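{- For any $\varepsilon>0$ and any integer $d\geq 2$ there exist positive constants $c_1$ and $c_2$ depending only on $d$ and $\varepsilon$ such that for every prime $p$ the following holds. If $f\in\mathbb{F}_p[X]$ is of degree at most $d$, $\mathscr{P}_0\geq c_1$, $u\in\mathbb{F}_p$, and $N\ge 1$ is an integer with $N<T_u$, then $$ G(N)\geq c_2\min\left\{N^{2-\varepsilon},\, p^{1-\varepsilon}\right\}. $$
   Context: Let $p$ be a prime, $\mathbb{F}_p$ the field of $p$ elements and $f\in\mathbb{F}_p[X]$. For $u\in\mathbb{F}_p$ let $(u_n)_{n\ge0}$ be the sequence $u_0=u$, $u_{n+1}=f(u_n)$ for $n=0,1,2,\ldots$. The trajectory length $T_u$ is the smallest integer $t$ for which there is an integer $s$ with $0\leq s<t$ and $u_s=u_t$. For $v\in\mathbb{F}_p$, $\mathscr{P}_v$ is the period length of the sequence with starting point $v$: the minimal integer $m>0$ such that $u_n=u_{n+m}$ for all $n=0,1,\ldots$ (where $u_0=v$), with $\mathscr{P}_v=\infty$ if the sequence is not purely periodic (only eventually periodic). In particular $\mathscr{P}_0$ is this quantity for the starting point $v=0$. $G(N)$ (depending also on $u$ and $f$) is the size of the smallest subgroup $\mathcal{G}\subseteq\mathbb{F}_p^*$ which contains the non-zero elements among $u_1,\ldots,u_N$, i.e. $u_n\in\mathcal{G}\cup\{0\}$ for $n=1,\ldots,N$. -}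

module Defs where

open import Level using (0ℓ)
open import Data.Empty using (⊥)
open import Data.Unit using (⊤)
open import Data.Nat as ℕ using (ℕ; zero; suc; NonZero)
open import Data.Nat.Properties using (m^n≢0)
open import Data.Nat.DivMod using (_mod_)
open import Data.Integer as ℤ using (ℤ; +_; -[1+_])
open import Data.Rational as ℚ using (ℚ; 0ℚ; ↥_; ↧ₙ_)
open import Data.Fin using (Fin; toℕ)
open import Data.Fin.Subset using (Subset; _∈_; _∉_; _⊆_; ∣_∣)
open import Data.List using (List; []; _∷_; foldr)
open import Data.Product using (_×_; ∃-syntax; _,_)
open import Data.Sum using (_⊎_)
open import Relation.Nullary using (¬_)
open import Relation.Nullary.Construct.Add.Supremum using (_⁺; [_]; ⊤⁺)
open import Relation.Unary as Pred using (Pred)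
open import Relation.Binary.PropositionalEquality using (_≡_; _≢_)
open import Algebra.Definitions.RawSemiring ℚ.+-*-rawSemiring using (_^_)

fromℕ : ℕ → ℚ
fromℕ n = + n ℚ./ 1

-- Two-sided Dedekind reals.
record ℝ : Set₁ where
  field
    lower upper : Pred ℚ 0ℓ
    lower-inhabited : ∃[ q ] lower q
    upper-inhabited : ∃[ q ] upper q
    lower-closed : ∀ {q r} → q ℚ.< r → lower r → lower q
    upper-closed : ∀ {q r} → q ℚ.< r → upper q → upper r
    lower-open : ∀ {q} → lower q → ∃[ r ] (q ℚ.< r × lower r)
    upper-open : ∀ {r} → upper r → ∃[ q ] (q ℚ.< r × upper q)
    disjoint : ∀ {q} → lower q → upper q → ⊥
    located : ∀ {q r} → q ℚ.< r → lower q ⊎ upper r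

Positive : ℝ → Set
Positive x = ℝ.lower x 0ℚ

-- A lower cut {q ∈ ℚ | q < x} is enough to say that a real x is bounded above
-- by an integer, so the quantities in the final inequality are given by theirs.
LowerCut : Set₁
LowerCut = Pred ℚ 0ℓ

-- q < k − x  ⇔  x < k − q
infixl 6 _⊖_
_⊖_ : ℕ → ℝ → LowerCut
(k ⊖ x) q = ℝ.upper x (fromℕ k ℚ.- q)

infixr 8 _^ℤ_ _^ℝ_
_^ℤ_ : (n : ℕ) .{{_ : NonZero n}} → ℤ → ℚ
n ^ℤ (+ k)    = fromℕ (n ℕ.^ k)
n ^ℤ -[1+ k ] = (ℚ._/_ (+ 1) (n ℕ.^ suc k)) {{m^n≢0 n (suc k)}}

-- For n ≥ 1, n ^ x is the supremum of n ^ s over the rationals s < x.  Writing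
-- s = a / b with b > 0, one has q < n ^ s iff q < 0 or q ^ b < n ^ a.
_^ℝ_ : (n : ℕ) .{{_ : NonZero n}} → LowerCut → LowerCut
(n ^ℝ x) q = ∃[ s ] (x s × (q ℚ.< 0ℚ ⊎ q ^ (↧ₙ s) ℚ.< n ^ℤ (↥ s)))

min : LowerCut → LowerCut → LowerCut
min x y = x Pred.∩ y

-- Scaling by c > 0.
infixl 7 _·_
_·_ : ℚ → LowerCut → LowerCut
(c · x) q = ∃[ r ] (x r × q ℚ.≤ c ℚ.* r)

infix 4 _≤ᴸ_
_≤ᴸ_ : LowerCut → ℕ → Set
x ≤ᴸ g = ∀ q → x q → q ℚ.< fromℕ g

-- ℕ ⁺ is ℕ with a top element ⊤⁺ playing the role of ∞.
infix 4 _≤∞_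
_≤∞_ : ℚ → ℕ ⁺ → Set
c ≤∞ [ m ] = c ℚ.≤ fromℕ m
c ≤∞ ⊤⁺    = ⊤

IsLeast : Pred ℕ 0ℓ → ℕ → Set
IsLeast P m = P m × (∀ n → P n → m ℕ.≤ n)

𝔽 : ℕ → Set
𝔽 p = Fin p

-- Coefficient lists, constant term first; trailing zeros are allowed.
Poly : ℕ → Set
Poly p = List (𝔽 p)

module _ {p : ℕ} .{{_ : NonZero p}} where

  0# 1# : 𝔽 p
  0# = 0 mod p
  1# = 1 mod p

  infixl 6 _+_
  infixl 7 _*_
  _+_ _*_ : 𝔽 p → 𝔽 p → 𝔽 p
  a + b = (toℕ a ℕ.+ toℕ b) mod p
  a * b = (toℕ a ℕ.* toℕ b) mod p

  coeff : Poly p → ℕ → 𝔽 p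
  coeff []      _       = 0#
  coeff (a ∷ _) zero    = a
  coeff (_ ∷ f) (suc i) = coeff f i

  DegreeAtMost : ℕ → Poly p → Set
  DegreeAtMost d f = ∀ i → d ℕ.< i → coeff f i ≡ 0#

  eval : Poly p → 𝔽 p → 𝔽 p
  eval f x = foldr (λ a y → a + x * y) 0# f

  orbit : Poly p → 𝔽 p → ℕ → 𝔽 p
  orbit f u zero    = u
  orbit f u (suc n) = eval f (orbit f u n)

  IsTrajectoryLength : Poly p → 𝔽 p → ℕ → Set
  IsTrajectoryLength f u =
    IsLeast (λ t → ∃[ s ] (s ℕ.< t × orbit f u s ≡ orbit f u t))

  IsPeriod : Poly p → 𝔽 p → ℕ → Set
  IsPeriod f v m = 0 ℕ.< m × (∀ n → orbit f v n ≡ orbit f v (n ℕ.+ m))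

  IsPeriodLength : Poly p → 𝔽 p → ℕ ⁺ → Set
  IsPeriodLength f v [ m ] = IsLeast (IsPeriod f v) m
  IsPeriodLength f v ⊤⁺    = ∀ m → ¬ IsPeriod f v m

  record IsSubgroup (S : Subset p) : Set where
    field
      0∉S       : 0# ∉ S
      1∈S       : 1# ∈ S
      *-closed  : ∀ {x y} → x ∈ S → y ∈ S → x * y ∈ S
      ⁻¹-closed : ∀ {x} → x ∈ S → ∃[ y ] (y ∈ S × x * y ≡ 1#)

  ContainsOrbit : Poly p → 𝔽 p → ℕ → Subset p → Set
  ContainsOrbit f u N S =
    ∀ n → 1 ℕ.≤ n → n ℕ.≤ N → orbit f u n ≢ 0# → orbit f u n ∈ S

  IsSmallestSubgroup : Poly p → 𝔽 p → ℕ → Subset p → Set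
  IsSmallestSubgroup f u N S =
    IsSubgroup S × ContainsOrbit f u N S ×
    (∀ S′ → IsSubgroup S′ → ContainsOrbit f u N S′ → S ⊆ S′)

  IsG : Poly p → 𝔽 p → ℕ → ℕ → Set
  IsG f u N g = ∃[ S ] (IsSmallestSubgroup f u N S × ∣ S ∣ ≡ g)

-- Write P i for the i-th iterate of f, 0 ≤ i < n.  As P (i + r) ≡ f^(r)(0) modulo P i, a long
-- period of 0 makes the P i pairwise coprime.  Many consecutive u_j give points x at which
-- all the values P i x lie in a subgroup of order t, that is (P i x)^t = 1, and Stepanov's
-- method bounds the number of such x.  Let E b = ∏ (P i) ^ (t * b i), where the b i are < B.
-- Since Q (E b)′ = E b * ℓ b with Q = ∏ P i and ℓ b of small degree, counting coefficients
-- yields c b of small degree, not all 0, such that Ψ = ∑ E b * c b vanishes to high order at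
-- every such x, and the degree of Ψ bounds their number, provided that Ψ ≠ 0.  For the last
-- point, differentiate a shortest relation ∑ E b * c b = 0: the vector (E b) is then, up to a
-- factor, the only solution of a linear system with small coefficients, so that it is
-- proportional to a vector of small degree.  This is impossible, as by coprimality the
-- quotients E b / E b′ have degree at least t in lowest terms.  With n = 4k + 2 and B of the
-- order of t ^ (1 / 2n), the result is the exponent 2 − 1 / (k + 1).

module Submission where

open import Algebra using (CommutativeRing; IsCommutativeRing)
import Algebra.Solver.Ring.NaturalCoefficients.Default as SemiringSolver
open import Data.Bool using (true; false; if_then_else_)
open import Data.Fin as Fin using (Fin; zero; suc; toℕ; fromℕ<; combine; remQuot; finToFun; funToFin;
    punchIn; punchOut)
open import Data.Fin.Permutation using (Permutation; permutation)
import Data.Fin.Properties as Fin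
open import Data.Fin.Subset using (Subset; _∈_; _∉_; ∣_∣) renaming (_-_ to _⊝_)
open import Data.Fin.Subset.Properties using (x∈p⇒∣p-x∣<∣p∣; x∈p∧x≢y⇒x∈p-y)
open import Data.List using (List; []; _∷_; foldr; map; tabulate)
open import Data.Nat as ℕ using (ℕ; zero; suc; z≤n; s≤s; z<s; s<s; _≤_; _<_; NonZero)
open import Data.Nat.Coprimality using (prime⇒coprime; coprime-Bézout)
open import Data.Nat.Divisibility using (∣⇒≤; _∣0; ∣m+n∣m⇒∣n; m%n≡0⇒n∣m) renaming (_∣_ to _∣ℕ_; _∣?_ to _∣ℕ?_)
open import Data.Nat.DivMod using (_%_; _mod_; %-distribˡ-+; %-distribˡ-*; m<n⇒m%n≡m; n%n≡0; m*n%n≡0; m%n<n)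
open import Data.Nat.GCD using (module Bézout)
open import Data.Nat.Primality using (Prime; prime⇒nonTrivial; ¬prime[0])
import Data.Nat.Properties as ℕ
open import Data.Nat.Tactic.RingSolver using (solve-∀)
open import Data.Product using (_×_; Σ-syntax; ∃-syntax; ∃₂; _,_; proj₁; proj₂)
open import Data.Rational as ℚ using (ℚ; mkℚ; 0ℚ; 1ℚ; ↥_; ↧ₙ_; toℚᵘ) renaming (_<_ to _<ℚ_)
import Data.Rational.Properties as ℚ
open import Data.Sum using (_⊎_; inj₁; inj₂; [_,_]′)
open import Data.Vec using (lookup; []; _∷_)
open import Data.Vec.Properties using ([]=⇒lookup; lookup⇒[]=)
import Defs
open import Function using (_∘_; id)
open import Level using (0ℓ)
open import Relation.Binary using (DecidableEquality; tri<; tri≈; tri>)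
open import Relation.Binary.PropositionalEquality using
    (_≡_; _≢_; _≗_; refl; sym; trans; cong; cong₂; subst; subst₂; isEquivalence; module ≡-Reasoning)
import Relation.Binary.Reasoning.Setoid as SetoidReasoning
open import Relation.Nullary using (¬_; Dec; yes; no; contradiction; ¬?)

-- Characteristic p shapes the argument. A vanishing Wronskian gives a relation whose coefficients
-- have derivative 0, and these include all polynomials in X ^ p. The relation descends to one over
-- the field of p elements when the polynomials involved have degree below p, so every `E b * c b`
-- is kept below that degree. As this degree is of the order of t * B, the method stops when t * B
-- reaches a constant multiple of p; then t is already large in terms of p, which is the second term
-- of the minimum. The size of B is limited by the comparison of degrees that ends the overview:
-- with L = B ^ n products, the vector of small degree has degree at most 2 * n * d ^ n * L ^ 2, and
-- this must stay below t. The order of vanishing is m = B ^ (n - 1), hence the number of points is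
-- O(t * B / m) = O(t / B ^ (n - 2)). For n = 4k + 2 one has (n - 2) / 2n = k / (2k + 1), which
-- turns this into O(t ^ ((k + 1) / (2k + 1))).

record PropositionalRing (F : Set) : Set where
  infixl 6 _+_
  infixl 7 _*_
  infix 8 -_
  field
    _+_ _*_ : F → F → F
    -_ : F → F
    0# 1# : F
    isCommutativeRing : IsCommutativeRing _≡_ _+_ _*_ -_ 0# 1#

  commutativeRing : CommutativeRing 0ℓ 0ℓ
  commutativeRing = record { isCommutativeRing = isCommutativeRing }

  open CommutativeRing commutativeRing public
    using (+-identityˡ; +-identityʳ; +-assoc; +-comm; *-identityˡ; *-identityʳ; *-assoc;
           *-comm; zeroˡ; zeroʳ; -‿inverseʳ)

-- Cauchy products of coefficient sequences.

module PowerSeries {F : Set} (𝔽 : PropositionalRing F) where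

  open PropositionalRing 𝔽

  open SemiringSolver (CommutativeRing.commutativeSemiring commutativeRing)

  infixl 7 _⊛_

  -- Recursion on the index, shifting the first factor, avoids finite sums and subtraction of
  -- indices.
  _⊛_ : (ℕ → F) → (ℕ → F) → ℕ → F
  (f ⊛ g) zero    = f 0 * g 0
  (f ⊛ g) (suc n) = f 0 * g (suc n) + (f ∘ suc ⊛ g) n

  ⊛-cong : ∀ {f f′ g g′} → f ≗ f′ → g ≗ g′ → f ⊛ g ≗ f′ ⊛ g′
  ⊛-cong p q zero    = cong₂ _*_ (p 0) (q 0)
  ⊛-cong p q (suc n) = cong₂ _+_ (cong₂ _*_ (p 0) (q (suc n))) (⊛-cong (p ∘ suc) q n)

  -- The defining recursion peels off the first factor; this mirror image of it is what
  -- commutativity rests on.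
  ⊛-suc : ∀ f g n → (f ⊛ g) (suc n) ≡ g 0 * f (suc n) + (f ⊛ g ∘ suc) n
  ⊛-suc f g zero    = lem (f 0) (g 1) (f 1) (g 0)
    where
    lem : ∀ a b c d → a * b + c * d ≡ d * c + a * b
    lem = solve 4 (λ a b c d → a :* b :+ c :* d := d :* c :+ a :* b) refl
  ⊛-suc f g (suc n) = begin
    f 0 * g (suc (suc n)) + (f ∘ suc ⊛ g) (suc n)
      ≡⟨ cong (f 0 * g (suc (suc n)) +_) (⊛-suc (f ∘ suc) g n) ⟩
    f 0 * g (suc (suc n)) + (g 0 * f (suc (suc n)) + (f ∘ suc ⊛ g ∘ suc) n)
      ≡⟨ lem (f 0 * g (suc (suc n))) (g 0 * f (suc (suc n))) ((f ∘ suc ⊛ g ∘ suc) n) ⟩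
    g 0 * f (suc (suc n)) + (f ⊛ g ∘ suc) (suc n) ∎
    where
    open ≡-Reasoning
    lem : ∀ a b c → a + (b + c) ≡ b + (a + c)
    lem = solve 3 (λ a b c → a :+ (b :+ c) := b :+ (a :+ c)) refl

  ⊛-comm : ∀ f g → f ⊛ g ≗ g ⊛ f
  ⊛-comm f g zero    = *-comm (f 0) (g 0)
  ⊛-comm f g (suc n) = trans (cong (f 0 * g (suc n) +_) (⊛-comm (f ∘ suc) g n)) (sym (⊛-suc g f n))

  ⊛-distribʳ-+ : ∀ f g h → (λ n → f n + g n) ⊛ h ≗ λ n → (f ⊛ h) n + (g ⊛ h) n
  ⊛-distribʳ-+ f g h zero    = lem (f 0) (g 0) (h 0)
    where
    lem : ∀ a b c → (a + b) * c ≡ a * c + b * c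
    lem = solve 3 (λ a b c → (a :+ b) :* c := a :* c :+ b :* c) refl
  ⊛-distribʳ-+ f g h (suc n) =
    trans (cong ((f 0 + g 0) * h (suc n) +_) (⊛-distribʳ-+ (f ∘ suc) (g ∘ suc) h n))
          (lem (f 0) (g 0) (h (suc n)) _ _)
    where
    lem : ∀ a b c d e → (a + b) * c + (d + e) ≡ (a * c + d) + (b * c + e)
    lem = solve 5 (λ a b c d e → (a :+ b) :* c :+ (d :+ e) := (a :* c :+ d) :+ (b :* c :+ e)) refl

  ⊛-scaleˡ : ∀ a f g → (λ n → a * f n) ⊛ g ≗ λ n → a * (f ⊛ g) n
  ⊛-scaleˡ a f g zero    = lem a (f 0) (g 0)
    where
    lem : ∀ a b c → a * b * c ≡ a * (b * c)
    lem = solve 3 (λ a b c → a :* b :* c := a :* (b :* c)) refl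
  ⊛-scaleˡ a f g (suc n) =
    trans (cong (a * f 0 * g (suc n) +_) (⊛-scaleˡ a (f ∘ suc) g n)) (lem a (f 0) (g (suc n)) _)
    where
    lem : ∀ a b c d → a * b * c + a * d ≡ a * (b * c + d)
    lem = solve 4 (λ a b c d → a :* b :* c :+ a :* d := a :* (b :* c :+ d)) refl

  ⊛-zeroˡ : ∀ f g → (∀ n → f n ≡ 0#) → ∀ n → (f ⊛ g) n ≡ 0#
  ⊛-zeroˡ f g p zero    = trans (cong (_* g 0) (p 0)) (zeroˡ _)
  ⊛-zeroˡ f g p (suc n) =
    trans (cong₂ _+_ (trans (cong (_* g (suc n)) (p 0)) (zeroˡ _)) (⊛-zeroˡ (f ∘ suc) g (p ∘ suc) n))
        (+-identityˡ _)

  ⊛-head : ∀ n f g → (∀ i → i ℕ.< n → f (suc i) ≡ 0#) → (f ⊛ g) n ≡ f 0 * g n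
  ⊛-head zero    f g p = refl
  ⊛-head (suc n) f g p = trans
    (cong (f 0 * g (suc n) +_) (trans (⊛-head n (f ∘ suc) g (λ i i<n → p (suc i) (s<s i<n)))
        (trans (cong (_* g n) (p 0 z<s)) (zeroˡ _))))
    (+-identityʳ _)

  -- Together with `⊛-head` this isolates a single term of a coefficient of a product: one removes
  -- the terms before it, the other those after it.
  ⊛-skip : ∀ m n f g → (∀ i j → i ℕ.< m → i ℕ.+ j ≡ m ℕ.+ n → f i * g j ≡ 0#) →
           (f ⊛ g) (m ℕ.+ n) ≡ ((λ i → f (m ℕ.+ i)) ⊛ g) n
  ⊛-skip zero    n f g p = refl
  ⊛-skip (suc m) n f g p = trans
    (cong₂ _+_ (p 0 _ z<s refl) (⊛-skip m n (f ∘ suc) g (λ i j i<m q → p (suc i) j (s<s i<m) (cong suc q))))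
    (+-identityˡ _)

  ⊛-assoc : ∀ f g h → (f ⊛ g) ⊛ h ≗ f ⊛ (g ⊛ h)
  ⊛-assoc f g h zero    = lem (f 0) (g 0) (h 0)
    where
    lem : ∀ a b c → a * b * c ≡ a * (b * c)
    lem = solve 3 (λ a b c → a :* b :* c := a :* (b :* c)) refl
  ⊛-assoc f g h (suc n) = begin
    f 0 * g 0 * h (suc n) + ((λ i → f 0 * g (suc i) + (f ∘ suc ⊛ g) i) ⊛ h) n
      ≡⟨ cong (f 0 * g 0 * h (suc n) +_) (⊛-distribʳ-+ (λ i → f 0 * g (suc i)) (f ∘ suc ⊛ g) h n) ⟩
    f 0 * g 0 * h (suc n) + (((λ i → f 0 * g (suc i)) ⊛ h) n + ((f ∘ suc ⊛ g) ⊛ h) n)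
      ≡⟨ cong (f 0 * g 0 * h (suc n) +_) (cong₂ _+_ (⊛-scaleˡ (f 0) (g ∘ suc) h n) (⊛-assoc (f ∘ suc) g h n)) ⟩
    f 0 * g 0 * h (suc n) + (f 0 * (g ∘ suc ⊛ h) n + (f ∘ suc ⊛ (g ⊛ h)) n)
      ≡⟨ lem (f 0) (g 0) (h (suc n)) _ _ ⟩
    f 0 * (g 0 * h (suc n) + (g ∘ suc ⊛ h) n) + (f ∘ suc ⊛ (g ⊛ h)) n ∎
    where
    open ≡-Reasoning
    lem : ∀ a b c d e → a * b * c + (a * d + e) ≡ a * (b * c + d) + e
    lem = solve 5 (λ a b c d e → a :* b :* c :+ (a :* d :+ e) := a :* (b :* c :+ d) :+ e) refl

  ⊛-above : ∀ a b f g → (∀ i → a ℕ.< i → f i ≡ 0#) → (∀ i → b ℕ.< i → g i ≡ 0#) →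
            ∀ i → a ℕ.+ b ℕ.< i → (f ⊛ g) i ≡ 0#
  ⊛-above zero    b f g p q (suc n) b<n = trans
    (cong₂ _+_ (trans (cong (f 0 *_) (q (suc n) b<n)) (zeroʳ _)) (⊛-zeroˡ (f ∘ suc) g (λ i → p (suc i) z<s) n))
    (+-identityˡ _)
  ⊛-above (suc a) b f g p q (suc n) (s<s a+b<n) = trans
    (cong₂ _+_ (trans (cong (f 0 *_) (q (suc n) (ℕ.m<n⇒m<1+n (ℕ.≤-<-trans (ℕ.m≤n+m b a) a+b<n)))) (zeroʳ _))
               (⊛-above a b (f ∘ suc) g (λ i a<i → p (suc i) (s<s a<i)) q n a+b<n))
    (+-identityˡ _)

  ⊛-top : ∀ a b f g → (∀ i → a ℕ.< i → f i ≡ 0#) → (∀ i → b ℕ.< i → g i ≡ 0#) →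
          (f ⊛ g) (a ℕ.+ b) ≡ f a * g b
  ⊛-top zero    zero    f g p q = refl
  ⊛-top zero    (suc b) f g p q = trans
    (cong (f 0 * g (suc b) +_) (⊛-zeroˡ (f ∘ suc) g (λ i → p (suc i) z<s) b)) (+-identityʳ _)
  ⊛-top (suc a) b       f g p q = trans
    (cong₂ _+_ (trans (cong (f 0 *_) (q (suc (a ℕ.+ b)) (s≤s (ℕ.m≤n+m b a)))) (zeroʳ _))
               (⊛-top a b (f ∘ suc) g (λ i a<i → p (suc i) (s<s a<i)) q))
    (+-identityˡ _)

-- Polynomials as coefficient lists: ring structure, formal derivative, evaluation.

module Polynomials {F : Set} (𝔽 : PropositionalRing F) where

  open PropositionalRing 𝔽
  open PowerSeries 𝔽
  open SemiringSolver (CommutativeRing.commutativeSemiring commutativeRing)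
  open import Algebra.Properties.Semiring.Mult (CommutativeRing.semiring commutativeRing) using (×-comm-*)
      renaming (_×_ to _×ᶠ_) public

  ×-zero : ∀ n → n ×ᶠ 0# ≡ 0#
  ×-zero zero    = refl
  ×-zero (suc n) = trans (+-identityˡ _) (×-zero n)

  ×-distrib-+ : ∀ n x y → n ×ᶠ (x + y) ≡ n ×ᶠ x + n ×ᶠ y
  ×-distrib-+ zero    x y = sym (+-identityˡ _)
  ×-distrib-+ (suc n) x y = trans (cong (x + y +_) (×-distrib-+ n x y))
    (solve 4 (λ x y a b → x :+ y :+ (a :+ b) := x :+ a :+ (y :+ b)) refl x y (n ×ᶠ x) (n ×ᶠ y))

  Poly : Set
  Poly = List F

  coeff : Poly → ℕ → F
  coeff []      _       = 0#
  coeff (a ∷ _) zero    = a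
  coeff (_ ∷ f) (suc i) = coeff f i

  infix 4 _≈_
  -- Coefficientwise equality disregards trailing zeros. As a record it lets `f` and `g` be
  -- recovered from the type of a proof.
  record _≈_ (f g : Poly) : Set where
    constructor mk≈
    field at : coeff f ≗ coeff g
  open _≈_ public

  eval : Poly → F → F
  eval f x = foldr (λ a y → a + x * y) 0# f

  ≈-refl : ∀ {f} → f ≈ f
  ≈-refl .at _ = refl
  ≈-sym : ∀ {f g} → f ≈ g → g ≈ f
  ≈-sym p .at i = sym (at p i)
  ≈-trans : ∀ {f g h} → f ≈ g → g ≈ h → f ≈ h
  ≈-trans p q .at i = trans (at p i) (at q i)

  infixl 6 _+ᴾ_
  infixl 7 _*ᴾ_ _·ᴾ_
  abstract
    _+ᴾ_ : Poly → Poly → Poly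
    []      +ᴾ g       = g
    (a ∷ f) +ᴾ []      = a ∷ f
    (a ∷ f) +ᴾ (b ∷ g) = a + b ∷ f +ᴾ g

    _·ᴾ_ : F → Poly → Poly
    a ·ᴾ f = map (a *_) f

    -ᴾ_ : Poly → Poly
    -ᴾ f = map -_ f

    _*ᴾ_ : Poly → Poly → Poly
    []      *ᴾ g = []
    (a ∷ f) *ᴾ g = a ·ᴾ g +ᴾ (0# ∷ f *ᴾ g)

    C : F → Poly
    C a = a ∷ []

    X : Poly
    X = 0# ∷ 1# ∷ []

    -0≡0 : - 0# ≡ 0#
    -0≡0 = trans (sym (+-identityˡ _)) (-‿inverseʳ 0#)

    coeff-+ : ∀ f g i → coeff (f +ᴾ g) i ≡ coeff f i + coeff g i
    coeff-+ []      g       i       = sym (+-identityˡ _)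
    coeff-+ (a ∷ f) []      i       = sym (+-identityʳ _)
    coeff-+ (a ∷ f) (b ∷ g) zero    = refl
    coeff-+ (a ∷ f) (b ∷ g) (suc i) = coeff-+ f g i

    coeff-· : ∀ a f i → coeff (a ·ᴾ f) i ≡ a * coeff f i
    coeff-· a []      i       = sym (zeroʳ a)
    coeff-· a (b ∷ f) zero    = refl
    coeff-· a (b ∷ f) (suc i) = coeff-· a f i

    coeff-neg : ∀ f i → coeff (-ᴾ f) i ≡ - coeff f i
    coeff-neg []      i       = sym -0≡0
    coeff-neg (b ∷ f) zero    = refl
    coeff-neg (b ∷ f) (suc i) = coeff-neg f i

    coeff-* : ∀ f g → coeff (f *ᴾ g) ≗ coeff f ⊛ coeff g
    coeff-* []      g n       = sym (⊛-zeroˡ _ (coeff g) (λ _ → refl) n)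
    coeff-* (a ∷ f) g zero    =
      trans (coeff-+ (a ·ᴾ g) (0# ∷ f *ᴾ g) 0) (trans (+-identityʳ _) (coeff-· a g 0))
    coeff-* (a ∷ f) g (suc n) =
      trans (coeff-+ (a ·ᴾ g) (0# ∷ f *ᴾ g) (suc n)) (cong₂ _+_ (coeff-· a g (suc n)) (coeff-* f g n))

    coeff-C : ∀ a n → coeff (C a) (suc n) ≡ 0#
    coeff-C a n = refl

    coeff-C0 : ∀ i → coeff (C 0#) i ≡ 0#
    coeff-C0 zero    = refl
    coeff-C0 (suc i) = refl

    coeff-C* : ∀ a f i → coeff (C a *ᴾ f) i ≡ a * coeff f i
    coeff-C* a f i = trans (coeff-+ (a ·ᴾ f) (C 0#) i)
        (trans (cong₂ _+_ (coeff-· a f i) (coeff-C0 i)) (+-identityʳ _))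

    +ᴾ-cong : ∀ {f f′ g g′} → f ≈ f′ → g ≈ g′ → f +ᴾ g ≈ f′ +ᴾ g′
    +ᴾ-cong {f} {f′} {g} {g′} p q .at i =
      trans (coeff-+ f g i) (trans (cong₂ _+_ (at p i) (at q i)) (sym (coeff-+ f′ g′ i)))

    *ᴾ-cong : ∀ {f f′ g g′} → f ≈ f′ → g ≈ g′ → f *ᴾ g ≈ f′ *ᴾ g′
    *ᴾ-cong {f} {f′} {g} {g′} p q .at i =
      trans (coeff-* f g i) (trans (⊛-cong (at p) (at q) i) (sym (coeff-* f′ g′ i)))

    *ᴾ-comm : ∀ f g → f *ᴾ g ≈ g *ᴾ f
    *ᴾ-comm f g .at i = trans (coeff-* f g i) (trans (⊛-comm (coeff f) (coeff g) i) (sym (coeff-* g f i)))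

    *ᴾ-assoc : ∀ f g h → (f *ᴾ g) *ᴾ h ≈ f *ᴾ (g *ᴾ h)
    *ᴾ-assoc f g h .at i = begin
      coeff ((f *ᴾ g) *ᴾ h) i         ≡⟨ coeff-* (f *ᴾ g) h i ⟩
      (coeff (f *ᴾ g) ⊛ coeff h) i    ≡⟨ ⊛-cong (coeff-* f g) (λ _ → refl) i ⟩
      ((coeff f ⊛ coeff g) ⊛ coeff h) i ≡⟨ ⊛-assoc (coeff f) (coeff g) (coeff h) i ⟩
      (coeff f ⊛ (coeff g ⊛ coeff h)) i ≡⟨ ⊛-cong (λ _ → refl) (coeff-* g h) i ⟨
      (coeff f ⊛ coeff (g *ᴾ h)) i    ≡⟨ coeff-* f (g *ᴾ h) i ⟨
      coeff (f *ᴾ (g *ᴾ h)) i ∎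
      where open ≡-Reasoning

    *ᴾ-distribʳ : ∀ h f g → (f +ᴾ g) *ᴾ h ≈ f *ᴾ h +ᴾ g *ᴾ h
    *ᴾ-distribʳ h f g .at i = begin
      coeff ((f +ᴾ g) *ᴾ h) i       ≡⟨ coeff-* (f +ᴾ g) h i ⟩
      (coeff (f +ᴾ g) ⊛ coeff h) i  ≡⟨ ⊛-cong (coeff-+ f g) (λ _ → refl) i ⟩
      ((λ n → coeff f n + coeff g n) ⊛ coeff h) i ≡⟨ ⊛-distribʳ-+ (coeff f) (coeff g) (coeff h) i ⟩
      (coeff f ⊛ coeff h) i + (coeff g ⊛ coeff h) i ≡⟨ cong₂ _+_ (coeff-* f h i) (coeff-* g h i) ⟨
      coeff (f *ᴾ h) i + coeff (g *ᴾ h) i ≡⟨ coeff-+ (f *ᴾ h) (g *ᴾ h) i ⟨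
      coeff (f *ᴾ h +ᴾ g *ᴾ h) i ∎
      where open ≡-Reasoning

    *ᴾ-identityˡ : ∀ f → C 1# *ᴾ f ≈ f
    *ᴾ-identityˡ f .at i = trans (coeff-C* 1# f i) (*-identityˡ _)

    isCommutativeRingᴾ : IsCommutativeRing _≈_ _+ᴾ_ _*ᴾ_ -ᴾ_ [] (C 1#)
    isCommutativeRingᴾ = record
      { isRing = record
        { +-isAbelianGroup = record
          { isGroup = record
            { isMonoid = record
              { isSemigroup = record
                { isMagma = record
                  { isEquivalence = record { refl = ≈-refl ; sym = ≈-sym ; trans = ≈-trans }
                  ; ∙-cong = +ᴾ-cong }
                ; assoc = λ f g h → mk≈ λ i → begin
                    coeff (f +ᴾ g +ᴾ h) i               ≡⟨ trans (coeff-+ (f +ᴾ g) h i)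
                        (cong (_+ coeff h i) (coeff-+ f g i)) ⟩
                    coeff f i + coeff g i + coeff h i   ≡⟨ +-assoc _ _ _ ⟩
                    coeff f i + (coeff g i + coeff h i) ≡⟨ trans (coeff-+ f (g +ᴾ h) i)
                        (cong (coeff f i +_) (coeff-+ g h i)) ⟨
                    coeff (f +ᴾ (g +ᴾ h)) i ∎ }
              ; identity = (λ f → ≈-refl) , λ f → mk≈ λ i → trans (coeff-+ f [] i) (+-identityʳ _) }
            ; inverse = (λ f → mk≈ λ i → trans (coeff-+ (-ᴾ f) f i)
                (trans (cong (_+ coeff f i) (coeff-neg f i)) (trans (+-comm _ _) (-‿inverseʳ _))))
                      , (λ f → mk≈ λ i → trans (coeff-+ f (-ᴾ f) i)
                          (trans (cong (coeff f i +_) (coeff-neg f i)) (-‿inverseʳ _)))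
            ; ⁻¹-cong = λ {f} {g} p → mk≈ λ i → trans (coeff-neg f i)
                (trans (cong -_ (at p i)) (sym (coeff-neg g i))) }
          ; comm = λ f g → mk≈ λ i → trans (coeff-+ f g i) (trans (+-comm _ _) (sym (coeff-+ g f i))) }
        ; *-cong = *ᴾ-cong
        ; *-assoc = *ᴾ-assoc
        ; *-identity = *ᴾ-identityˡ , λ f → ≈-trans (*ᴾ-comm f (C 1#)) (*ᴾ-identityˡ f)
        ; distrib = (λ f g h → ≈-trans (*ᴾ-comm f (g +ᴾ h))
            (≈-trans (*ᴾ-distribʳ f g h) (+ᴾ-cong (*ᴾ-comm g f) (*ᴾ-comm h f))))
                  , *ᴾ-distribʳ }
      ; *-comm = *ᴾ-comm }
      where open ≡-Reasoning

    cons-≈ : ∀ a f → a ∷ f ≈ C a +ᴾ X *ᴾ f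
    cons-≈ a f = ≈-sym (mk≈ λ i → trans (coeff-+ (C a) (X *ᴾ f) i) (lem i))
      where
      open ≡-Reasoning
      tail-X : ∀ n → (coeff (1# ∷ []) ⊛ coeff f) n ≡ coeff f n
      tail-X n = trans (sym (coeff-* (C 1#) f n)) (at (*ᴾ-identityˡ f) n)
      lem : ∀ i → coeff (C a) i + coeff (X *ᴾ f) i ≡ coeff (a ∷ f) i
      lem zero    = trans (cong (a +_) (trans (coeff-* X f 0) (zeroˡ _))) (+-identityʳ a)
      lem (suc i) = begin
        0# + coeff (X *ᴾ f) (suc i)                        ≡⟨ +-identityˡ _ ⟩
        coeff (X *ᴾ f) (suc i)                             ≡⟨ coeff-* X f (suc i) ⟩
        0# * coeff f (suc i) + (coeff (1# ∷ []) ⊛ coeff f) i ≡⟨ cong₂ _+_ (zeroˡ _) (tail-X i) ⟩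
        0# + coeff f i                                     ≡⟨ +-identityˡ _ ⟩
        coeff f i ∎

    D : Poly → Poly
    D []      = []
    D (a ∷ f) = f +ᴾ (0# ∷ D f)

    coeff-D : ∀ f i → coeff (D f) i ≡ suc i ×ᶠ coeff f (suc i)
    coeff-D []      i       = sym (×-zero (suc i))
    coeff-D (a ∷ f) zero    = coeff-+ f (0# ∷ D f) 0
    coeff-D (a ∷ f) (suc i) = trans (coeff-+ f (0# ∷ D f) (suc i)) (cong (coeff f (suc i) +_) (coeff-D f i))

    D-X* : ∀ f → D (X *ᴾ f) ≈ f +ᴾ X *ᴾ D f
    D-X* f .at i = begin
      coeff (D (X *ᴾ f)) i                  ≡⟨ coeff-D (X *ᴾ f) i ⟩
      suc i ×ᶠ coeff (X *ᴾ f) (suc i)        ≡⟨ cong (suc i ×ᶠ_) (at (shift f) (suc i)) ⟨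
      suc i ×ᶠ coeff (0# ∷ f) (suc i)        ≡⟨ coeff-D (0# ∷ f) i ⟨
      coeff (f +ᴾ (0# ∷ D f)) i             ≡⟨ at (+ᴾ-cong (≈-refl {f}) (shift (D f))) i ⟩
      coeff (f +ᴾ X *ᴾ D f) i ∎
      where
      open ≡-Reasoning
      shift : ∀ g → 0# ∷ g ≈ X *ᴾ g
      shift g = ≈-trans (cons-≈ 0# g) (mk≈ λ i → trans (coeff-+ (C 0#) (X *ᴾ g) i)
          (trans (cong (_+ coeff (X *ᴾ g) i) (coeff-C0 i)) (+-identityˡ _)))

    eval-+ : ∀ f g x → eval (f +ᴾ g) x ≡ eval f x + eval g x
    eval-+ []      g       x = sym (+-identityˡ _)
    eval-+ (a ∷ f) []      x = sym (+-identityʳ _)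
    eval-+ (a ∷ f) (b ∷ g) x = trans (cong (λ y → a + b + x * y) (eval-+ f g x))
      (solve 5 (λ a b x y z → a :+ b :+ x :* (y :+ z) := a :+ x :* y :+ (b :+ x :* z)) refl a b x (eval f x)
          (eval g x))

    eval-· : ∀ a f x → eval (a ·ᴾ f) x ≡ a * eval f x
    eval-· a []      x = sym (zeroʳ a)
    eval-· a (b ∷ f) x = trans (cong (λ y → a * b + x * y) (eval-· a f x))
      (solve 4 (λ a b x y → a :* b :+ x :* (a :* y) := a :* (b :+ x :* y)) refl a b x (eval f x))

    eval-* : ∀ f g x → eval (f *ᴾ g) x ≡ eval f x * eval g x
    eval-* []      g x = sym (zeroˡ _)
    eval-* (a ∷ f) g x = begin
      eval (a ·ᴾ g +ᴾ (0# ∷ f *ᴾ g)) x           ≡⟨ eval-+ (a ·ᴾ g) (0# ∷ f *ᴾ g) x ⟩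
      eval (a ·ᴾ g) x + (0# + x * eval (f *ᴾ g) x) ≡⟨ cong₂ (λ y z → y + (0# + x * z)) (eval-· a g x)
          (eval-* f g x) ⟩
      a * eval g x + (0# + x * (eval f x * eval g x))
        ≡⟨ solve 4 (λ a x y z → a :* z :+ (con 0 :+ x :* (y :* z)) := (a :+ x :* y) :* z) refl a x (eval f x)
            (eval g x) ⟩
      (a + x * eval f x) * eval g x ∎
      where open ≡-Reasoning

    eval-C : ∀ a x → eval (C a) x ≡ a
    eval-C a x = trans (cong (a +_) (zeroʳ x)) (+-identityʳ a)

    eval-X : ∀ x → eval X x ≡ x
    eval-X x = solve 1 (λ x → con 0 :+ x :* (con 1 :+ x :* con 0) := x) refl x

    coeff-C-zero : ∀ a → coeff (C a) 0 ≡ a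
    coeff-C-zero a = refl

    coeff-X-suc² : ∀ n → coeff X (suc (suc n)) ≡ 0#
    coeff-X-suc² n = refl

    coeff-X-one : coeff X 1 ≡ 1#
    coeff-X-one = refl

  polynomialRing : CommutativeRing 0ℓ 0ℓ
  polynomialRing = record { isCommutativeRing = isCommutativeRingᴾ }

-- Coprimality and divisibility in a commutative ring.

module Coprimality {c ℓ} (R : CommutativeRing c ℓ) where

  open CommutativeRing R hiding (zero; refl; sym; trans)
  open CommutativeRing R using () renaming (refl to ≈-refl; sym to ≈-sym; trans to ≈-trans)
  open SemiringSolver commutativeSemiring
  open import Algebra.Properties.Semiring.Exp semiring using (_^_)
  open SetoidReasoning setoid

  infix 4 _∣_
  _∣_ : Carrier → Carrier → Set _
  f ∣ g = ∃[ h ] f * h ≈ g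

  -- A Bézout identity rather than the absence of common factors: such identities multiply, so
  -- products and powers are handled without any factorisation theory.
  Coprime : Carrier → Carrier → Set _
  Coprime f g = ∃₂ λ u v → u * f + v * g ≈ 1#

  coprime-sym : ∀ {f g} → Coprime f g → Coprime g f
  coprime-sym (u , v , p) = v , u , ≈-trans (+-comm _ _) p

  coprime-1 : ∀ f → Coprime f 1#
  coprime-1 f = 0# , 1# , solve 1 (λ f → con 0 :* f :+ con 1 :* con 1 := con 1) ≈-refl f

  coprime-* : ∀ {f g h} → Coprime f g → Coprime f h → Coprime f (g * h)
  coprime-* {f} {g} {h} (u , v , p) (u′ , v′ , p′) =
    u * u′ * f + u * (v′ * h) + v * g * u′ , v * v′ , (begin
      (u * u′ * f + u * (v′ * h) + v * g * u′) * f + v * v′ * (g * h)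
        ≈⟨ solve 7 (λ u v u′ v′ f g h →
             (u :* u′ :* f :+ u :* (v′ :* h) :+ v :* g :* u′) :* f :+ v :* v′ :* (g :* h)
             := (u :* f :+ v :* g) :* (u′ :* f :+ v′ :* h)) ≈-refl u v u′ v′ f g h ⟩
      (u * f + v * g) * (u′ * f + v′ * h) ≈⟨ *-cong p p′ ⟩
      1# * 1#                             ≈⟨ *-identityˡ 1# ⟩
      1# ∎)

  coprime-^ʳ : ∀ {f g} n → Coprime f g → Coprime f (g ^ n)
  coprime-^ʳ {f} zero    p = coprime-1 f
  coprime-^ʳ {f} (suc n) p = coprime-* p (coprime-^ʳ n p)

  coprime-^ : ∀ {f g} m n → Coprime f g → Coprime (f ^ m) (g ^ n)
  coprime-^ m n p = coprime-sym (coprime-^ʳ m (coprime-sym (coprime-^ʳ n p)))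

  -- Euclid's lemma: in h = u f h + v g h both summands are multiples of `f`.
  coprime-∣ : ∀ {f g h} → Coprime f g → f ∣ g * h → f ∣ h
  coprime-∣ {f} {g} {h} (u , v , p) (k , q) = u * h + v * k , (begin
    f * (u * h + v * k)     ≈⟨ solve 5 (λ f u h v k → f :* (u :* h :+ v :* k) := u :* f :* h :+ v :*
        (f :* k)) ≈-refl f u h v k ⟩
    u * f * h + v * (f * k) ≈⟨ +-congˡ (*-congˡ q) ⟩
    u * f * h + v * (g * h) ≈⟨ solve 5 (λ f u h v g → u :* f :* h :+ v :* (g :* h) := (u :* f :+ v :* g) :*
        h) ≈-refl f u h v g ⟩
    (u * f + v * g) * h     ≈⟨ *-congʳ p ⟩
    1# * h                  ≈⟨ *-identityˡ h ⟩
    h ∎)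

  coprime-*-∣ : ∀ {f g h} → Coprime f g → f ∣ h → g ∣ h → f * g ∣ h
  coprime-*-∣ {f} {g} c f∣h (k , q) with coprime-∣ c (_ , ≈-trans (proj₂ f∣h) (≈-sym q))
  ... | l , r = l , ≈-trans (≈-trans (solve 3 (λ f g l → f :* g :* l := g :* (f :* l)) ≈-refl f g l)
      (*-congˡ r)) q

-- Fields with decidable equality and prime fields.

record DiscreteField (F : Set) : Set where
  field
    propositionalRing : PropositionalRing F
  open PropositionalRing propositionalRing public
  infix 4 _≟_
  field
    _≟_ : DecidableEquality F
    1≢0 : 1# ≢ 0#
    inverse : ∀ x → x ≢ 0# → ∃[ y ] x * y ≡ 1#

  x*y≢0 : ∀ {x y} → x ≢ 0# → y ≢ 0# → x * y ≢ 0#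
  x*y≢0 {x} {y} x≢0 y≢0 xy≡0 with inverse x x≢0
  ... | z , xz≡1 = y≢0 (begin
    y           ≡⟨ *-identityˡ y ⟨
    1# * y      ≡⟨ cong (_* y) xz≡1 ⟨
    x * z * y   ≡⟨ cong (_* y) (*-comm x z) ⟩
    z * x * y   ≡⟨ *-assoc z x y ⟩
    z * (x * y) ≡⟨ cong (z *_) xy≡0 ⟩
    z * 0#      ≡⟨ zeroʳ z ⟩
    0# ∎)
    where open ≡-Reasoning

  x-y≡0⇒x≡y : ∀ {x y} → x + - y ≡ 0# → x ≡ y
  x-y≡0⇒x≡y {x} {y} p = begin
    x               ≡⟨ +-identityʳ x ⟨
    x + 0#          ≡⟨ cong (x +_) (trans (+-comm (- y) y) (-‿inverseʳ y)) ⟨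
    x + (- y + y)   ≡⟨ +-assoc x (- y) y ⟨
    x + - y + y     ≡⟨ cong (_+ y) p ⟩
    0# + y          ≡⟨ +-identityˡ y ⟩
    y ∎
    where open ≡-Reasoning

  open import Algebra.Properties.Semiring.Mult (CommutativeRing.semiring commutativeRing) using () renaming
      (_×_ to _×ᶠ_)

  ι : ℕ → F
  ι n = n ×ᶠ 1#

-- The prime is `suc p′`; its predecessor recurs as the largest admissible degree and as the
-- exponent that completes a p-th power. The last two fields say that the characteristic is p.
record PrimeField (p′ : ℕ) : Set where
  field
    discreteField : DiscreteField (Fin (suc p′))
  open DiscreteField discreteField
  field
    ι≡0⇒∣ : ∀ n → ι n ≡ 0# → suc p′ ∣ℕ n
    ι-p≡0 : ι (suc p′) ≡ 0#

-- Degrees, division by linear factors and roots over a field.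

module Degrees {F : Set} (𝔽 : DiscreteField F) where

  open DiscreteField 𝔽
  open PowerSeries propositionalRing
  open Polynomials propositionalRing public
  open CommutativeRing polynomialRing public
    using (semiring; commutativeSemiring; setoid; +-commutativeMonoid)
    renaming (+-congˡ to +ᴾ-congˡ; +-congʳ to +ᴾ-congʳ; *-congˡ to *ᴾ-congˡ; *-congʳ to *ᴾ-congʳ;
              +-identityˡ to +ᴾ-identityˡ; +-identityʳ to +ᴾ-identityʳ; +-assoc to +ᴾ-assoc;
              zeroˡ to *ᴾ-zeroˡ; zeroʳ to *ᴾ-zeroʳ; *-identityʳ to *ᴾ-identityʳ; distribˡ to *ᴾ-distribˡ;
              -‿inverseʳ to -ᴾ-inverseʳ; -‿inverseˡ to -ᴾ-inverseˡ)
  open import Algebra.Properties.Semiring.Exp semiring public using (_^_; ^-homo-*; ^-assocʳ)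
  open import Algebra.Properties.Semiring.Sum semiring public using
      (sum; sum-cong-≋; *-distribˡ-sum; ∑-distrib-+; sum-remove)
  open Coprimality polynomialRing public
  open SemiringSolver commutativeSemiring
  open SetoidReasoning setoid

  -- The zero polynomial satisfies every such bound, so that no convention about its degree is
  -- required.
  record Deg≤ (n : ℕ) (f : Poly) : Set where
    constructor mkDeg≤
    field above : ∀ i → n < i → coeff f i ≡ 0#
  open Deg≤ public

  IsDeg : ℕ → Poly → Set
  IsDeg n f = Deg≤ n f × coeff f n ≢ 0#

  deg-cong : ∀ {n f g} → f ≈ g → Deg≤ n f → Deg≤ n g
  deg-cong p d .above i n<i = trans (sym (at p i)) (above d i n<i)

  deg-mono : ∀ {m n f} → m ≤ n → Deg≤ m f → Deg≤ n f
  deg-mono m≤n d .above i n<i = above d i (ℕ.≤-<-trans m≤n n<i)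

  deg-0 : ∀ {n f} → f ≈ [] → Deg≤ n f
  deg-0 p .above i _ = at p i

  deg-+ : ∀ {n f g} → Deg≤ n f → Deg≤ n g → Deg≤ n (f +ᴾ g)
  deg-+ {f = f} {g} d e .above i n<i =
    trans (coeff-+ f g i) (trans (cong₂ _+_ (above d i n<i) (above e i n<i)) (+-identityˡ _))

  deg-neg : ∀ {n f} → Deg≤ n f → Deg≤ n (-ᴾ f)
  deg-neg {f = f} d .above i n<i = trans (coeff-neg f i) (trans (cong -_ (above d i n<i)) -0≡0)

  deg-* : ∀ {m n f g} → Deg≤ m f → Deg≤ n g → Deg≤ (m ℕ.+ n) (f *ᴾ g)
  deg-* {m} {n} {f} {g} d e .above i p =
    trans (coeff-* f g i) (⊛-above m n (coeff f) (coeff g) (above d) (above e) i p)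

  coeff-top : ∀ {m n f g} → Deg≤ m f → Deg≤ n g → coeff (f *ᴾ g) (m ℕ.+ n) ≡ coeff f m * coeff g n
  coeff-top {m} {n} {f} {g} d e = trans (coeff-* f g (m ℕ.+ n))
      (⊛-top m n (coeff f) (coeff g) (above d) (above e))

  deg-C : ∀ a → Deg≤ 0 (C a)
  deg-C a .above (suc i) _ = coeff-C a i

  deg-X : Deg≤ 1 X
  deg-X .above (suc (suc i)) _ = coeff-X-suc² i
  deg-X .above (suc zero) (s<s ())

  deg-D : ∀ {n f} → Deg≤ n f → Deg≤ n (D f)
  deg-D {n} {f} d .above i n<i =
    trans (coeff-D f i) (trans (cong (suc i ×ᶠ_) (above d (suc i) (ℕ.m<n⇒m<1+n n<i))) (×-zero (suc i)))

  deg-sum : ∀ {n k} (f : Fin k → Poly) → (∀ b → Deg≤ n (f b)) → Deg≤ n (sum f)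
  deg-sum {k = zero}  f d = deg-0 ≈-refl
  deg-sum {k = suc k} f d = deg-+ (d zero) (deg-sum (f ∘ suc) (d ∘ suc))

  sum-cong : ∀ {k} (f g : Fin k → Poly) → (∀ b → f b ≈ g b) → sum f ≈ sum g
  sum-cong f g p = sum-cong-≋ p

  coeff-sum-cong : ∀ {k} (f g : Fin k → Poly) {i j} → (∀ b → coeff (f b) i ≡ coeff (g b) j) → coeff (sum f) i
      ≡ coeff (sum g) j
  coeff-sum-cong {zero}  f g p = refl
  coeff-sum-cong {suc k} f g p = trans (coeff-+ (f zero) _ _)
    (trans (cong₂ _+_ (p zero) (coeff-sum-cong (f ∘ suc) (g ∘ suc) (p ∘ suc))) (sym (coeff-+ (g zero) _ _)))

  deg-^ : ∀ {n f} k → Deg≤ n f → Deg≤ (k ℕ.* n) (f ^ k)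
  deg-^ zero    d = deg-C 1#
  deg-^ (suc k) d = deg-* d (deg-^ k d)

  isDeg-cong : ∀ {n f g} → f ≈ g → IsDeg n f → IsDeg n g
  isDeg-cong {n} p (d , top) = deg-cong p d , λ q → top (trans (at p n) q)

  isDeg-* : ∀ {m n f g} → IsDeg m f → IsDeg n g → IsDeg (m ℕ.+ n) (f *ᴾ g)
  isDeg-* (d , p) (e , q) = deg-* d e , λ r → x*y≢0 p q (trans (sym (coeff-top d e)) r)

  isDeg-C : ∀ {a} → a ≢ 0# → IsDeg 0 (C a)
  isDeg-C {a} a≢0 = deg-C a , λ p → a≢0 (trans (sym (coeff-C-zero a)) p)

  isDeg-^ : ∀ {n f} k → IsDeg n f → IsDeg (k ℕ.* n) (f ^ k)
  isDeg-^ zero    d = isDeg-C 1≢0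
  isDeg-^ (suc k) d = isDeg-* d (isDeg-^ k d)

  isDeg-≤ : ∀ {m n f} → IsDeg m f → Deg≤ n f → m ≤ n
  isDeg-≤ {m} {n} (_ , p) e = ℕ.≮⇒≥ λ n<m → p (above e m n<m)

  isDeg⇒≉0 : ∀ {n f} → IsDeg n f → ¬ f ≈ []
  isDeg⇒≉0 {n} (_ , p) q = p (at q n)

  zero⊎isDeg : ∀ f → f ≈ [] ⊎ ∃[ n ] IsDeg n f
  zero⊎isDeg []      = inj₁ ≈-refl
  zero⊎isDeg (a ∷ f) with zero⊎isDeg f
  ... | inj₂ (n , d , p) = inj₂ (suc n , mkDeg≤ (λ { (suc i) (s<s n<i) → above d i n<i }) , p)
  ... | inj₁ p with a ≟ 0#
  ...   | yes q = inj₁ (mk≈ λ { zero → q ; (suc i) → at p i })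
  ...   | no ¬q = inj₂ (0 , mkDeg≤ (λ { (suc i) _ → at p i }) , ¬q)

  *ᴾ-nonzero : ∀ {f g} → ¬ f ≈ [] → ¬ g ≈ [] → ¬ f *ᴾ g ≈ []
  *ᴾ-nonzero {f} {g} f≉0 g≉0 with zero⊎isDeg f | zero⊎isDeg g
  ... | inj₁ p | _      = contradiction p f≉0
  ... | inj₂ _ | inj₁ q = contradiction q g≉0
  ... | inj₂ (_ , d) | inj₂ (_ , e) = isDeg⇒≉0 (isDeg-* d e)

  ^-nonzero : ∀ {f} k → ¬ f ≈ [] → ¬ f ^ k ≈ []
  ^-nonzero zero    f≉0 = isDeg⇒≉0 (isDeg-C 1≢0)
  ^-nonzero (suc k) f≉0 = *ᴾ-nonzero f≉0 (^-nonzero k f≉0)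

  ≈0? : ∀ f → Dec (f ≈ [])
  ≈0? f with zero⊎isDeg f
  ... | inj₁ p       = yes p
  ... | inj₂ (_ , d) = no (isDeg⇒≉0 d)

  f-g≈0⇒f≈g : ∀ {f g} → f +ᴾ -ᴾ g ≈ [] → f ≈ g
  f-g≈0⇒f≈g {f} {g} p .at i = x-y≡0⇒x≡y
    (trans (cong (coeff f i +_) (sym (coeff-neg g i))) (trans (sym (coeff-+ f (-ᴾ g) i)) (at p i)))

  *ᴾ-cancelˡ : ∀ {f g h} → ¬ f ≈ [] → f *ᴾ g ≈ f *ᴾ h → g ≈ h
  *ᴾ-cancelˡ {f} {g} {h} f≉0 p with ≈0? (g +ᴾ -ᴾ h)
  ... | yes q = f-g≈0⇒f≈g q
  ... | no ¬q = contradiction (begin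
    f *ᴾ (g +ᴾ -ᴾ h)       ≈⟨ *ᴾ-distribˡ f g (-ᴾ h) ⟩
    f *ᴾ g +ᴾ f *ᴾ -ᴾ h    ≈⟨ +ᴾ-congʳ p ⟩
    f *ᴾ h +ᴾ f *ᴾ -ᴾ h    ≈⟨ *ᴾ-distribˡ f h (-ᴾ h) ⟨
    f *ᴾ (h +ᴾ -ᴾ h)       ≈⟨ *ᴾ-congˡ (-ᴾ-inverseʳ h) ⟩
    f *ᴾ []                ≈⟨ *ᴾ-zeroʳ f ⟩
    [] ∎) (*ᴾ-nonzero f≉0 ¬q)

  isDeg-∣ : ∀ {m n f g} → IsDeg m f → f ∣ g → ¬ g ≈ [] → Deg≤ n g → m ≤ n
  isDeg-∣ {m} {f = f} {g} d (h , p) g≉0 e with zero⊎isDeg h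
  ... | inj₁ q       = contradiction (≈-trans (≈-sym p) (≈-trans (*ᴾ-congˡ q) (*ᴾ-zeroʳ f))) g≉0
  ... | inj₂ (k , r) = ℕ.≤-trans (ℕ.m≤m+n m k) (isDeg-≤ (isDeg-cong p (isDeg-* d r)) e)

  C-+ : ∀ a b → C (a + b) ≈ C a +ᴾ C b
  C-+ a b .at zero    = trans (coeff-C-zero _)
      (sym (trans (coeff-+ (C a) (C b) 0) (cong₂ _+_ (coeff-C-zero a) (coeff-C-zero b))))
  C-+ a b .at (suc i) = trans (coeff-C _ i) (sym
      (trans (coeff-+ (C a) (C b) (suc i)) (trans (cong₂ _+_ (coeff-C a i) (coeff-C b i)) (+-identityˡ _))))

  C-* : ∀ a b → C (a * b) ≈ C a *ᴾ C b
  C-* a b .at zero    = trans (coeff-C-zero _) (sym (trans (coeff-C* a (C b) 0) (cong (a *_) (coeff-C-zero b))))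
  C-* a b .at (suc i) = trans (coeff-C _ i) (sym
      (trans (coeff-C* a (C b) (suc i)) (trans (cong (a *_) (coeff-C b i)) (zeroʳ a))))

  C-cong : ∀ {a b} → a ≡ b → C a ≈ C b
  C-cong refl = ≈-refl

  C-0 : C 0# ≈ []
  C-0 .at zero    = coeff-C-zero 0#
  C-0 .at (suc i) = coeff-C 0# i

  X-_ : F → Poly
  X- a = X +ᴾ C (- a)

  isDeg-X- : ∀ a → IsDeg 1 (X- a)
  isDeg-X- a = deg-+ deg-X (deg-mono z≤n (deg-C (- a))) , λ p → 1≢0 (trans (sym top) p)
    where
    top : coeff (X- a) 1 ≡ 1#
    top = trans (coeff-+ X (C (- a)) 1) (trans (cong₂ _+_ coeff-X-one (coeff-C (- a) 0)) (+-identityʳ 1#))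

  eval-X- : ∀ a x → eval (X- a) x ≡ x + - a
  eval-X- a x = trans (eval-+ X (C (- a)) x) (cong₂ _+_ (eval-X x) (eval-C (- a) x))

  eval-0 : ∀ {f} → f ≈ [] → ∀ x → eval f x ≡ 0#
  eval-0 {[]}    p x = refl
  eval-0 {a ∷ f} p x = trans (cong₂ _+_ (at p 0)
      (trans (cong (x *_) (eval-0 {f} (mk≈ λ i → at p (suc i)) x)) (zeroʳ x))) (+-identityˡ _)

  eval-cong : ∀ {f g} → f ≈ g → ∀ x → eval f x ≡ eval g x
  eval-cong {[]}    {g}     p x = sym (eval-0 (≈-sym p) x)
  eval-cong {a ∷ f} {[]}    p x = eval-0 p x
  eval-cong {a ∷ f} {b ∷ g} p x = cong₂ (λ c y → c + x * y) (at p 0)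
      (eval-cong {f} {g} (mk≈ λ i → at p (suc i)) x)

  -- Synthetic division: the coefficients of the quotient by `X- a` are the values at `a` of the
  -- successive tails of the polynomial.
  quotient : F → Poly → Poly
  quotient a []      = []
  quotient a (b ∷ f) = eval f a ∷ quotient a f

  division : ∀ a f → f ≈ C (eval f a) +ᴾ X- a *ᴾ quotient a f
  division a []      = ≈-sym (≈-trans (+ᴾ-cong C-0 (*ᴾ-zeroʳ (X- a))) (+ᴾ-identityˡ []))
  division a (b ∷ f) = begin
    b ∷ f                                  ≈⟨ cons-≈ b f ⟩
    C b +ᴾ X *ᴾ f                          ≈⟨ +ᴾ-congˡ (*ᴾ-congˡ (division a f)) ⟩
    C b +ᴾ X *ᴾ (C e +ᴾ X- a *ᴾ q)         ≈⟨ +ᴾ-identityʳ _ ⟨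
    C b +ᴾ X *ᴾ (C e +ᴾ X- a *ᴾ q) +ᴾ []   ≈⟨ +ᴾ-congˡ (≈-trans (*ᴾ-congʳ C-a) (*ᴾ-zeroˡ (C e))) ⟨
    C b +ᴾ X *ᴾ (C e +ᴾ X- a *ᴾ q) +ᴾ (C a +ᴾ C (- a)) *ᴾ C e
      ≈⟨ solve 6 (λ b x e n q a → b :+ x :* (e :+ (x :+ n) :* q) :+ (a :+ n) :* e
                                  := b :+ a :* e :+ (x :+ n) :* (e :+ x :* q)) ≈-refl (C b) X (C e) (C (- a))
                                      q (C a) ⟩
    C b +ᴾ C a *ᴾ C e +ᴾ X- a *ᴾ (C e +ᴾ X *ᴾ q)
      ≈⟨ +ᴾ-cong (≈-trans (C-+ b (a * e)) (+ᴾ-congˡ (C-* a e))) (*ᴾ-congˡ (cons-≈ e q)) ⟨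
    C (b + a * e) +ᴾ X- a *ᴾ (e ∷ q) ∎
    where
    e = eval f a
    q = quotient a f
    C-a : C a +ᴾ C (- a) ≈ []
    C-a = ≈-trans (≈-sym (C-+ a (- a))) (≈-trans (C-cong (-‿inverseʳ a)) C-0)

  -- Modulo `f` the polynomial `g` is the unit `e`, and scaling by `e⁻¹` gives the Bézout identity.
  -- This serves both linear factors and iterates.
  coprime-const : ∀ {f g} e → e ≢ 0# → ∀ {h} → g ≈ C e +ᴾ f *ᴾ h → Coprime f g
  coprime-const {f} {g} e e≢0 {h} p with inverse e e≢0
  ... | e⁻¹ , q = -ᴾ (C e⁻¹ *ᴾ h) , C e⁻¹ , (begin
    -ᴾ (C e⁻¹ *ᴾ h) *ᴾ f +ᴾ C e⁻¹ *ᴾ g               ≈⟨ +ᴾ-congˡ (*ᴾ-congˡ p) ⟩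
    -ᴾ (C e⁻¹ *ᴾ h) *ᴾ f +ᴾ C e⁻¹ *ᴾ (C e +ᴾ f *ᴾ h)
      ≈⟨ solve 5 (λ n i f e h → n :* f :+ i :* (e :+ f :* h) := (n :+ i :* h) :* f :+ e :* i)
           ≈-refl (-ᴾ (C e⁻¹ *ᴾ h)) (C e⁻¹) f (C e) h ⟩
    (-ᴾ (C e⁻¹ *ᴾ h) +ᴾ C e⁻¹ *ᴾ h) *ᴾ f +ᴾ C e *ᴾ C e⁻¹
      ≈⟨ +ᴾ-cong (≈-trans (*ᴾ-congʳ (-ᴾ-inverseˡ _)) (*ᴾ-zeroˡ f)) (≈-trans (≈-sym (C-* e e⁻¹)) (C-cong q)) ⟩
    [] +ᴾ C 1#                                      ≈⟨ +ᴾ-identityˡ _ ⟩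
    C 1# ∎)

  coprime-X- : ∀ {a b} → a ≢ b → Coprime (X- a) (X- b)
  coprime-X- {a} {b} a≢b = coprime-const (a + - b) (λ p → a≢b (x-y≡0⇒x≡y p)) {C 1#} (begin
    X +ᴾ C (- b)                              ≈⟨ +ᴾ-identityʳ _ ⟨
    X +ᴾ C (- b) +ᴾ []                        ≈⟨ +ᴾ-congˡ
        (≈-trans (≈-sym (C-+ a (- a))) (≈-trans (C-cong (-‿inverseʳ a)) C-0)) ⟨
    X +ᴾ C (- b) +ᴾ (C a +ᴾ C (- a))
      ≈⟨ solve 4 (λ x b a n → x :+ b :+ (a :+ n) := a :+ b :+ (x :+ n) :* con 1) ≈-refl X (C (- b)) (C a)
          (C (- a)) ⟩
    C a +ᴾ C (- b) +ᴾ X- a *ᴾ C 1#            ≈⟨ +ᴾ-congʳ (C-+ a (- b)) ⟨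
    C (a + - b) +ᴾ X- a *ᴾ C 1# ∎)

  -- Powers of distinct linear factors are pairwise coprime, so their product, of degree `M * m`,
  -- divides `g`.
  roots-bound : ∀ {M m n g} (x : Fin M → F) → (∀ {i j} → x i ≡ x j → i ≡ j) →
                ¬ g ≈ [] → (∀ i → (X- x i) ^ m ∣ g) → Deg≤ n g → M ℕ.* m ≤ n
  roots-bound {M} {m} {n} {g} x inj g≉0 div d = isDeg-∣ {n = n} (prod-deg x) (prod-∣ x inj div) g≉0 d
    where
    prod : ∀ {M} → (Fin M → F) → Poly
    prod {zero}  x = C 1#
    prod {suc M} x = (X- x zero) ^ m *ᴾ prod (x ∘ suc)
    prod-deg : ∀ {M} (x : Fin M → F) → IsDeg (M ℕ.* m) (prod x)
    prod-deg {zero}  x = isDeg-C 1≢0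
    prod-deg {suc M} x = isDeg-*
      (subst (λ k → IsDeg k ((X- x zero) ^ m)) (ℕ.*-identityʳ m) (isDeg-^ m (isDeg-X- (x zero))))
          (prod-deg (x ∘ suc))
    prod-coprime : ∀ {M} a (x : Fin M → F) → (∀ i → a ≢ x i) → Coprime ((X- a) ^ m) (prod x)
    prod-coprime {zero}  a x p = coprime-1 _
    prod-coprime {suc M} a x p = coprime-* (coprime-^ m m (coprime-X- (p zero)))
        (prod-coprime a (x ∘ suc) (p ∘ suc))
    prod-∣ : ∀ {M} (x : Fin M → F) → (∀ {i j} → x i ≡ x j → i ≡ j) → (∀ i → (X- x i) ^ m ∣ g) → prod x ∣ g
    prod-∣ {zero}  x inj div = g , *ᴾ-identityˡ g
    prod-∣ {suc M} x inj div = coprime-*-∣ (prod-coprime (x zero) (x ∘ suc) (λ i r → Fin.0≢1+n (inj r)))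
      (div zero) (prod-∣ (x ∘ suc) (Fin.suc-injective ∘ inj) (div ∘ suc))

-- Rules of differentiation and multiplicity of roots.

module Derivatives {F : Set} (𝔽 : DiscreteField F) where

  open DiscreteField 𝔽
  open PowerSeries propositionalRing
  open Degrees 𝔽
  open SemiringSolver commutativeSemiring
  open SetoidReasoning setoid

  ι-× : ∀ n x → ι n * x ≡ n ×ᶠ x
  ι-× n x = trans (*-comm _ _) (trans (×-comm-* n x 1#) (cong (n ×ᶠ_) (*-identityʳ x)))

  D-cong : ∀ {f g} → f ≈ g → D f ≈ D g
  D-cong {f} {g} p .at i = trans (coeff-D f i) (trans (cong (suc i ×ᶠ_) (at p (suc i))) (sym (coeff-D g i)))

  D-0 : ∀ {f} → f ≈ [] → D f ≈ []
  D-0 {f} p .at i = trans (coeff-D f i) (trans (cong (suc i ×ᶠ_) (at p (suc i))) (×-zero (suc i)))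

  D-C : ∀ a → D (C a) ≈ []
  D-C a .at i = trans (coeff-D (C a) i) (trans (cong (suc i ×ᶠ_) (coeff-C a i)) (×-zero (suc i)))

  D-+ : ∀ f g → D (f +ᴾ g) ≈ D f +ᴾ D g
  D-+ f g .at i = trans (coeff-D (f +ᴾ g) i) (trans (cong (suc i ×ᶠ_) (coeff-+ f g (suc i)))
    (trans (×-distrib-+ (suc i) _ _) (sym (trans (coeff-+ (D f) (D g) i)
        (cong₂ _+_ (coeff-D f i) (coeff-D g i))))))

  D-C* : ∀ a f → D (C a *ᴾ f) ≈ C a *ᴾ D f
  D-C* a f .at i = trans (coeff-D (C a *ᴾ f) i) (trans (cong (suc i ×ᶠ_) (coeff-C* a f (suc i)))
    (trans (sym (×-comm-* (suc i) a _)) (sym (trans (coeff-C* a (D f) i) (cong (a *_) (coeff-D f i))))))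

  D-* : ∀ f g → D (f *ᴾ g) ≈ D f *ᴾ g +ᴾ f *ᴾ D g
  D-* []      g = ≈-trans (D-0 (*ᴾ-zeroˡ g)) (≈-sym
      (≈-trans (+ᴾ-cong (≈-trans (*ᴾ-congʳ (D-0 ≈-refl)) (*ᴾ-zeroˡ g)) (*ᴾ-zeroˡ (D g))) (+ᴾ-identityˡ [])))
  D-* (a ∷ f) g = begin
    D ((a ∷ f) *ᴾ g)                        ≈⟨ D-cong (*ᴾ-congʳ (cons-≈ a f)) ⟩
    D ((C a +ᴾ X *ᴾ f) *ᴾ g)                ≈⟨ D-cong
        (solve 4 (λ a x f g → (a :+ x :* f) :* g := a :* g :+ x :* (f :* g)) ≈-refl (C a) X f g) ⟩
    D (C a *ᴾ g +ᴾ X *ᴾ (f *ᴾ g))           ≈⟨ D-+ _ _ ⟩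
    D (C a *ᴾ g) +ᴾ D (X *ᴾ (f *ᴾ g))       ≈⟨ +ᴾ-cong (D-C* a g) (D-X* (f *ᴾ g)) ⟩
    C a *ᴾ D g +ᴾ (f *ᴾ g +ᴾ X *ᴾ D (f *ᴾ g)) ≈⟨ +ᴾ-congˡ (+ᴾ-congˡ (*ᴾ-congˡ (D-* f g))) ⟩
    C a *ᴾ D g +ᴾ (f *ᴾ g +ᴾ X *ᴾ (D f *ᴾ g +ᴾ f *ᴾ D g))
      ≈⟨ solve 6 (λ a g′ f g x f′ → a :* g′ :+ (f :* g :+ x :* (f′ :* g :+ f :* g′))
                                  := (con 0 :+ (f :+ x :* f′)) :* g :+ (a :+ x :* f) :* g′) ≈-refl (C a)
                                      (D g) f g X (D f) ⟩
    ([] +ᴾ (f +ᴾ X *ᴾ D f)) *ᴾ g +ᴾ (C a +ᴾ X *ᴾ f) *ᴾ D g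
      ≈⟨ +ᴾ-cong (*ᴾ-congʳ (≈-trans (≈-trans (D-cong (cons-≈ a f)) (D-+ _ _)) (+ᴾ-cong (D-C a) (D-X* f))))
          (*ᴾ-congʳ (cons-≈ a f)) ⟨
    D (a ∷ f) *ᴾ g +ᴾ (a ∷ f) *ᴾ D g ∎

  D-^ : ∀ f n → D (f ^ suc n) ≈ C (ι (suc n)) *ᴾ (f ^ n *ᴾ D f)
  D-^ f zero    = begin
    D (f *ᴾ C 1#)                     ≈⟨ D-cong (*ᴾ-identityʳ f) ⟩
    D f                               ≈⟨ *ᴾ-identityˡ (D f) ⟨
    C 1# *ᴾ D f                       ≈⟨ *ᴾ-identityˡ _ ⟨
    C 1# *ᴾ (C 1# *ᴾ D f)             ≈⟨ *ᴾ-congʳ (C-cong (sym (+-identityʳ 1#))) ⟩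
    C (1# + 0#) *ᴾ (C 1# *ᴾ D f) ∎
  D-^ f (suc n) = begin
    D (f *ᴾ f ^ suc n)                                  ≈⟨ D-* f (f ^ suc n) ⟩
    D f *ᴾ (f *ᴾ f ^ n) +ᴾ f *ᴾ D (f ^ suc n)           ≈⟨ +ᴾ-congˡ (*ᴾ-congˡ (D-^ f n)) ⟩
    D f *ᴾ (f *ᴾ f ^ n) +ᴾ f *ᴾ (C (ι (suc n)) *ᴾ (f ^ n *ᴾ D f)) ≈⟨ regroup (D f) f (f ^ n) (C (ι (suc n))) ⟩
    (C 1# +ᴾ C (ι (suc n))) *ᴾ (f *ᴾ f ^ n *ᴾ D f)      ≈⟨ *ᴾ-congʳ (C-+ 1# (ι (suc n))) ⟨
    C (ι (suc (suc n))) *ᴾ (f *ᴾ f ^ n *ᴾ D f) ∎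
    where
    regroup : ∀ f′ f e c → f′ *ᴾ (f *ᴾ e) +ᴾ f *ᴾ (c *ᴾ (e *ᴾ f′)) ≈ (C 1# +ᴾ c) *ᴾ (f *ᴾ e *ᴾ f′)
    regroup = solve 4 (λ f′ f e c → f′ :* (f :* e) :+ f :* (c :* (e :* f′)) := (con 1 :+ c) :*
        (f :* e :* f′)) ≈-refl

  -- The factor `f` on the left avoids the exponent n - 1 and thereby includes n = 0.
  *D-^ : ∀ f n → f *ᴾ D (f ^ n) ≈ C (ι n) *ᴾ (f ^ n *ᴾ D f)
  *D-^ f zero    = ≈-trans (≈-trans (*ᴾ-congˡ (D-C 1#)) (*ᴾ-zeroʳ f))
      (≈-sym (≈-trans (*ᴾ-congʳ C-0) (*ᴾ-zeroˡ _)))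
  *D-^ f (suc n) = ≈-trans (*ᴾ-congˡ (D-^ f n)) (regroup f (C (ι (suc n))) (f ^ n) (D f))
    where
    regroup : ∀ f c e f′ → f *ᴾ (c *ᴾ (e *ᴾ f′)) ≈ c *ᴾ (f *ᴾ e *ᴾ f′)
    regroup = solve 4 (λ f c e f′ → f :* (c :* (e :* f′)) := c :* (f :* e :* f′)) ≈-refl

  D-sum : ∀ {k} (f : Fin k → Poly) → D (sum f) ≈ sum (λ b → D (f b))
  D-sum {zero}  f = D-0 ≈-refl
  D-sum {suc k} f = ≈-trans (D-+ (f zero) _) (+ᴾ-congˡ (D-sum (f ∘ suc)))

  D-X- : ∀ a → D (X- a) ≈ C 1#
  D-X- a = begin
    D (X +ᴾ C (- a))        ≈⟨ D-+ X _ ⟩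
    D X +ᴾ D (C (- a))      ≈⟨ +ᴾ-cong (D-cong (≈-sym (*ᴾ-identityʳ X))) (D-C (- a)) ⟩
    D (X *ᴾ C 1#) +ᴾ []     ≈⟨ +ᴾ-identityʳ _ ⟩
    D (X *ᴾ C 1#)           ≈⟨ D-X* (C 1#) ⟩
    C 1# +ᴾ X *ᴾ D (C 1#)   ≈⟨ +ᴾ-congˡ (≈-trans (*ᴾ-congˡ (D-C 1#)) (*ᴾ-zeroʳ X)) ⟩
    C 1# +ᴾ []              ≈⟨ +ᴾ-identityʳ _ ⟩
    C 1# ∎

  module Derivation (Q : Poly) where

    -- The factor `Q` clears the denominators of logarithmic derivatives. Where `Q` does not vanish,
    -- `∂` detects multiplicities just as `D` does.
    ∂ : Poly → Poly
    ∂ f = Q *ᴾ D f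

    ∂^ : ℕ → Poly → Poly
    ∂^ zero    f = f
    ∂^ (suc k) f = ∂ (∂^ k f)

    ∂^-suc : ∀ k f → ∂^ (suc k) f ≡ ∂^ k (∂ f)
    ∂^-suc zero    f = refl
    ∂^-suc (suc k) f = cong ∂ (∂^-suc k f)

    ∂-cong : ∀ {f g} → f ≈ g → ∂ f ≈ ∂ g
    ∂-cong p = *ᴾ-congˡ (D-cong p)

    ∂^-cong : ∀ k {f g} → f ≈ g → ∂^ k f ≈ ∂^ k g
    ∂^-cong zero    p = p
    ∂^-cong (suc k) p = ∂-cong (∂^-cong k p)

    ∂^-0 : ∀ k {f} → f ≈ [] → ∂^ k f ≈ []
    ∂^-0 zero    p = p
    ∂^-0 (suc k) p = ≈-trans (*ᴾ-congˡ (D-0 (∂^-0 k p))) (*ᴾ-zeroʳ Q)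

    ∂^-sum : ∀ k {n} (f : Fin n → Poly) → ∂^ k (sum f) ≈ sum (λ b → ∂^ k (f b))
    ∂^-sum zero    f = ≈-refl
    ∂^-sum (suc k) f = ≈-trans (∂-cong (∂^-sum k f))
        (≈-trans (*ᴾ-congˡ (D-sum (λ b → ∂^ k (f b)))) (*-distribˡ-sum Q (λ b → D (∂^ k (f b)))))

    module Multiplicity (a : F) (Q≢0 : eval Q a ≢ 0#) where

      eval-X-a : ∀ f → eval (X- a *ᴾ f) a ≡ 0#
      eval-X-a f = trans (eval-* (X- a) f a) (trans (cong (_* eval f a) (trans (eval-X- a a) (-‿inverseʳ a)))
          (zeroˡ _))

      -- One application of `∂` turns (X - a) ^ j h into (X - a) ^ (j - 1) h₁ with h₁(a) = j Q(a)
      -- h(a), so that the final value is j! Q(a) ^ j h(a).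
      eval-∂^ : ∀ j h → (∀ i → i < j → ι (suc i) ≢ 0#) → eval h a ≢ 0# → eval (∂^ j ((X- a) ^ j *ᴾ h)) a ≢ 0#
      eval-∂^ zero    h p h≢0 q = h≢0 (trans (sym (eval-cong (*ᴾ-identityˡ h) a)) q)
      eval-∂^ (suc j) h p h≢0 q =
        eval-∂^ j h₁ (λ i i<j → p i (ℕ.m<n⇒m<1+n i<j)) h₁≢0
          (trans (sym (eval-cong (∂^-cong j step) a))
              (trans (cong (λ f → eval f a) (sym (∂^-suc j ((X- a) ^ suc j *ᴾ h)))) q))
        where
        h₁ = C (ι (suc j)) *ᴾ (Q *ᴾ h) +ᴾ X- a *ᴾ (Q *ᴾ D h)
        regroup : ∀ q c e h x h′ → q *ᴾ (c *ᴾ (e *ᴾ C 1#) *ᴾ h +ᴾ x *ᴾ e *ᴾ h′) ≈ e *ᴾ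
            (c *ᴾ (q *ᴾ h) +ᴾ x *ᴾ (q *ᴾ h′))
        regroup = solve 6 (λ q c e h x h′ → q :* (c :* (e :* con 1) :* h :+ x :* e :* h′) := e :*
            (c :* (q :* h) :+ x :* (q :* h′))) ≈-refl
        step : ∂ ((X- a) ^ suc j *ᴾ h) ≈ (X- a) ^ j *ᴾ h₁
        step = begin
          Q *ᴾ D ((X- a) ^ suc j *ᴾ h)                                  ≈⟨ *ᴾ-congˡ (D-* ((X- a) ^ suc j) h) ⟩
          Q *ᴾ (D ((X- a) ^ suc j) *ᴾ h +ᴾ (X- a) ^ suc j *ᴾ D h)
            ≈⟨ *ᴾ-congˡ (+ᴾ-congʳ (*ᴾ-congʳ (≈-trans (D-^ (X- a) j) (*ᴾ-congˡ (*ᴾ-congˡ (D-X- a)))))) ⟩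
          Q *ᴾ (C (ι (suc j)) *ᴾ ((X- a) ^ j *ᴾ C 1#) *ᴾ h +ᴾ (X- a) ^ suc j *ᴾ D h)
            ≈⟨ regroup Q (C (ι (suc j))) ((X- a) ^ j) h (X- a) (D h) ⟩
          (X- a) ^ j *ᴾ h₁ ∎
        h₁≢0 : eval h₁ a ≢ 0#
        h₁≢0 r = x*y≢0 (p j ℕ.≤-refl) (x*y≢0 Q≢0 h≢0)
            (trans (sym (trans (eval-+ (C (ι (suc j)) *ᴾ (Q *ᴾ h)) _ a)
          (trans (cong₂ _+_ (trans (eval-* (C (ι (suc j))) (Q *ᴾ h) a)
              (cong₂ _*_ (eval-C _ a) (eval-* Q h a))) (eval-X-a (Q *ᴾ D h))) (+-identityʳ _)))) r)

      -- If `h` does not vanish at `a`, then the m-th derivative of (X - a) ^ m h does not vanish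
      -- there either; hence each further vanishing derivative yields a further factor. The
      -- factorial (m - 1)! has to be invertible, which limits `m` by the characteristic.
      multiplicity : ∀ m g → (∀ i → suc i < m → ι (suc i) ≢ 0#) → (∀ k → k < m → eval (∂^ k g) a ≡ 0#) →
          (X- a) ^ m ∣ g
      multiplicity zero    g p q = g , *ᴾ-identityˡ g
      multiplicity (suc m) g p q with multiplicity m g (λ i i<m → p i (ℕ.m<n⇒m<1+n i<m))
          (λ k k<m → q k (ℕ.m<n⇒m<1+n k<m))
      ... | h , r with eval h a ≟ 0#
      ...   | no h≢0  = contradiction (trans (eval-cong (∂^-cong m r) a) (q m ℕ.≤-refl))
          (eval-∂^ m h (λ i i<m → p i (s<s i<m)) h≢0)
      ...   | yes h≡0 = quotient a h , (begin
        X- a *ᴾ (X- a) ^ m *ᴾ quotient a h    ≈⟨ regroup (X- a) ((X- a) ^ m) (quotient a h) ⟩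
        (X- a) ^ m *ᴾ ([] +ᴾ X- a *ᴾ quotient a h) ≈⟨ *ᴾ-congˡ (+ᴾ-congʳ (≈-trans (C-cong h≡0) C-0)) ⟨
        (X- a) ^ m *ᴾ (C (eval h a) +ᴾ X- a *ᴾ quotient a h) ≈⟨ *ᴾ-congˡ (division a h) ⟨
        (X- a) ^ m *ᴾ h                       ≈⟨ r ⟩
        g ∎)
        where
        regroup : ∀ x e f → x *ᴾ e *ᴾ f ≈ e *ᴾ ([] +ᴾ x *ᴾ f)
        regroup = solve 3 (λ x e f → x :* e :* f := e :* (con 0 :+ x :* f)) ≈-refl

-- The Wronskian criterion in characteristic p.

module Wronskian {p′ : ℕ} (𝔽ₚ : PrimeField p′) where

  open PrimeField 𝔽ₚ
  open DiscreteField discreteField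
  open PowerSeries propositionalRing
  open Degrees discreteField
  open Derivatives discreteField
  open SemiringSolver commutativeSemiring
  open SetoidReasoning setoid

  private
    F = Fin (suc p′)

  D≈0⇒coeff≡0 : ∀ {f} → D f ≈ [] → ∀ i → ¬ suc p′ ∣ℕ i → coeff f i ≡ 0#
  D≈0⇒coeff≡0 {f} q zero    p∤i = contradiction (suc p′ ∣0) p∤i
  D≈0⇒coeff≡0 {f} q (suc i) p∤i with coeff f (suc i) ≟ 0#
  ... | yes r = r
  ... | no ¬r = contradiction (trans (ι-× (suc i) _) (trans (sym (coeff-D f i)) (at q i)))
                              (x*y≢0 (λ r → p∤i (ι≡0⇒∣ (suc i) r)) ¬r)

  -- Here `f` is a polynomial in X ^ p and `g` has degree below p; by uniqueness of division with
  -- remainder only one term contributes to the index n + r.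
  coeff-pth-power-* : ∀ {f g} n r → D f ≈ [] → Deg≤ p′ g → suc p′ ∣ℕ n → r ≤ p′ →
                      coeff (f *ᴾ g) (n ℕ.+ r) ≡ coeff f n * coeff g r
  coeff-pth-power-* {f} {g} n r q d p∣n r≤p′ =
    trans (coeff-* f g (n ℕ.+ r)) (trans (⊛-skip n r (coeff f) (coeff g) below)
      (trans (⊛-head r (λ i → coeff f (n ℕ.+ i)) (coeff g) above-n)
          (cong (λ i → coeff f i * coeff g r) (ℕ.+-identityʳ n))))
    where
    below : ∀ i j → i < n → i ℕ.+ j ≡ n ℕ.+ r → coeff f i * coeff g j ≡ 0#
    below i j i<n e with suc p′ ∣ℕ? i
    ... | no p∤i  = trans (cong (_* coeff g j) (D≈0⇒coeff≡0 q i p∤i)) (zeroˡ _)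
    -- As p divides n - i > 0, the index j is at least p and thus beyond the degree of `g`.
    ... | yes p∣i = trans (cong (coeff f i *_) (above d j p′<j)) (zeroʳ _)
      where
      instance _ = ℕ.>-nonZero (ℕ.m<n⇒0<n∸m i<n)
      p∣n∸i : suc p′ ∣ℕ n ℕ.∸ i
      p∣n∸i = ∣m+n∣m⇒∣n (subst (suc p′ ∣ℕ_) (sym (ℕ.m+[n∸m]≡n (ℕ.<⇒≤ i<n))) p∣n) p∣i
      p′<j : p′ < j
      p′<j = ℕ.≤-trans (∣⇒≤ p∣n∸i) (ℕ.+-cancelˡ-≤ i _ _ (ℕ.≤-trans (ℕ.≤-reflexive (ℕ.m+[n∸m]≡n (ℕ.<⇒≤ i<n)))
        (ℕ.≤-trans (ℕ.m≤m+n n r) (ℕ.≤-reflexive (sym e)))))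
    above-n : ∀ i → i < r → coeff f (n ℕ.+ suc i) ≡ 0#
    above-n i i<r = D≈0⇒coeff≡0 q (n ℕ.+ suc i) λ p∣ →
      ℕ.<⇒≱ (s<s (ℕ.<-≤-trans i<r r≤p′)) (∣⇒≤ (∣m+n∣m⇒∣n p∣ p∣n))

  LinearlyDependent : ∀ {s} → (Fin s → Poly) → Set
  LinearlyDependent {s} g = Σ[ γ ∈ (Fin s → F) ] ((∃[ b ] γ b ≢ 0#) × sum (λ b → C (γ b) *ᴾ g b) ≈ [])

  dependent-suc : ∀ {s} (g : Fin (suc s) → Poly) → LinearlyDependent (g ∘ suc) → LinearlyDependent g
  dependent-suc {s} g (γ , (b , γb≢0) , p) = γ′ , (suc b , γb≢0) ,
    ≈-trans (+ᴾ-congʳ (≈-trans (*ᴾ-congʳ C-0) (*ᴾ-zeroˡ _))) (≈-trans (+ᴾ-identityˡ _) p)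
    where
    γ′ : Fin (suc s) → F
    γ′ zero    = 0#
    γ′ (suc b) = γ b

  tail-relation : ∀ {s} (z h : Fin (suc s) → Poly) → z zero ≈ [] →
                  sum (λ b → z b *ᴾ h b) ≈ [] → sum (λ b → z (suc b) *ᴾ h (suc b)) ≈ []
  tail-relation z h z₀≈0 p = ≈-trans (≈-trans (≈-sym (+ᴾ-identityˡ _))
    (+ᴾ-congʳ (≈-sym (≈-trans (*ᴾ-congʳ z₀≈0) (*ᴾ-zeroˡ (h zero)))))) p

  -- If all the quotients z b / z 0 have derivative 0, then (z 0) ^ (p - 1) * z b is a
  -- polynomial in X ^ p, so that a relation between the g b, of degrees < p, can be
  -- read off coefficientwise.
  constant-quotients⇒dependent : ∀ {s} (g z : Fin (suc s) → Poly) → (∀ b → Deg≤ p′ (g b)) →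
    sum (λ b → z b *ᴾ g b) ≈ [] → ¬ z zero ≈ [] →
    (∀ b → z zero *ᴾ D (z b) ≈ D (z zero) *ᴾ z b) → LinearlyDependent g
  constant-quotients⇒dependent {s} g z deg-g rel z₀≉0 W≈0 with zero⊎isDeg (z zero ^ p′ *ᴾ z zero)
  ... | inj₁ q = contradiction q (*ᴾ-nonzero (^-nonzero p′ z₀≉0) z₀≉0)
  ... | inj₂ (n , d , top) = γ , (zero , top) , mk≈ Σγg
    where
    z₀ = z zero
    Z : Fin (suc s) → Poly
    Z b = z₀ ^ p′ *ᴾ z b
    -- Since `n` is the degree of z₀ ^ p, the entry `γ zero` is a leading coefficient and the
    -- relation is not trivial.
    γ : Fin (suc s) → F
    γ b = coeff (Z b) n

    -- Multiplied by z₀ the derivative becomes (1 + p′) z₀ ^ p′ z₀′ z b, which is 0 in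
    -- characteristic p.
    DZ≈0 : ∀ b → D (Z b) ≈ []
    DZ≈0 b with ≈0? (D (Z b))
    ... | yes q = q
    ... | no ¬q = contradiction (begin
      z₀ *ᴾ D (z₀ ^ p′ *ᴾ z b)                                       ≈⟨ *ᴾ-congˡ (D-* (z₀ ^ p′) (z b)) ⟩
      z₀ *ᴾ (D (z₀ ^ p′) *ᴾ z b +ᴾ z₀ ^ p′ *ᴾ D (z b))               ≈⟨ regroup₁ z₀ (D (z₀ ^ p′)) (z b)
          (z₀ ^ p′) (D (z b)) ⟩
      z₀ *ᴾ D (z₀ ^ p′) *ᴾ z b +ᴾ z₀ ^ p′ *ᴾ (z₀ *ᴾ D (z b))         ≈⟨ +ᴾ-cong (*ᴾ-congʳ (*D-^ z₀ p′))
          (*ᴾ-congˡ (W≈0 b)) ⟩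
      C (ι p′) *ᴾ (z₀ ^ p′ *ᴾ D z₀) *ᴾ z b +ᴾ z₀ ^ p′ *ᴾ (D z₀ *ᴾ z b) ≈⟨ regroup₂ (C (ι p′)) (z₀ ^ p′)
          (D z₀) (z b) ⟩
      (C 1# +ᴾ C (ι p′)) *ᴾ (z₀ ^ p′ *ᴾ D z₀ *ᴾ z b)
        ≈⟨ *ᴾ-congʳ (≈-trans (≈-sym (C-+ 1# (ι p′))) (≈-trans (C-cong ι-p≡0) C-0)) ⟩
      [] *ᴾ (z₀ ^ p′ *ᴾ D z₀ *ᴾ z b)                                 ≈⟨ *ᴾ-zeroˡ _ ⟩
      [] ∎) (*ᴾ-nonzero z₀≉0 ¬q)
      where
      regroup₁ : ∀ a b c d e → a *ᴾ (b *ᴾ c +ᴾ d *ᴾ e) ≈ a *ᴾ b *ᴾ c +ᴾ d *ᴾ (a *ᴾ e)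
      regroup₁ = solve 5 (λ a b c d e → a :* (b :* c :+ d :* e) := a :* b :* c :+ d :* (a :* e)) ≈-refl
      regroup₂ : ∀ a b c d → a *ᴾ (b *ᴾ c) *ᴾ d +ᴾ b *ᴾ (c *ᴾ d) ≈ (C 1# +ᴾ a) *ᴾ (b *ᴾ c *ᴾ d)
      regroup₂ = solve 4 (λ a b c d → a :* (b :* c) :* d :+ b :* (c :* d) := (con 1 :+ a) :* (b :* c :* d))
          ≈-refl

    p∣n : suc p′ ∣ℕ n
    p∣n with suc p′ ∣ℕ? n
    ... | yes q = q
    ... | no ¬q = contradiction (D≈0⇒coeff≡0 (DZ≈0 zero) n ¬q) top

    ΣZg≈0 : sum (λ b → Z b *ᴾ g b) ≈ []
    ΣZg≈0 = begin
      sum (λ b → z₀ ^ p′ *ᴾ z b *ᴾ g b)    ≈⟨ sum-cong _ (λ b → z₀ ^ p′ *ᴾ (z b *ᴾ g b))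
          (λ b → *ᴾ-assoc _ _ _) ⟩
      sum (λ b → z₀ ^ p′ *ᴾ (z b *ᴾ g b))  ≈⟨ *-distribˡ-sum (z₀ ^ p′) (λ b → z b *ᴾ g b) ⟨
      z₀ ^ p′ *ᴾ sum (λ b → z b *ᴾ g b)    ≈⟨ *ᴾ-congˡ rel ⟩
      z₀ ^ p′ *ᴾ []                        ≈⟨ *ᴾ-zeroʳ _ ⟩
      [] ∎

    Σγg : ∀ r → coeff (sum (λ b → C (γ b) *ᴾ g b)) r ≡ 0#
    Σγg r with r ℕ.≤? p′
    ... | no r≰p′  = above (deg-sum (λ b → C (γ b) *ᴾ g b) (λ b → deg-* (deg-C (γ b)) (deg-g b))) r (ℕ.≰⇒> r≰p′)
    ... | yes r≤p′ = trans (coeff-sum-cong (λ b → C (γ b) *ᴾ g b) (λ b → Z b *ᴾ g b)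
                             (λ b → trans (coeff-C* (γ b) (g b) r)
                                 (sym (coeff-pth-power-* {Z b} n r (DZ≈0 b) (deg-g b) p∣n r≤p′))))
                           (at ΣZg≈0 (n ℕ.+ r))

  module _ {Q : Poly} (Q≉0 : ¬ Q ≈ []) where

    open Derivation Q

    -- The vector `z` lies in the kernel of the Wronskian matrix of `g`. Differentiating each
    -- relation and subtracting the next shows that the `D (z b)` satisfy all relations but the
    -- last. Eliminating index 0 between the two vectors leaves a kernel vector `w` of a smaller
    -- matrix, to which induction applies; if `w` vanishes, the quotients z b / z 0 have derivative
    -- 0.
    wronskian : ∀ {s} (g z : Fin s → Poly) → (∀ b → Deg≤ p′ (g b)) →
                (∀ k → k < s → sum (λ b → z b *ᴾ ∂^ k (g b)) ≈ []) →
                (∀ b → z b ≈ []) ⊎ LinearlyDependent g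
    wronskian {zero}  g z deg-g rel = inj₁ λ ()
    wronskian {suc s} g z deg-g rel with ≈0? (z zero)
    ... | yes z₀≈0 with wronskian (g ∘ suc) (z ∘ suc) (deg-g ∘ suc)
                          (λ k k<s → tail-relation z (λ b → ∂^ k (g b)) z₀≈0 (rel k (ℕ.m<n⇒m<1+n k<s)))
    ...   | inj₁ z≈0 = inj₁ λ { zero → z₀≈0 ; (suc b) → z≈0 b }
    ...   | inj₂ dep = inj₂ (dependent-suc g dep)
    wronskian {suc s} g z deg-g rel | no z₀≉0 = result
      where
      z₀ = z zero
      w : Fin (suc s) → Poly
      w b = z₀ *ᴾ D (z b) +ᴾ -ᴾ D z₀ *ᴾ z b

      cancel-neg : ∀ a b → a *ᴾ b +ᴾ -ᴾ b *ᴾ a ≈ []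
      cancel-neg a b = begin
        a *ᴾ b +ᴾ -ᴾ b *ᴾ a  ≈⟨ solve 3 (λ a b n → a :* b :+ n :* a := (b :+ n) :* a) ≈-refl a b (-ᴾ b) ⟩
        (b +ᴾ -ᴾ b) *ᴾ a     ≈⟨ *ᴾ-congʳ (-ᴾ-inverseʳ b) ⟩
        [] *ᴾ a              ≈⟨ *ᴾ-zeroˡ a ⟩
        [] ∎

      ΣDz∂g≈0 : ∀ k → k < s → sum (λ b → D (z b) *ᴾ ∂^ k (g b)) ≈ []
      ΣDz∂g≈0 k k<s with ≈0? (sum (λ b → D (z b) *ᴾ ∂^ k (g b)))
      ... | yes q = q
      ... | no ¬q = contradiction (begin
        Q *ᴾ sum (λ b → D (z b) *ᴾ ∂^ k (g b))       ≈⟨ +ᴾ-identityʳ _ ⟨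
        Q *ᴾ sum (λ b → D (z b) *ᴾ ∂^ k (g b)) +ᴾ [] ≈⟨ +ᴾ-cong
            (*-distribˡ-sum Q (λ b → D (z b) *ᴾ ∂^ k (g b))) (≈-sym (rel (suc k) (s<s k<s))) ⟩
        sum (λ b → Q *ᴾ (D (z b) *ᴾ ∂^ k (g b))) +ᴾ sum (λ b → z b *ᴾ ∂^ (suc k) (g b))
          ≈⟨ ∑-distrib-+ (λ b → Q *ᴾ (D (z b) *ᴾ ∂^ k (g b))) (λ b → z b *ᴾ ∂^ (suc k) (g b)) ⟨
        sum (λ b → Q *ᴾ (D (z b) *ᴾ ∂^ k (g b)) +ᴾ z b *ᴾ ∂^ (suc k) (g b))
          ≈⟨ sum-cong _ (λ b → Q *ᴾ D (z b *ᴾ ∂^ k (g b)))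
               (λ b → ≈-trans (regroup Q (D (z b)) (∂^ k (g b)) (z b) (D (∂^ k (g b))))
                   (*ᴾ-congˡ (≈-sym (D-* (z b) (∂^ k (g b)))))) ⟩
        sum (λ b → Q *ᴾ D (z b *ᴾ ∂^ k (g b)))       ≈⟨ *-distribˡ-sum Q (λ b → D (z b *ᴾ ∂^ k (g b))) ⟨
        Q *ᴾ sum (λ b → D (z b *ᴾ ∂^ k (g b)))       ≈⟨ *ᴾ-congˡ (D-sum (λ b → z b *ᴾ ∂^ k (g b))) ⟨
        Q *ᴾ D (sum (λ b → z b *ᴾ ∂^ k (g b)))       ≈⟨ *ᴾ-congˡ (D-0 (rel k (ℕ.m<n⇒m<1+n k<s))) ⟩
        Q *ᴾ []                                      ≈⟨ *ᴾ-zeroʳ Q ⟩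
        [] ∎) (*ᴾ-nonzero Q≉0 ¬q)
        where
        regroup : ∀ q a b c d → q *ᴾ (a *ᴾ b) +ᴾ c *ᴾ (q *ᴾ d) ≈ q *ᴾ (a *ᴾ b +ᴾ c *ᴾ d)
        regroup = solve 5 (λ q a b c d → q :* (a :* b) :+ c :* (q :* d) := q :* (a :* b :+ c :* d)) ≈-refl

      Σw∂g≈0 : ∀ k → k < s → sum (λ b → w b *ᴾ ∂^ k (g b)) ≈ []
      Σw∂g≈0 k k<s = begin
        sum (λ b → w b *ᴾ h b)
          ≈⟨ sum-cong _ (λ b → z₀ *ᴾ (D (z b) *ᴾ h b) +ᴾ -ᴾ D z₀ *ᴾ (z b *ᴾ h b))
               (λ b → regroup z₀ (D (z b)) (-ᴾ D z₀) (z b) (h b)) ⟩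
        sum (λ b → z₀ *ᴾ (D (z b) *ᴾ h b) +ᴾ -ᴾ D z₀ *ᴾ (z b *ᴾ h b))
          ≈⟨ ∑-distrib-+ (λ b → z₀ *ᴾ (D (z b) *ᴾ h b)) (λ b → -ᴾ D z₀ *ᴾ (z b *ᴾ h b)) ⟩
        sum (λ b → z₀ *ᴾ (D (z b) *ᴾ h b)) +ᴾ sum (λ b → -ᴾ D z₀ *ᴾ (z b *ᴾ h b))
          ≈⟨ +ᴾ-cong (*-distribˡ-sum z₀ (λ b → D (z b) *ᴾ h b)) (*-distribˡ-sum (-ᴾ D z₀) (λ b → z b *ᴾ h b)) ⟨
        z₀ *ᴾ sum (λ b → D (z b) *ᴾ h b) +ᴾ -ᴾ D z₀ *ᴾ sum (λ b → z b *ᴾ h b)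
          ≈⟨ +ᴾ-cong (≈-trans (*ᴾ-congˡ (ΣDz∂g≈0 k k<s)) (*ᴾ-zeroʳ z₀))
                     (≈-trans (*ᴾ-congˡ (rel k (ℕ.m<n⇒m<1+n k<s))) (*ᴾ-zeroʳ (-ᴾ D z₀))) ⟩
        [] +ᴾ []   ≈⟨ +ᴾ-identityˡ [] ⟩
        [] ∎
        where
        h : Fin (suc s) → Poly
        h b = ∂^ k (g b)
        regroup : ∀ a b n c h → (a *ᴾ b +ᴾ n *ᴾ c) *ᴾ h ≈ a *ᴾ (b *ᴾ h) +ᴾ n *ᴾ (c *ᴾ h)
        regroup = solve 5 (λ a b n c h → (a :* b :+ n :* c) :* h := a :* (b :* h) :+ n :* (c :* h)) ≈-refl

      conclude : (∀ b → w (suc b) ≈ []) ⊎ LinearlyDependent (g ∘ suc) → (∀ b → z b ≈ []) ⊎ LinearlyDependent g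
      conclude (inj₂ dep) = inj₂ (dependent-suc g dep)
      conclude (inj₁ w≈0) = inj₂ (constant-quotients⇒dependent g z deg-g (rel 0 z<s) z₀≉0 W)
        where
        W : ∀ b → z₀ *ᴾ D (z b) ≈ D z₀ *ᴾ z b
        W zero    = *ᴾ-comm z₀ (D z₀)
        W (suc b) = begin
          z₀ *ᴾ D (z (suc b))                                      ≈⟨ +ᴾ-identityʳ _ ⟨
          z₀ *ᴾ D (z (suc b)) +ᴾ []                                ≈⟨ +ᴾ-congˡ
              (≈-trans (*ᴾ-congʳ (-ᴾ-inverseˡ (D z₀))) (*ᴾ-zeroˡ _)) ⟨
          z₀ *ᴾ D (z (suc b)) +ᴾ (-ᴾ D z₀ +ᴾ D z₀) *ᴾ z (suc b)
            ≈⟨ solve 4 (λ a n b c → a :+ (n :+ b) :* c := a :+ n :* c :+ b :* c) ≈-refl (z₀ *ᴾ D (z (suc b)))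
                (-ᴾ D z₀) (D z₀) (z (suc b)) ⟩
          w (suc b) +ᴾ D z₀ *ᴾ z (suc b)                           ≈⟨ +ᴾ-congʳ (w≈0 b) ⟩
          [] +ᴾ D z₀ *ᴾ z (suc b)                                  ≈⟨ +ᴾ-identityˡ _ ⟩
          D z₀ *ᴾ z (suc b) ∎

      result : (∀ b → z b ≈ []) ⊎ LinearlyDependent g
      result = conclude (wronskian (g ∘ suc) (w ∘ suc) (deg-g ∘ suc)
        (λ k k<s → tail-relation w (λ b → ∂^ k (g b)) (cancel-neg z₀ (D z₀)) (Σw∂g≈0 k k<s)))

-- Homogeneous systems with polynomial unknowns over a finite field.

funToFin-cong : ∀ {m n} {f g : Fin m → Fin n} → f ≗ g → funToFin f ≡ funToFin g
funToFin-cong {zero}  p = refl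
funToFin-cong {suc m} p = cong₂ combine (p zero) (funToFin-cong (p ∘ suc))

module LinearSystems {p′ : ℕ} (𝔽ₚ : PrimeField p′) where

  open PrimeField 𝔽ₚ
  open DiscreteField discreteField
  open Degrees discreteField

  private
    p = suc p′

  1<p : 1 < p
  1<p = ℕ.≰⇒> λ p≤1 → 1≢0 (unique p≤1 1# 0#)
    where
    unique : ∀ {n} → n ≤ 1 → (i j : Fin n) → i ≡ j
    unique (s≤s z≤n) zero zero = refl

  abstract
    coeff-tabulate : ∀ {n} (v : Fin n → Fin p) j → coeff (tabulate v) (toℕ j) ≡ v j
    coeff-tabulate v zero    = refl
    coeff-tabulate v (suc j) = coeff-tabulate (v ∘ suc) j

    deg-tabulate : ∀ {n} (v : Fin (suc n) → Fin p) → Deg≤ n (tabulate v)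
    deg-tabulate {zero}  v .above (suc i) _         = refl
    deg-tabulate {suc n} v .above (suc i) (s<s n<i) = above (deg-tabulate (v ∘ suc)) i n<i

  private
    coefficients : ∀ L A → Fin (p ℕ.^ (L ℕ.* suc A)) → Fin L → Fin (suc A) → Fin p
    coefficients L A e b j = finToFun {p} {L ℕ.* suc A} e (combine b j)

    family : ∀ {L A} → Fin (p ℕ.^ (L ℕ.* suc A)) → Fin L → Poly
    family {L} {A} e b = tabulate (coefficients L A e b)

    -- Only coefficients up to index `K` are recorded, so that there are p ^ (M * (K + 1)) possible
    -- outcomes to compare with p ^ (L * (A + 1)) families.
    values : ∀ {L M A K} → ((Fin L → Poly) → Fin M → Poly) → Fin (p ℕ.^ (L ℕ.* suc A)) → Fin (M ℕ.* suc K) →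
        Fin p
    values {L} {M} {A} {K} obs e i =
      coeff (obs (family {L} {A} e) (proj₁ (remQuot {M} (suc K) i))) (toℕ (proj₂ (remQuot {M} (suc K) i)))

  -- By the pigeonhole principle over the finite field, two different families give the same
  -- values; their difference is the solution.
  nontrivial-solution :
    ∀ {L M A K} (obs : (Fin L → Poly) → Fin M → Poly) →
    (∀ c → (∀ b → Deg≤ A (c b)) → ∀ j → Deg≤ K (obs c j)) →
    (∀ c c′ j → obs c j ≈ obs c′ j → obs (λ b → c b +ᴾ -ᴾ c′ b) j ≈ []) →
    M ℕ.* suc K < L ℕ.* suc A →
    Σ[ c ∈ (Fin L → Poly) ] ((∀ b → Deg≤ A (c b)) × (∃[ b ] ¬ c b ≈ []) × (∀ j → obs c j ≈ []))
  nontrivial-solution {L} {M} {A} {K} obs deg-obs obs-diff M<L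
    with Fin.pigeonhole (ℕ.^-monoʳ-< p 1<p M<L) (λ e → funToFin (values {A = A} {K = K} obs e))
  ... | e , e′ , e<e′ , q = c , deg-c , nonzero , λ j → obs-diff (family {L} {A} e) (family {L} {A} e′) j
      (same j)
    where
    c : Fin L → Poly
    c b = family {L} {A} e b +ᴾ -ᴾ family {L} {A} e′ b
    deg-family : ∀ e b → Deg≤ A (family {L} {A} e b)
    deg-family e b = deg-tabulate (coefficients L A e b)
    deg-c : ∀ b → Deg≤ A (c b)
    deg-c b = deg-+ (deg-family e b) (deg-neg (deg-family e′ b))
    same-values : ∀ i → values {K = K} obs e i ≡ values {K = K} obs e′ i
    same-values i = trans (sym (Fin.finToFun-funToFin (values {K = K} obs e) i))
      (trans (cong (λ v → finToFun v i) q) (Fin.finToFun-funToFin (values {K = K} obs e′) i))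
    same : ∀ j → obs (family {L} {A} e) j ≈ obs (family {L} {A} e′) j
    same j .at k with k ℕ.≤? K
    ... | no k≰K = trans (above (deg-obs (family {L} {A} e) (deg-family e) j) k (ℕ.≰⇒> k≰K))
                         (sym (above (deg-obs (family {L} {A} e′) (deg-family e′) j) k (ℕ.≰⇒> k≰K)))
    ... | yes k≤K = trans (sym (eq e)) (trans (same-values (combine j k′)) (eq e′))
      where
      k′ = fromℕ< (s≤s k≤K)
      eq : ∀ e → values {K = K} obs e (combine j k′) ≡ coeff (obs (family {L} {A} e) j) k
      eq e = trans (cong (λ jk → coeff (obs (family {L} {A} e) (proj₁ jk)) (toℕ (proj₂ jk)))
          (Fin.remQuot-combine {M} j k′))
                   (cong (coeff (obs (family {L} {A} e) j)) (Fin.toℕ-fromℕ< (s≤s k≤K)))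
    nonzero : ∃[ b ] ¬ c b ≈ []
    nonzero with Fin.any? (λ b → ¬? (≈0? (c b)))
    ... | yes r = r
    ... | no ¬r = contradiction e≡e′ (Fin.<⇒≢ e<e′)
      where
      c≈0 : ∀ b → c b ≈ []
      c≈0 b with ≈0? (c b)
      ... | yes r = r
      ... | no r  = contradiction (b , r) ¬r
      agree-combine : ∀ b j → finToFun {p} {L ℕ.* suc A} e (combine b j) ≡ finToFun {p} {L ℕ.* suc A} e′
          (combine b j)
      agree-combine b j = trans (sym (coeff-tabulate (coefficients L A e b) j))
        (trans (at (f-g≈0⇒f≈g (c≈0 b)) (toℕ j)) (coeff-tabulate (coefficients L A e′ b) j))
      agree : finToFun {p} {L ℕ.* suc A} e ≗ finToFun e′
      agree i = subst (λ i → finToFun {p} {L ℕ.* suc A} e i ≡ finToFun e′ i) (Fin.combine-remQuot {L} (suc A) i)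
                  (agree-combine (proj₁ (remQuot {L} (suc A) i)) (proj₂ (remQuot {L} (suc A) i)))
      e≡e′ : e ≡ e′
      e≡e′ = trans (sym (Fin.funToFin-finToFin {L ℕ.* suc A} {p} e))
        (trans (funToFin-cong agree) (Fin.funToFin-finToFin {L ℕ.* suc A} {p} e′))

-- Stepanov's method: independence and the count of zeros.

module Stepanov {p′ : ℕ} (𝔽ₚ : PrimeField p′) where

  open PrimeField 𝔽ₚ
  open DiscreteField discreteField
  open Degrees discreteField
  open Derivatives discreteField
  open Wronskian 𝔽ₚ
  open LinearSystems 𝔽ₚ
  open SemiringSolver commutativeSemiring
  open SetoidReasoning setoid

  private
    F = Fin (suc p′)

  x+y≈y⇒x≈0 : ∀ {x y} → x +ᴾ y ≈ y → x ≈ []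
  x+y≈y⇒x≈0 {x} {y} p = begin
    x                  ≈⟨ +ᴾ-identityʳ x ⟨
    x +ᴾ []            ≈⟨ +ᴾ-congˡ (-ᴾ-inverseʳ y) ⟨
    x +ᴾ (y +ᴾ -ᴾ y)   ≈⟨ +ᴾ-assoc x y (-ᴾ y) ⟨
    x +ᴾ y +ᴾ -ᴾ y     ≈⟨ +ᴾ-congʳ p ⟩
    y +ᴾ -ᴾ y          ≈⟨ -ᴾ-inverseʳ y ⟩
    [] ∎

  x-y+y≈x : ∀ x y → x +ᴾ -ᴾ y +ᴾ y ≈ x
  x-y+y≈x x y = ≈-trans (+ᴾ-assoc x (-ᴾ y) y) (≈-trans (+ᴾ-congˡ (-ᴾ-inverseˡ y)) (+ᴾ-identityʳ x))

  -- Supplies the additivity that `nontrivial-solution` asks of its observations.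
  sum-diff≈0 : ∀ {k} (f g h : Fin k → Poly) → (∀ b → h b +ᴾ g b ≈ f b) → sum f ≈ sum g → sum h ≈ []
  sum-diff≈0 f g h p q = x+y≈y⇒x≈0 (begin
    sum h +ᴾ sum g              ≈⟨ ∑-distrib-+ h g ⟨
    sum (λ b → h b +ᴾ g b)      ≈⟨ sum-cong _ f p ⟩
    sum f                       ≈⟨ q ⟩
    sum g ∎)

  eval-sum-cong : ∀ {k} (f g : Fin k → Poly) x → (∀ b → eval (f b) x ≡ eval (g b) x) → eval (sum f) x ≡ eval
      (sum g) x
  eval-sum-cong {zero}  f g x p = refl
  eval-sum-cong {suc k} f g x p = trans (eval-+ (f zero) _ x)
    (trans (cong₂ _+_ (p zero) (eval-sum-cong (f ∘ suc) (g ∘ suc) x (p ∘ suc))) (sym (eval-+ (g zero) _ x)))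

  -- The functions E b solve the first order equations Q E′ = E ℓ, so that the
  -- operator Q d/dX acts on the coefficients c b of a combination ∑ E b * c b.
  module _ {L Dg A N : ℕ} {Q R : Poly} {E Ê ℓ : Fin L → Poly}
    (Q≉0 : ¬ Q ≈ []) (R≉0 : ¬ R ≈ []) (deg-Q : Deg≤ Dg Q) (deg-ℓ : ∀ b → Deg≤ Dg (ℓ b))
    (log-derivative : ∀ b → Q *ᴾ D (E b) ≈ E b *ᴾ ℓ b) (E*Ê : ∀ b → E b *ᴾ Ê b ≈ R)
    (deg-E* : ∀ b {c} → Deg≤ A c → Deg≤ N (E b *ᴾ c)) (N≤p′ : N ≤ p′)
    (separated : ∀ {b b′} → b ≢ b′ → ∀ {y y′} → Deg≤ (L ℕ.* (A ℕ.+ L ℕ.* Dg)) y →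
                 Deg≤ (L ℕ.* (A ℕ.+ L ℕ.* Dg)) y′ → y *ᴾ E b′ ≈ y′ *ᴾ E b → y ≈ [])
    where

    open Derivation Q

    E≉0 : ∀ b → ¬ E b ≈ []
    E≉0 b q = R≉0 (≈-trans (≈-sym (E*Ê b)) (≈-trans (*ᴾ-congʳ q) (*ᴾ-zeroˡ (Ê b))))

    -- This is `∂` conjugated by multiplication with `E b`.
    δ : Fin L → Poly → Poly
    δ b c = Q *ᴾ D c +ᴾ ℓ b *ᴾ c

    δ^ : Fin L → ℕ → Poly → Poly
    δ^ b zero    c = c
    δ^ b (suc k) c = δ b (δ^ b k c)

    δ-cong : ∀ b {c c′} → c ≈ c′ → δ b c ≈ δ b c′
    δ-cong b p = +ᴾ-cong (*ᴾ-congˡ (D-cong p)) (*ᴾ-congˡ p)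

    δ^-cong : ∀ b k {c c′} → c ≈ c′ → δ^ b k c ≈ δ^ b k c′
    δ^-cong b zero    p = p
    δ^-cong b (suc k) p = δ-cong b (δ^-cong b k p)

    δ-+ : ∀ b c c′ → δ b (c +ᴾ c′) ≈ δ b c +ᴾ δ b c′
    δ-+ b c c′ = ≈-trans (+ᴾ-congʳ (*ᴾ-congˡ (D-+ c c′))) (regroup Q (D c) (D c′) (ℓ b) c c′)
      where
      regroup : ∀ q d d′ l c c′ → q *ᴾ (d +ᴾ d′) +ᴾ l *ᴾ (c +ᴾ c′) ≈ (q *ᴾ d +ᴾ l *ᴾ c) +ᴾ (q *ᴾ d′ +ᴾ l *ᴾ c′)
      regroup = solve 6 (λ q d d′ l c c′ → q :* (d :+ d′) :+ l :* (c :+ c′) := (q :* d :+ l :* c) :+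
          (q :* d′ :+ l :* c′)) ≈-refl

    δ^-+ : ∀ b k c c′ → δ^ b k (c +ᴾ c′) ≈ δ^ b k c +ᴾ δ^ b k c′
    δ^-+ b zero    c c′ = ≈-refl
    δ^-+ b (suc k) c c′ = ≈-trans (δ-cong b (δ^-+ b k c c′)) (δ-+ b _ _)

    deg-δ^ : ∀ b k {c} → Deg≤ A c → Deg≤ (A ℕ.+ k ℕ.* Dg) (δ^ b k c)
    deg-δ^ b zero    d = deg-mono (ℕ.m≤m+n A 0) d
    deg-δ^ b (suc k) d = deg-mono (ℕ.≤-reflexive eq)
        (deg-+ (deg-* deg-Q (deg-D (deg-δ^ b k d))) (deg-* (deg-ℓ b) (deg-δ^ b k d)))
      where
      eq : Dg ℕ.+ (A ℕ.+ k ℕ.* Dg) ≡ A ℕ.+ (Dg ℕ.+ k ℕ.* Dg)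
      eq = trans (sym (ℕ.+-assoc Dg A _)) (trans (cong (ℕ._+ k ℕ.* Dg) (ℕ.+-comm Dg A)) (ℕ.+-assoc A Dg _))

    ∂-E* : ∀ b c → ∂ (E b *ᴾ c) ≈ E b *ᴾ δ b c
    ∂-E* b c = begin
      Q *ᴾ D (E b *ᴾ c)                       ≈⟨ *ᴾ-congˡ (D-* (E b) c) ⟩
      Q *ᴾ (D (E b) *ᴾ c +ᴾ E b *ᴾ D c)       ≈⟨ regroup₁ Q (D (E b)) c (E b) (D c) ⟩
      Q *ᴾ D (E b) *ᴾ c +ᴾ E b *ᴾ (Q *ᴾ D c)  ≈⟨ +ᴾ-congʳ (*ᴾ-congʳ (log-derivative b)) ⟩
      E b *ᴾ ℓ b *ᴾ c +ᴾ E b *ᴾ (Q *ᴾ D c)    ≈⟨ regroup₂ (E b) (ℓ b) c (Q *ᴾ D c) ⟩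
      E b *ᴾ (Q *ᴾ D c +ᴾ ℓ b *ᴾ c) ∎
      where
      regroup₁ : ∀ q d c e f → q *ᴾ (d *ᴾ c +ᴾ e *ᴾ f) ≈ q *ᴾ d *ᴾ c +ᴾ e *ᴾ (q *ᴾ f)
      regroup₁ = solve 5 (λ q d c e f → q :* (d :* c :+ e :* f) := q :* d :* c :+ e :* (q :* f)) ≈-refl
      regroup₂ : ∀ e l c f → e *ᴾ l *ᴾ c +ᴾ e *ᴾ f ≈ e *ᴾ (f +ᴾ l *ᴾ c)
      regroup₂ = solve 4 (λ e l c f → e :* l :* c :+ e :* f := e :* (f :+ l :* c)) ≈-refl

    ∂^-E* : ∀ b k c → ∂^ k (E b *ᴾ c) ≈ E b *ᴾ δ^ b k c
    ∂^-E* b zero    c = ≈-refl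
    ∂^-E* b (suc k) c = ≈-trans (∂-cong (∂^-E* b k c)) (∂-E* b (δ^ b k c))

    -- The quantification over injections `σ` lets the induction on `s` drop any of the products.
    Independent : ℕ → Set
    Independent s = (σ : Fin s → Fin L) → (∀ {i j} → σ i ≡ σ j → i ≡ j) →
                    (c : Fin s → Poly) → (∀ b → Deg≤ A (c b)) →
                    sum (λ b → E (σ b) *ᴾ c b) ≈ [] → ∀ b → c b ≈ []

    -- The derivatives of a relation say that (1, ..., 1) is in the kernel of the Wronskian matrix
    -- of the `E b * c b`. Counting provides a second kernel vector, of small degree up to the
    -- factors `Ê b`. Subtracting a multiple of the first removes index 0, and the Wronskian
    -- criterion then either makes the two proportional, against `separated`, or yields a shorter
    -- relation.
    independent-suc : ∀ r → Independent (suc r) → Independent (suc (suc r))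
    independent-suc r IH σ σ-inj c deg-c rel with Fin.any? (λ b → ≈0? (c b))
    ... | yes (i , cᵢ≈0) = vanish
      where
      rest : sum (λ b → E (σ (punchIn i b)) *ᴾ c (punchIn i b)) ≈ []
      rest = begin
        sum (λ b → E (σ (punchIn i b)) *ᴾ c (punchIn i b))          ≈⟨ +ᴾ-identityˡ _ ⟨
        [] +ᴾ sum (λ b → E (σ (punchIn i b)) *ᴾ c (punchIn i b))
          ≈⟨ +ᴾ-congʳ (≈-trans (*ᴾ-congˡ cᵢ≈0) (*ᴾ-zeroʳ (E (σ i)))) ⟨
        E (σ i) *ᴾ c i +ᴾ sum (λ b → E (σ (punchIn i b)) *ᴾ c (punchIn i b))
          ≈⟨ sum-remove {i = i} (λ b → E (σ b) *ᴾ c b) ⟨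
        sum (λ b → E (σ b) *ᴾ c b)                                  ≈⟨ rel ⟩
        [] ∎
      vanish : ∀ b → c b ≈ []
      vanish b with i Fin.≟ b
      ... | yes refl = cᵢ≈0
      ... | no i≢b = subst (λ j → c j ≈ []) (Fin.punchIn-punchOut i≢b)
        (IH (σ ∘ punchIn i) (Fin.punchIn-injective i _ _ ∘ σ-inj) (c ∘ punchIn i) (deg-c ∘ punchIn i) rest
            (punchOut i≢b))
    ... | no all≉0 = λ _ → contradiction solution no-solution
      where
      s = suc r
      -- With this degree the (s + 1)(Y + 1) unknown coefficients exceed the number of equations by
      -- exactly one.
      Y = s ℕ.* (A ℕ.+ s ℕ.* Dg)
      c≉0 : ∀ b → ¬ c b ≈ []
      c≉0 b q = all≉0 (b , q)

      g : Fin (suc s) → Poly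
      g b = E (σ b) *ᴾ c b
      h : Fin s → Fin (suc s) → Poly
      h k b = δ^ (σ b) (toℕ k) (c b)
      obs : (Fin (suc s) → Poly) → Fin s → Poly
      obs y k = sum (λ b → y b *ᴾ h k b)

      deg-obs : ∀ y → (∀ b → Deg≤ Y (y b)) → ∀ k → Deg≤ (Y ℕ.+ (A ℕ.+ s ℕ.* Dg)) (obs y k)
      deg-obs y deg-y k = deg-sum (λ b → y b *ᴾ h k b) λ b → deg-* (deg-y b)
        (deg-mono (ℕ.+-monoʳ-≤ A (ℕ.*-monoˡ-≤ Dg (ℕ.<⇒≤ (Fin.toℕ<n k)))) (deg-δ^ (σ b) (toℕ k) (deg-c b)))

      obs-diff : ∀ y y′ k → obs y k ≈ obs y′ k → obs (λ b → y b +ᴾ -ᴾ y′ b) k ≈ []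
      obs-diff y y′ k = sum-diff≈0 (λ b → y b *ᴾ h k b) (λ b → y′ b *ᴾ h k b) (λ b → (y b +ᴾ -ᴾ y′ b) *ᴾ h k b)
        λ b → ≈-trans (≈-sym (*ᴾ-distribʳ (h k b) _ _)) (*ᴾ-congʳ (x-y+y≈x (y b) (y′ b)))

      count : s ℕ.* suc (Y ℕ.+ (A ℕ.+ s ℕ.* Dg)) < suc s ℕ.* suc Y
      count = ℕ.≤-reflexive (cong suc (trans (ℕ.*-distribˡ-+ s (suc Y) (A ℕ.+ s ℕ.* Dg))
          (ℕ.+-comm (s ℕ.* suc Y) Y)))

      Solution : Set
      Solution = Σ[ y ∈ (Fin (suc s) → Poly) ]
          ((∀ b → Deg≤ Y (y b)) × (∃[ b ] ¬ y b ≈ []) × (∀ k → obs y k ≈ []))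

      solution : Solution
      solution = nontrivial-solution obs deg-obs obs-diff count

      no-solution : ¬ Solution
      no-solution (y , deg-y , (b₀ , y≉0) , obs≈0) = conclude
        (wronskian Q≉0 (g ∘ suc) (w ∘ suc) (deg-g ∘ suc)
            (λ k k<s → tail-relation w (λ b → ∂^ k (g b)) (-ᴾ-inverseʳ (z zero)) (Σw∂g≈0 k k<s)))
        where
        -- Up to the common factor `R`, `z b` is the quotient of `y b` by `E (σ b)`. The vector `w`
        -- is `z` minus `z zero` times the constant vector.
        z w : Fin (suc s) → Poly
        z b = y b *ᴾ Ê (σ b)
        w b = z b +ᴾ -ᴾ z zero

        deg-g : ∀ b → Deg≤ p′ (g b)
        deg-g b = deg-mono N≤p′ (deg-E* (σ b) (deg-c b))

        Σz∂g≈0 : ∀ k → k < s → sum (λ b → z b *ᴾ ∂^ k (g b)) ≈ []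
        Σz∂g≈0 k k<s = begin
          sum (λ b → z b *ᴾ ∂^ k (g b))               ≈⟨ sum-cong _ (λ b → R *ᴾ (y b *ᴾ δ^ (σ b) k (c b)))
              term ⟩
          sum (λ b → R *ᴾ (y b *ᴾ δ^ (σ b) k (c b)))  ≈⟨ *-distribˡ-sum R (λ b → y b *ᴾ δ^ (σ b) k (c b)) ⟨
          R *ᴾ sum (λ b → y b *ᴾ δ^ (σ b) k (c b))    ≈⟨ *ᴾ-congˡ Σyδ≈0 ⟩
          R *ᴾ []                                     ≈⟨ *ᴾ-zeroʳ R ⟩
          [] ∎
          where
          regroup : ∀ y ê e d → y *ᴾ ê *ᴾ (e *ᴾ d) ≈ e *ᴾ ê *ᴾ (y *ᴾ d)
          regroup = solve 4 (λ y ê e d → y :* ê :* (e :* d) := e :* ê :* (y :* d)) ≈-refl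
          term : ∀ b → z b *ᴾ ∂^ k (g b) ≈ R *ᴾ (y b *ᴾ δ^ (σ b) k (c b))
          term b = ≈-trans (*ᴾ-congˡ (∂^-E* (σ b) k (c b)))
            (≈-trans (regroup (y b) (Ê (σ b)) (E (σ b)) (δ^ (σ b) k (c b))) (*ᴾ-congʳ (E*Ê (σ b))))
          Σyδ≈0 : sum (λ b → y b *ᴾ δ^ (σ b) k (c b)) ≈ []
          Σyδ≈0 = subst (λ j → sum (λ b → y b *ᴾ δ^ (σ b) j (c b)) ≈ []) (Fin.toℕ-fromℕ< k<s)
              (obs≈0 (fromℕ< k<s))

        Σw∂g≈0 : ∀ k → k < s → sum (λ b → w b *ᴾ ∂^ k (g b)) ≈ []
        Σw∂g≈0 k k<s = begin
          sum (λ b → w b *ᴾ ∂^ k (g b))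
            ≈⟨ sum-cong _ (λ b → z b *ᴾ ∂^ k (g b) +ᴾ -ᴾ z zero *ᴾ ∂^ k (g b))
                (λ b → *ᴾ-distribʳ (∂^ k (g b)) (z b) (-ᴾ z zero)) ⟩
          sum (λ b → z b *ᴾ ∂^ k (g b) +ᴾ -ᴾ z zero *ᴾ ∂^ k (g b))
            ≈⟨ ∑-distrib-+ (λ b → z b *ᴾ ∂^ k (g b)) (λ b → -ᴾ z zero *ᴾ ∂^ k (g b)) ⟩
          sum (λ b → z b *ᴾ ∂^ k (g b)) +ᴾ sum (λ b → -ᴾ z zero *ᴾ ∂^ k (g b))
            ≈⟨ +ᴾ-cong (Σz∂g≈0 k k<s) (≈-sym (*-distribˡ-sum (-ᴾ z zero) (λ b → ∂^ k (g b)))) ⟩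
          [] +ᴾ -ᴾ z zero *ᴾ sum (λ b → ∂^ k (g b))   ≈⟨ +ᴾ-identityˡ _ ⟩
          -ᴾ z zero *ᴾ sum (λ b → ∂^ k (g b))         ≈⟨ *ᴾ-congˡ (≈-trans (≈-sym (∂^-sum k g)) (∂^-0 k rel)) ⟩
          -ᴾ z zero *ᴾ []                             ≈⟨ *ᴾ-zeroʳ _ ⟩
          [] ∎

        Y-bound : Y ≤ L ℕ.* (A ℕ.+ L ℕ.* Dg)
        Y-bound = ℕ.*-mono-≤ s≤L (ℕ.+-monoʳ-≤ A (ℕ.*-monoˡ-≤ Dg s≤L))
          where
          s≤L : s ≤ L
          s≤L = ℕ.≤-trans (ℕ.n≤1+n s) (Fin.injective⇒≤ σ-inj)

        -- Equal entries of `z` mean that E (σ i) / E (σ j) = y i / y j, a quotient of polynomials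
        -- of small degree.
        equal-z⇒y≈0 : ∀ i j → i ≢ j → z i ≈ z j → y i ≈ []
        equal-z⇒y≈0 i j i≢j p = separated (i≢j ∘ σ-inj) (deg-mono Y-bound (deg-y i))
            (deg-mono Y-bound (deg-y j)) (*ᴾ-cancelˡ R≉0 (begin
          R *ᴾ (y i *ᴾ E (σ j))                       ≈⟨ *ᴾ-congʳ (E*Ê (σ i)) ⟨
          E (σ i) *ᴾ Ê (σ i) *ᴾ (y i *ᴾ E (σ j))      ≈⟨ regroup (E (σ i)) (Ê (σ i)) (y i) (E (σ j)) ⟩
          E (σ i) *ᴾ E (σ j) *ᴾ z i                   ≈⟨ *ᴾ-cong (*ᴾ-comm (E (σ i)) (E (σ j))) p ⟩
          E (σ j) *ᴾ E (σ i) *ᴾ z j                   ≈⟨ regroup (E (σ j)) (Ê (σ j)) (y j) (E (σ i)) ⟨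
          E (σ j) *ᴾ Ê (σ j) *ᴾ (y j *ᴾ E (σ i))      ≈⟨ *ᴾ-congʳ (E*Ê (σ j)) ⟩
          R *ᴾ (y j *ᴾ E (σ i)) ∎))
          where
          regroup : ∀ e ê y f → e *ᴾ ê *ᴾ (y *ᴾ f) ≈ e *ᴾ f *ᴾ (y *ᴾ ê)
          regroup = solve 4 (λ e ê y f → e :* ê :* (y :* f) := e :* f :* (y :* ê)) ≈-refl

        y≈0 : (∀ b → w (suc b) ≈ []) → ∀ b → y b ≈ []
        y≈0 w≈0 zero    = equal-z⇒y≈0 zero (suc zero) (λ ()) (≈-sym (f-g≈0⇒f≈g (w≈0 zero)))
        y≈0 w≈0 (suc b) = equal-z⇒y≈0 (suc b) zero (λ ()) (f-g≈0⇒f≈g (w≈0 b))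

        conclude : ¬ ((∀ b → w (suc b) ≈ []) ⊎ LinearlyDependent (g ∘ suc))
        conclude (inj₁ w≈0) = y≉0 (y≈0 w≈0 b₀)
        -- A dependence over the field is a relation with one product fewer, whose coefficients
        -- `γ b * c b` still have degree at most `A`.
        conclude (inj₂ (γ , (b , γb≢0) , p)) = *ᴾ-nonzero (isDeg⇒≉0 (isDeg-C γb≢0)) (c≉0 (suc b))
          (IH (σ ∘ suc) (Fin.suc-injective ∘ σ-inj) (λ b → C (γ b) *ᴾ c (suc b))
              (λ b → deg-* (deg-C (γ b)) (deg-c (suc b)))
            (≈-trans (sum-cong _ (λ b → C (γ b) *ᴾ g (suc b))
                (λ b → regroup (E (σ (suc b))) (C (γ b)) (c (suc b)))) p) b)
          where
          regroup : ∀ e γ c → e *ᴾ (γ *ᴾ c) ≈ γ *ᴾ (e *ᴾ c)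
          regroup = solve 3 (λ e γ c → e :* (γ :* c) := γ :* (e :* c)) ≈-refl

    independent : ∀ s → Independent s
    independent zero          σ σ-inj c deg-c rel ()
    independent (suc zero)    σ σ-inj c deg-c rel zero with ≈0? (c zero)
    ... | yes q = q
    ... | no ¬q = contradiction (≈-trans (≈-sym (+ᴾ-identityʳ _)) rel) (*ᴾ-nonzero (E≉0 (σ zero)) ¬q)
    independent (suc (suc r)) = independent-suc r (independent (suc r))

    -- Since all `E b` equal 1 at the points, the k-th derivative of `Ψ` takes there the values of
    -- the sum of the `δ^ b k (c b)`. That sum is made to vanish identically, so the number of
    -- linear conditions does not depend on the number of points.
    zeros-bound : ∀ {M m} → m ≤ suc p′ → m ℕ.* suc (A ℕ.+ m ℕ.* Dg) < L ℕ.* suc A →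
                  (x : Fin M → F) → (∀ {i j} → x i ≡ x j → i ≡ j) →
                  (∀ i → eval Q (x i) ≢ 0#) → (∀ i b → eval (E b) (x i) ≡ 1#) → M ℕ.* m ≤ N
    zeros-bound {M} {m} m≤p count x x-inj Q≢0 E≡1 = conclude (nontrivial-solution obs deg-obs obs-diff count)
      where
      obs : (Fin L → Poly) → Fin m → Poly
      obs c k = sum (λ b → δ^ b (toℕ k) (c b))

      deg-obs : ∀ c → (∀ b → Deg≤ A (c b)) → ∀ k → Deg≤ (A ℕ.+ m ℕ.* Dg) (obs c k)
      deg-obs c deg-c k = deg-sum (λ b → δ^ b (toℕ k) (c b)) λ b →
        deg-mono (ℕ.+-monoʳ-≤ A (ℕ.*-monoˡ-≤ Dg (ℕ.<⇒≤ (Fin.toℕ<n k)))) (deg-δ^ b (toℕ k) (deg-c b))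

      obs-diff : ∀ c c′ k → obs c k ≈ obs c′ k → obs (λ b → c b +ᴾ -ᴾ c′ b) k ≈ []
      obs-diff c c′ k = sum-diff≈0 (λ b → δ^ b (toℕ k) (c b)) (λ b → δ^ b (toℕ k) (c′ b))
          (λ b → δ^ b (toℕ k) (c b +ᴾ -ᴾ c′ b))
        λ b → ≈-trans (≈-sym (δ^-+ b (toℕ k) _ _)) (δ^-cong b (toℕ k) (x-y+y≈x (c b) (c′ b)))

      ι≢0 : ∀ i → suc i < m → ι (suc i) ≢ 0#
      ι≢0 i i<m q = ℕ.<⇒≱ (ℕ.<-≤-trans i<m m≤p) (∣⇒≤ (ι≡0⇒∣ (suc i) q))

      conclude : Σ[ c ∈ (Fin L → Poly) ] ((∀ b → Deg≤ A (c b)) × (∃[ b ] ¬ c b ≈ []) × (∀ k → obs c k ≈ []))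
          → M ℕ.* m ≤ N
      conclude (c , deg-c , (b₀ , c≉0) , obs≈0) = roots-bound {g = Ψ} x x-inj Ψ≉0
        (λ i → Multiplicity.multiplicity (x i) (Q≢0 i) m Ψ ι≢0 (∂Ψ≡0 i))
        (deg-sum (λ b → E b *ᴾ c b) (λ b → deg-E* b (deg-c b)))
        where
        Ψ : Poly
        Ψ = sum (λ b → E b *ᴾ c b)
        Ψ≉0 : ¬ Ψ ≈ []
        Ψ≉0 q = c≉0 (independent L id id c deg-c q b₀)
        ∂Ψ≡0 : ∀ i k → k < m → eval (∂^ k Ψ) (x i) ≡ 0#
        ∂Ψ≡0 i k k<m = trans (eval-cong (≈-trans (∂^-sum k (λ b → E b *ᴾ c b))
            (sum-cong _ (λ b → E b *ᴾ δ^ b k (c b)) (λ b → ∂^-E* b k (c b)))) (x i))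
          (trans (eval-sum-cong (λ b → E b *ᴾ δ^ b k (c b)) (λ b → δ^ b k (c b)) (x i)
                   (λ b → trans (eval-* (E b) _ (x i))
                       (trans (cong (_* eval (δ^ b k (c b)) (x i)) (E≡1 i b)) (*-identityˡ _))))
                 (eval-0 (subst (λ j → sum (λ b → δ^ b j (c b)) ≈ []) (Fin.toℕ-fromℕ< k<m)
                     (obs≈0 (fromℕ< k<m))) (x i)))

-- Products of powers of pairwise coprime polynomials.

module PowerProducts {p′ : ℕ} (𝔽ₚ : PrimeField p′) where

  open PrimeField 𝔽ₚ
  open DiscreteField discreteField
  open Degrees discreteField
  open Derivatives discreteField
  open Stepanov 𝔽ₚ using (zeros-bound)
  open SemiringSolver commutativeSemiring
  open SetoidReasoning setoid
  open import Algebra.Properties.CommutativeMonoid.Sum (CommutativeRing.*-commutativeMonoid polynomialRing)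
      using ()
    renaming (sum to ∏; sum-remove to ∏-remove; ∑-distrib-+ to ∏-distrib-*; sum-cong-≋ to ∏-cong)

  private
    F = Fin (suc p′)

  deg-∏ : ∀ {n d} (f : Fin n → Poly) → (∀ i → Deg≤ d (f i)) → Deg≤ (n ℕ.* d) (∏ f)
  deg-∏ {zero}  f deg = deg-C 1#
  deg-∏ {suc n} f deg = deg-* (deg zero) (deg-∏ (f ∘ suc) (deg ∘ suc))

  ∏≉0 : ∀ {n} (f : Fin n → Poly) → (∀ i → ¬ f i ≈ []) → ¬ ∏ f ≈ []
  ∏≉0 {zero}  f p = isDeg⇒≉0 (isDeg-C 1≢0)
  ∏≉0 {suc n} f p = *ᴾ-nonzero (p zero) (∏≉0 (f ∘ suc) (p ∘ suc))

  coprime-∏ : ∀ {n g} (f : Fin n → Poly) → (∀ i → Coprime g (f i)) → Coprime g (∏ f)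
  coprime-∏ {zero}  f p = coprime-1 _
  coprime-∏ {suc n} f p = coprime-* (p zero) (coprime-∏ (f ∘ suc) (p ∘ suc))

  eval-∏≢0 : ∀ {n} (f : Fin n → Poly) x → (∀ i → eval (f i) x ≢ 0#) → eval (∏ f) x ≢ 0#
  eval-∏≢0 {zero}  f x p q = 1≢0 (trans (sym (eval-C 1# x)) q)
  eval-∏≢0 {suc n} f x p q = x*y≢0 (p zero) (eval-∏≢0 (f ∘ suc) x (p ∘ suc))
      (trans (sym (eval-* (f zero) _ x)) q)

  eval-∏≡1 : ∀ {n} (f : Fin n → Poly) x → (∀ i → eval (f i) x ≡ 1#) → eval (∏ f) x ≡ 1#
  eval-∏≡1 {zero}  f x p = eval-C 1# x
  eval-∏≡1 {suc n} f x p = trans (eval-* (f zero) _ x)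
      (trans (cong₂ _*_ (p zero) (eval-∏≡1 (f ∘ suc) x (p ∘ suc))) (*-identityˡ 1#))

  eval-^≡1 : ∀ f x k → eval f x ≡ 1# → eval (f ^ k) x ≡ 1#
  eval-^≡1 f x zero    p = eval-C 1# x
  eval-^≡1 f x (suc k) p = trans (eval-* f _ x) (trans (cong₂ _*_ p (eval-^≡1 f x k p)) (*-identityˡ 1#))

  powers : ∀ {n} → (Fin n → Poly) → (Fin n → ℕ) → Fin n → Poly
  powers P e i = P i ^ e i

  -- Q E′ / E for Q = ∏ P and E = ∏ (P i ^ e i).
  log-D : ∀ {n} → (Fin n → Poly) → (Fin n → ℕ) → Poly
  log-D {zero}  P e = []
  log-D {suc n} P e = C (ι (e zero)) *ᴾ (D (P zero) *ᴾ ∏ (P ∘ suc)) +ᴾ P zero *ᴾ log-D (P ∘ suc) (e ∘ suc)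

  deg-log-D : ∀ {n d} (P : Fin n → Poly) e → (∀ i → Deg≤ d (P i)) → Deg≤ (n ℕ.* d) (log-D P e)
  deg-log-D {zero}  P e deg = deg-0 ≈-refl
  deg-log-D {suc n} P e deg = deg-+
    (deg-* (deg-C (ι (e zero))) (deg-* (deg-D (deg zero)) (deg-∏ (P ∘ suc) (deg ∘ suc))))
    (deg-* (deg zero) (deg-log-D (P ∘ suc) (e ∘ suc) (deg ∘ suc)))

  log-derivative : ∀ {n} (P : Fin n → Poly) e → ∏ P *ᴾ D (∏ (powers P e)) ≈ ∏ (powers P e) *ᴾ log-D P e
  log-derivative {zero}  P e = ≈-trans (≈-trans (*ᴾ-congˡ (D-C 1#)) (*ᴾ-zeroʳ (C 1#))) (≈-sym (*ᴾ-zeroʳ (C 1#)))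
  log-derivative {suc n} P e = begin
    P₀ *ᴾ Q *ᴾ D (E₀ *ᴾ E)                          ≈⟨ *ᴾ-congˡ (D-* E₀ E) ⟩
    P₀ *ᴾ Q *ᴾ (D E₀ *ᴾ E +ᴾ E₀ *ᴾ D E)             ≈⟨ regroup₁ P₀ Q (D E₀) E E₀ (D E) ⟩
    P₀ *ᴾ D E₀ *ᴾ (Q *ᴾ E) +ᴾ P₀ *ᴾ E₀ *ᴾ (Q *ᴾ D E)
      ≈⟨ +ᴾ-cong (*ᴾ-congʳ (*D-^ P₀ (e zero))) (*ᴾ-congˡ (log-derivative (P ∘ suc) (e ∘ suc))) ⟩
    C (ι (e zero)) *ᴾ (E₀ *ᴾ D P₀) *ᴾ (Q *ᴾ E) +ᴾ P₀ *ᴾ E₀ *ᴾ (E *ᴾ l)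
      ≈⟨ regroup₂ (C (ι (e zero))) E₀ (D P₀) Q E P₀ l ⟩
    E₀ *ᴾ E *ᴾ (C (ι (e zero)) *ᴾ (D P₀ *ᴾ Q) +ᴾ P₀ *ᴾ l) ∎
    where
    P₀ = P zero
    Q = ∏ (P ∘ suc)
    E₀ = P zero ^ e zero
    E = ∏ (powers (P ∘ suc) (e ∘ suc))
    l = log-D (P ∘ suc) (e ∘ suc)
    regroup₁ : ∀ p q d e e₀ d′ → p *ᴾ q *ᴾ (d *ᴾ e +ᴾ e₀ *ᴾ d′) ≈ p *ᴾ d *ᴾ (q *ᴾ e) +ᴾ p *ᴾ e₀ *ᴾ (q *ᴾ d′)
    regroup₁ = solve 6 (λ p q d e e₀ d′ → p :* q :* (d :* e :+ e₀ :* d′) := p :* d :* (q :* e) :+ p :* e₀ :*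
        (q :* d′)) ≈-refl
    regroup₂ : ∀ c e₀ d q e p l → c *ᴾ (e₀ *ᴾ d) *ᴾ (q *ᴾ e) +ᴾ p *ᴾ e₀ *ᴾ (e *ᴾ l) ≈ e₀ *ᴾ e *ᴾ
        (c *ᴾ (d *ᴾ q) +ᴾ p *ᴾ l)
    regroup₂ = solve 7 (λ c e₀ d q e p l → c :* (e₀ :* d) :* (q :* e) :+ p :* e₀ :* (e :* l) := e₀ :* e :*
        (c :* (d :* q) :+ p :* l)) ≈-refl

  -- Cancelling the smaller power of `P i` leaves `P i ^ k` as a divisor of `y` times a product
  -- coprime to it, hence of `y`, whose degree is too small for that.
  powers-∣⇒≈0 : ∀ {n} (P : Fin n → Poly) (e e′ : Fin n → ℕ) i {k r Y} → e i ≡ e′ i ℕ.+ k →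
                (∀ {i j} → i ≢ j → Coprime (P i) (P j)) → ¬ P i ≈ [] → IsDeg r (P i) → Y < k ℕ.* r →
                ∀ {y y′} → Deg≤ Y y → y *ᴾ ∏ (powers P e′) ≈ y′ *ᴾ ∏ (powers P e) → y ≈ []
  powers-∣⇒≈0 {suc n} P e e′ i {k} {r} {Y} eᵢ coprime Pᵢ≉0 deg-Pᵢ Y<kr {y} {y′} deg-y p = conclude (≈0? y)
    where
    Pᵢ = P i
    rest = ∏ (powers P e ∘ punchIn i)
    rest′ = ∏ (powers P e′ ∘ punchIn i)
    regroup₁ : ∀ a y r → a *ᴾ (r *ᴾ y) ≈ y *ᴾ (a *ᴾ r)
    regroup₁ = solve 3 (λ a y r → a :* (r :* y) := y :* (a :* r)) ≈-refl
    regroup₂ : ∀ a b y r → y *ᴾ (a *ᴾ b *ᴾ r) ≈ a *ᴾ (b *ᴾ (r *ᴾ y))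
    regroup₂ = solve 4 (λ a b y r → y :* (a :* b :* r) := a :* (b :* (r :* y))) ≈-refl
    divides : Pᵢ ^ k ∣ rest′ *ᴾ y
    divides = rest *ᴾ y′ , ≈-sym (*ᴾ-cancelˡ (^-nonzero (e′ i) Pᵢ≉0) (begin
      Pᵢ ^ e′ i *ᴾ (rest′ *ᴾ y)                ≈⟨ regroup₁ (Pᵢ ^ e′ i) y rest′ ⟩
      y *ᴾ (Pᵢ ^ e′ i *ᴾ rest′)                ≈⟨ *ᴾ-congˡ (∏-remove {i = i} (powers P e′)) ⟨
      y *ᴾ ∏ (powers P e′)                     ≈⟨ p ⟩
      y′ *ᴾ ∏ (powers P e)                     ≈⟨ *ᴾ-congˡ (∏-remove {i = i} (powers P e)) ⟩
      y′ *ᴾ (Pᵢ ^ e i *ᴾ rest)                 ≡⟨ cong (λ j → y′ *ᴾ (Pᵢ ^ j *ᴾ rest)) eᵢ ⟩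
      y′ *ᴾ (Pᵢ ^ (e′ i ℕ.+ k) *ᴾ rest)        ≈⟨ *ᴾ-congˡ (*ᴾ-congʳ (^-homo-* Pᵢ (e′ i) k)) ⟩
      y′ *ᴾ (Pᵢ ^ e′ i *ᴾ Pᵢ ^ k *ᴾ rest)      ≈⟨ regroup₂ (Pᵢ ^ e′ i) (Pᵢ ^ k) y′ rest ⟩
      Pᵢ ^ e′ i *ᴾ (Pᵢ ^ k *ᴾ (rest *ᴾ y′)) ∎))
    conclude : Dec (y ≈ []) → y ≈ []
    conclude (yes q) = q
    conclude (no ¬q) = contradiction
      (isDeg-∣ (isDeg-^ k deg-Pᵢ) (coprime-∣ (coprime-∏ (powers P e′ ∘ punchIn i)
        (λ j → coprime-^ k (e′ (punchIn i j)) (coprime (λ q → Fin.punchInᵢ≢i i j (sym q))))) divides) ¬q deg-y)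
      (ℕ.<⇒≱ Y<kr)

  module _ {n d B t m M : ℕ} (P : Fin n → Poly) (deg-P : ∀ i → Deg≤ d (P i))
    (P-nonconstant : ∀ i → ∃[ r ] (0 < r × IsDeg r (P i)))
    (coprime : ∀ {i j} → i ≢ j → Coprime (P i) (P j)) where

    private
      -- With A = Dg * L, up to L applications of `δ` raise the degree from `A` to at most 2 A.
      Dg L A : ℕ
      Dg = n ℕ.* d
      L = B ℕ.^ n
      A = Dg ℕ.* L

    -- The indices are the digit vectors of length n in base `B`. All exponents are multiples of
    -- `t`, so every `E b` is 1 at the points, while two different products differ by at least the
    -- t-th power of some `P i`.
    common-subgroup-values-bound : L ℕ.* (A ℕ.+ L ℕ.* Dg) < t → n ℕ.* (t ℕ.* B ℕ.* d) ℕ.+ A ≤ p′ →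
      m ≤ suc p′ → m ℕ.* suc (A ℕ.+ m ℕ.* Dg) < L ℕ.* suc A →
      (x : Fin M → F) → (∀ {i j} → x i ≡ x j → i ≡ j) →
      (∀ j i → eval (P i) (x j) ≢ 0#) → (∀ j i → eval (P i ^ t) (x j) ≡ 1#) →
      M ℕ.* m ≤ n ℕ.* (t ℕ.* B ℕ.* d) ℕ.+ A
    common-subgroup-values-bound Y<t N≤p′ m≤p count x x-inj P≢0 P^t≡1 =
      zeros-bound {Q = ∏ P} {R = ∏ (powers P (λ _ → t ℕ.* B))} {E = E} {Ê = Ê} {ℓ = λ b → log-D P (e b)}
        (∏≉0 P P≉0) (∏≉0 (powers P (λ _ → t ℕ.* B)) (λ i → ^-nonzero (t ℕ.* B) (P≉0 i)))
        (deg-∏ P deg-P) (λ b → deg-log-D P (e b) deg-P)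
        (λ b → log-derivative P (e b)) E*Ê deg-E* N≤p′ separated m≤p count x x-inj
        (λ j → eval-∏≢0 P (x j) (P≢0 j)) E≡1
      where
      digit : Fin L → Fin n → ℕ
      digit b i = toℕ (finToFun b i)
      digit≤B : ∀ b i → digit b i ≤ B
      digit≤B b i = ℕ.<⇒≤ (Fin.toℕ<n (finToFun {B} {n} b i))
      e ê : Fin L → Fin n → ℕ
      e b i = t ℕ.* digit b i
      ê b i = t ℕ.* (B ℕ.∸ digit b i)
      E Ê : Fin L → Poly
      E b = ∏ (powers P (e b))
      Ê b = ∏ (powers P (ê b))
      P≉0 : ∀ i → ¬ P i ≈ []
      P≉0 i = isDeg⇒≉0 (proj₂ (proj₂ (P-nonconstant i)))

      E*Ê : ∀ b → E b *ᴾ Ê b ≈ ∏ (powers P (λ _ → t ℕ.* B))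
      E*Ê b = ≈-trans (≈-sym (∏-distrib-* (powers P (e b)) (powers P (ê b)))) (∏-cong λ i →
        ≈-trans (≈-sym (^-homo-* (P i) (e b i) (ê b i)))
          (≈-reflexive (cong (P i ^_) (trans (sym (ℕ.*-distribˡ-+ t (digit b i) _))
              (cong (t ℕ.*_) (ℕ.m+[n∸m]≡n (digit≤B b i)))))))
        where
        ≈-reflexive : ∀ {f g} → f ≡ g → f ≈ g
        ≈-reflexive refl = ≈-refl

      deg-E* : ∀ b {c} → Deg≤ A c → Deg≤ (n ℕ.* (t ℕ.* B ℕ.* d) ℕ.+ A) (E b *ᴾ c)
      deg-E* b deg-c = deg-* (deg-∏ (powers P (e b)) λ i →
        deg-mono (ℕ.*-monoˡ-≤ d (ℕ.*-monoʳ-≤ t (digit≤B b i))) (deg-^ (e b i) (deg-P i))) deg-c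

      E≡1 : ∀ j b → eval (E b) (x j) ≡ 1#
      E≡1 j b = eval-∏≡1 (powers P (e b)) (x j) λ i →
        trans (eval-cong (≈-sym (^-assocʳ (P i) t (digit b i))) (x j))
            (eval-^≡1 (P i ^ t) (x j) (digit b i) (P^t≡1 j i))

      larger-digit : ∀ {b b′} i → digit b′ i < digit b i → ∀ {y y′} → Deg≤ (L ℕ.* (A ℕ.+ L ℕ.* Dg)) y →
                     y *ᴾ E b′ ≈ y′ *ᴾ E b → y ≈ []
      larger-digit {b} {b′} i b′<b deg-y = powers-∣⇒≈0 P (e b) (e b′) i {k = t ℕ.* (digit b i ℕ.∸ digit b′ i)}
        (trans (cong (t ℕ.*_) (sym (ℕ.m+[n∸m]≡n (ℕ.<⇒≤ b′<b)))) (ℕ.*-distribˡ-+ t (digit b′ i) _))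
        coprime (P≉0 i) (proj₂ (proj₂ (P-nonconstant i)))
        (ℕ.<-≤-trans Y<t (ℕ.≤-trans (ℕ.≤-trans (ℕ.≤-reflexive (sym (ℕ.*-identityʳ t)))
            (ℕ.*-monoʳ-≤ t (ℕ.m<n⇒0<n∸m b′<b)))
          (ℕ.≤-trans (ℕ.≤-reflexive (sym (ℕ.*-identityʳ _)))
              (ℕ.*-monoʳ-≤ (t ℕ.* (digit b i ℕ.∸ digit b′ i)) (proj₁ (proj₂ (P-nonconstant i))))))) deg-y

      separated : ∀ {b b′} → b ≢ b′ → ∀ {y y′} → Deg≤ (L ℕ.* (A ℕ.+ L ℕ.* Dg)) y → Deg≤
          (L ℕ.* (A ℕ.+ L ℕ.* Dg)) y′ →
                  y *ᴾ E b′ ≈ y′ *ᴾ E b → y ≈ []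
      separated {b} {b′} b≢b′ {y} {y′} deg-y deg-y′ p = different
          (Fin.all? (λ i → finToFun {B} {n} b i Fin.≟ finToFun b′ i))
        where
        E≉0 : ∀ b → ¬ E b ≈ []
        E≉0 b = ∏≉0 (powers P (e b)) (λ i → ^-nonzero (e b i) (P≉0 i))
        y≈0 : y′ ≈ [] → Dec (y ≈ []) → y ≈ []
        y≈0 q (yes r) = r
        y≈0 q (no ¬r) = contradiction (≈-trans p (≈-trans (*ᴾ-congʳ q) (*ᴾ-zeroˡ (E b))))
            (*ᴾ-nonzero ¬r (E≉0 b′))
        different : Dec (∀ i → finToFun {B} {n} b i ≡ finToFun b′ i) → y ≈ []
        different (yes q) = contradiction (trans (sym (Fin.funToFin-finToFin {n} {B} b))
            (trans (funToFin-cong q) (Fin.funToFin-finToFin {n} {B} b′))) b≢b′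
        different (no ¬q) with Fin.¬∀⟶∃¬ n _ (λ i → finToFun {B} {n} b i Fin.≟ finToFun b′ i) ¬q
        ... | i , bᵢ≢ with ℕ.<-cmp (digit b′ i) (digit b i)
        ...   | tri< lt _ _ = larger-digit i lt deg-y p
        ...   | tri≈ _ q _  = contradiction (sym (Fin.toℕ-injective q)) bᵢ≢
        -- Here the larger exponent belongs to `b′`: the argument first gives that `y′` vanishes,
        -- and then `y` does because `E b′` is nonzero.
        ...   | tri> _ _ gt = y≈0 (larger-digit i gt deg-y′ (≈-sym p)) (≈0? y)

-- Composition and iterates of a polynomial.

module Iterates {p′ : ℕ} (𝔽ₚ : PrimeField p′) where

  open PrimeField 𝔽ₚ
  open DiscreteField discreteField
  open Degrees discreteField
  open PowerProducts 𝔽ₚ using (common-subgroup-values-bound)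
  open SemiringSolver commutativeSemiring
  open SetoidReasoning setoid

  private
    F = Fin (suc p′)

  comp : Poly → Poly → Poly
  comp f g = foldr (λ a h → C a +ᴾ g *ᴾ h) [] f

  eval-comp : ∀ f g x → eval (comp f g) x ≡ eval f (eval g x)
  eval-comp []      g x = refl
  eval-comp (a ∷ f) g x = trans (eval-+ (C a) _ x) (cong₂ _+_ (eval-C a x)
    (trans (eval-* g (comp f g) x) (cong (eval g x *_) (eval-comp f g x))))

  comp-0 : ∀ {f} → f ≈ [] → ∀ g → comp f g ≈ []
  comp-0 {[]}    p g = ≈-refl
  comp-0 {a ∷ f} p g = ≈-trans (+ᴾ-cong (≈-trans (C-cong (at p 0)) C-0)
    (≈-trans (*ᴾ-congˡ (comp-0 {f} (mk≈ λ i → at p (suc i)) g)) (*ᴾ-zeroʳ g))) (+ᴾ-identityˡ [])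

  comp-cong : ∀ f {g g′} → g ≈ g′ → comp f g ≈ comp f g′
  comp-cong []      p = ≈-refl
  comp-cong (a ∷ f) p = +ᴾ-congˡ (*ᴾ-cong p (comp-cong f p))

  deg-comp : ∀ {m e} f {g} → Deg≤ m f → Deg≤ e g → Deg≤ (m ℕ.* e) (comp f g)
  deg-comp         []      d d′ = deg-0 ≈-refl
  deg-comp {zero}  (a ∷ f) {g} d d′ = deg-cong (≈-sym (≈-trans
    (+ᴾ-congˡ (≈-trans (*ᴾ-congˡ (comp-0 {f} (mk≈ λ i → above d (suc i) z<s) g)) (*ᴾ-zeroʳ g)))
        (+ᴾ-identityʳ (C a)))) (deg-C a)
  deg-comp {suc m} (a ∷ f) d d′ = deg-+ (deg-mono z≤n (deg-C a))
      (deg-* d′ (deg-comp f (mkDeg≤ λ i m<i → above d (suc i) (s<s m<i)) d′))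

  -- The congruence f (a + g h) ≡ f a modulo `g`, which carries the induction for `iterate-+`.
  comp-shift : ∀ f a g h → ∃[ k ] comp f (C a +ᴾ g *ᴾ h) ≈ C (eval f a) +ᴾ g *ᴾ k
  comp-shift []      a g h = [] , ≈-sym (≈-trans (+ᴾ-cong C-0 (*ᴾ-zeroʳ g)) (+ᴾ-identityˡ []))
  comp-shift (b ∷ f) a g h with comp-shift f a g h
  ... | k , p = C a *ᴾ k +ᴾ h *ᴾ (C (eval f a) +ᴾ g *ᴾ k) , (begin
    C b +ᴾ (C a +ᴾ g *ᴾ h) *ᴾ comp f (C a +ᴾ g *ᴾ h)            ≈⟨ +ᴾ-congˡ (*ᴾ-congˡ p) ⟩
    C b +ᴾ (C a +ᴾ g *ᴾ h) *ᴾ (C (eval f a) +ᴾ g *ᴾ k)          ≈⟨ regroup (C b) (C a) g h (C (eval f a)) k ⟩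
    C b +ᴾ C a *ᴾ C (eval f a) +ᴾ g *ᴾ (C a *ᴾ k +ᴾ h *ᴾ (C (eval f a) +ᴾ g *ᴾ k))
      ≈⟨ +ᴾ-congʳ (≈-trans (C-+ b _) (+ᴾ-congˡ (C-* a _))) ⟨
    C (b + a * eval f a) +ᴾ g *ᴾ (C a *ᴾ k +ᴾ h *ᴾ (C (eval f a) +ᴾ g *ᴾ k)) ∎)
    where
    regroup : ∀ b a g h e k → b +ᴾ (a +ᴾ g *ᴾ h) *ᴾ (e +ᴾ g *ᴾ k) ≈ b +ᴾ a *ᴾ e +ᴾ g *ᴾ
        (a *ᴾ k +ᴾ h *ᴾ (e +ᴾ g *ᴾ k))
    regroup = solve 6 (λ b a g h e k → b :+ (a :+ g :* h) :* (e :+ g :* k) := b :+ a :* e :+ g :*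
        (a :* k :+ h :* (e :+ g :* k))) ≈-refl

  nonconstant⇒isDeg : ∀ f {x y} → eval f x ≢ eval f y → ∃[ r ] (0 < r × IsDeg r f)
  nonconstant⇒isDeg f {x} {y} fx≢fy with zero⊎isDeg f
  ... | inj₁ p           = contradiction (trans (eval-0 p x) (sym (eval-0 p y))) fx≢fy
  ... | inj₂ (suc r , d) = suc r , z<s , d
  ... | inj₂ (zero , d , _) = contradiction (trans (constant x) (sym (constant y))) fx≢fy
    where
    f≈C : f ≈ C (coeff f 0)
    f≈C .at zero    = sym (coeff-C-zero _)
    f≈C .at (suc i) = trans (above d (suc i) z<s) (sym (coeff-C _ i))
    constant : ∀ x → eval f x ≡ coeff f 0
    constant x = trans (eval-cong f≈C x) (eval-C _ x)

  orbit : Poly → F → ℕ → F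
  orbit f u zero    = u
  orbit f u (suc n) = eval f (orbit f u n)

  iterate : Poly → ℕ → Poly
  iterate f zero    = X
  iterate f (suc i) = comp f (iterate f i)

  eval-iterate : ∀ f u i n → eval (iterate f i) (orbit f u n) ≡ orbit f u (i ℕ.+ n)
  eval-iterate f u zero    n = eval-X _
  eval-iterate f u (suc i) n = trans (eval-comp f (iterate f i) _) (cong (eval f) (eval-iterate f u i n))

  deg-iterate : ∀ {d} f i → Deg≤ d f → Deg≤ (d ℕ.^ i) (iterate f i)
  deg-iterate f zero    deg-f = deg-X
  deg-iterate f (suc i) deg-f = deg-comp f deg-f (deg-iterate f i deg-f)

  iterate-+ : ∀ f r i → ∃[ h ] iterate f (r ℕ.+ i) ≈ C (orbit f 0# r) +ᴾ iterate f i *ᴾ h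
  iterate-+ f zero    i = C 1# , ≈-sym (≈-trans (+ᴾ-cong C-0 (*ᴾ-identityʳ _)) (+ᴾ-identityˡ _))
  iterate-+ f (suc r) i with iterate-+ f r i
  ... | h , p with comp-shift f (orbit f 0# r) (iterate f i) h
  ...   | k , q = k , ≈-trans (comp-cong f p) q

  coprime-iterates : ∀ {n} f → (∀ r → 0 < r → r < n → orbit f 0# r ≢ 0#) →
                     ∀ {i j} → i < j → j < n → Coprime (iterate f i) (iterate f j)
  coprime-iterates f aperiodic {i} {j} i<j j<n with iterate-+ f (j ℕ.∸ i) i
  ... | h , p rewrite ℕ.m∸n+n≡m (ℕ.<⇒≤ i<j) =
    coprime-const (orbit f 0# (j ℕ.∸ i)) (aperiodic (j ℕ.∸ i) (ℕ.m<n⇒0<n∸m i<j)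
        (ℕ.≤-<-trans (ℕ.m∸n≤m j i) j<n)) p

  -- The points are the first M + 1 of the orbit. The polynomial `P i` sends the l-th to the one of
  -- index i + l, which is below `h` because n + (M + 1) ≤ h.
  orbit-bound : ∀ {n d B t m M h} f → Deg≤ d f → 0 < d → (∀ r → 0 < r → r < n → orbit f 0# r ≢ 0#) →
    let Dg = n ℕ.* d ℕ.^ n ; L = B ℕ.^ n ; A = Dg ℕ.* L ; N = n ℕ.* (t ℕ.* B ℕ.* d ℕ.^ n) ℕ.+ A in
    L ℕ.* (A ℕ.+ L ℕ.* Dg) < t → N ≤ p′ → m ≤ suc p′ → m ℕ.* suc (A ℕ.+ m ℕ.* Dg) < L ℕ.* suc A →
    ∀ u → (∀ {i j} → i < h → j < h → orbit f u i ≡ orbit f u j → i ≡ j) →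
    (∀ i → i < h → orbit f u i ≢ 0#) → (∀ i → i < h → eval (X ^ t) (orbit f u i) ≡ 1#) →
    n ℕ.+ suc M ≤ h → suc M ℕ.* m ≤ N
  orbit-bound {n} {d} {B} {t} {m} {M} {h} f deg-f 0<d aperiodic Y<t N≤p′ m≤p count u inj u≢0 u^t≡1 M≤h =
    common-subgroup-values-bound {B = B} P deg-P P-nonconstant coprime Y<t N≤p′ m≤p count
      (λ l → orbit f u (toℕ l)) (λ p → Fin.toℕ-injective (inj (l<h _) (l<h _) p))
      (λ l i → subst (_≢ 0#) (sym (eval-iterate f u (toℕ i) (toℕ l))) (u≢0 _ (i+l<h i l)))
      (λ l i → trans (eval-^-X (P i) (orbit f u (toℕ l)) t)
        (trans (cong (eval (X ^ t)) (eval-iterate f u (toℕ i) (toℕ l))) (u^t≡1 _ (i+l<h i l))))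
    where
    P : Fin n → Poly
    P i = iterate f (toℕ i)
    i+l<h : ∀ (i : Fin n) (l : Fin (suc M)) → toℕ i ℕ.+ toℕ l < h
    i+l<h i l = ℕ.<-≤-trans (ℕ.+-mono-< (Fin.toℕ<n i) (Fin.toℕ<n l)) M≤h
    l<h : ∀ (l : Fin (suc M)) → toℕ l < h
    l<h l = ℕ.<-≤-trans (Fin.toℕ<n l) (ℕ.≤-trans (ℕ.m≤n+m (suc M) n) M≤h)
    deg-P : ∀ i → Deg≤ (d ℕ.^ n) (P i)
    deg-P i = deg-mono (ℕ.^-monoʳ-≤ d {{ℕ.>-nonZero 0<d}} (ℕ.<⇒≤ (Fin.toℕ<n i))) (deg-iterate f (toℕ i) deg-f)
    -- At the first two points `P i` takes the values of indices i and i + 1, which are distinct; so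
    -- it is not constant, whatever the degree of `f`.
    P-nonconstant : ∀ i → ∃[ r ] (0 < r × IsDeg r (P i))
    P-nonconstant i = nonconstant⇒isDeg (P i) {orbit f u 0} {orbit f u 1} λ p → ℕ.0≢1+n
        (ℕ.+-cancelˡ-≡ (toℕ i) 0 1 (inj i+0<h i+1<h
      (trans (sym (eval-iterate f u (toℕ i) 0)) (trans p (eval-iterate f u (toℕ i) 1)))))
      where
      i+1<h : toℕ i ℕ.+ 1 < h
      i+1<h = ℕ.<-≤-trans (subst (_< n ℕ.+ suc M) (ℕ.+-comm 1 (toℕ i))
          (ℕ.≤-<-trans (Fin.toℕ<n i) (ℕ.m<m+n n z<s))) M≤h
      i+0<h : toℕ i ℕ.+ 0 < h
      i+0<h = ℕ.<-trans (ℕ.+-monoʳ-< (toℕ i) z<s) i+1<h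
    coprime : ∀ {i j} → i ≢ j → Coprime (P i) (P j)
    coprime {i} {j} i≢j with ℕ.<-cmp (toℕ i) (toℕ j)
    ... | tri< lt _ _ = coprime-iterates f aperiodic lt (Fin.toℕ<n j)
    ... | tri≈ _ q _  = contradiction (Fin.toℕ-injective q) i≢j
    ... | tri> _ _ gt = coprime-sym (coprime-iterates f aperiodic gt (Fin.toℕ<n i))
    eval-^-X : ∀ f x k → eval (f ^ k) x ≡ eval (X ^ k) (eval f x)
    eval-^-X f x zero    = trans (eval-C 1# x) (sym (eval-C 1# (eval f x)))
    eval-^-X f x (suc k) = trans (eval-* f _ x)
        (trans (cong₂ _*_ (sym (eval-X (eval f x))) (eval-^-X f x k)) (sym (eval-* X (X ^ k) (eval f x))))

-- Residues modulo a prime as a prime field.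

module PrimeModulus (p′ : ℕ) (p-prime : Prime (suc p′)) where

  private
    p = suc p′
    F = Fin p
    infixl 6 _+_
    infixl 7 _*_
    _+_ _*_ : F → F → F
    _+_ = Defs._+_
    _*_ = Defs._*_

  [_] : ℕ → F
  [ n ] = n mod p

  toℕ-[] : ∀ n → toℕ [ n ] ≡ n % p
  toℕ-[] n = Fin.toℕ-fromℕ< (m%n<n n p)

  []-cong : ∀ m n → m % p ≡ n % p → [ m ] ≡ [ n ]
  []-cong m n q = Fin.toℕ-injective (trans (toℕ-[] m) (trans q (sym (toℕ-[] n))))

  [toℕ] : ∀ a → [ toℕ a ] ≡ a
  [toℕ] a = Fin.toℕ-injective (trans (toℕ-[] (toℕ a)) (m<n⇒m%n≡m (Fin.toℕ<n a)))

  []-+ : ∀ m n → [ m ] + [ n ] ≡ [ m ℕ.+ n ]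
  []-+ m n = []-cong (toℕ [ m ] ℕ.+ toℕ [ n ]) (m ℕ.+ n)
      (trans (cong₂ (λ a b → (a ℕ.+ b) % p) (toℕ-[] m) (toℕ-[] n)) (sym (%-distribˡ-+ m n p)))

  []-* : ∀ m n → [ m ] * [ n ] ≡ [ m ℕ.* n ]
  []-* m n = []-cong (toℕ [ m ] ℕ.* toℕ [ n ]) (m ℕ.* n)
      (trans (cong₂ (λ a b → (a ℕ.* b) % p) (toℕ-[] m) (toℕ-[] n)) (sym (%-distribˡ-* m n p)))

  [p*]≡0 : ∀ n → [ n ℕ.* p ] ≡ [ 0 ]
  [p*]≡0 n = []-cong (n ℕ.* p) 0 (m*n%n≡0 n p)

  -- The class of -1 is p - 1, that is `p′`.
  neg : F → F
  neg a = [ p′ ℕ.* toℕ a ]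

  -- An identity of residue classes is reduced to one of natural numbers by writing
  -- every element in the form [ n ].
  via₁ : {P : F → Set} → (∀ n → P [ n ]) → ∀ a → P a
  via₁ {P} q a = subst P ([toℕ] a) (q (toℕ a))

  neg-inverseʳ : ∀ a → a + neg a ≡ [ 0 ]
  neg-inverseʳ a = trans (cong (_+ neg a) (sym ([toℕ] a))) (trans ([]-+ (toℕ a) (p′ ℕ.* toℕ a))
    (trans (cong [_] (ℕ.*-comm p (toℕ a))) ([p*]≡0 (toℕ a))))

  +-comm : ∀ a b → a + b ≡ b + a
  +-comm a b = cong [_] (ℕ.+-comm (toℕ a) (toℕ b))

  *-comm : ∀ a b → a * b ≡ b * a
  *-comm a b = cong [_] (ℕ.*-comm (toℕ a) (toℕ b))

  +-assoc : ∀ a b c → (a + b) + c ≡ a + (b + c)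
  +-assoc = via₁ λ a → via₁ λ b → via₁ λ c → begin
    [ a ] + [ b ] + [ c ]     ≡⟨ trans (cong (_+ [ c ]) ([]-+ a b)) ([]-+ (a ℕ.+ b) c) ⟩
    [ a ℕ.+ b ℕ.+ c ]         ≡⟨ cong [_] (ℕ.+-assoc a b c) ⟩
    [ a ℕ.+ (b ℕ.+ c) ]       ≡⟨ trans (cong ([ a ] +_) ([]-+ b c)) ([]-+ a (b ℕ.+ c)) ⟨
    [ a ] + ([ b ] + [ c ]) ∎
    where open ≡-Reasoning

  *-assoc : ∀ a b c → (a * b) * c ≡ a * (b * c)
  *-assoc = via₁ λ a → via₁ λ b → via₁ λ c → begin
    [ a ] * [ b ] * [ c ]     ≡⟨ trans (cong (_* [ c ]) ([]-* a b)) ([]-* (a ℕ.* b) c) ⟩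
    [ a ℕ.* b ℕ.* c ]         ≡⟨ cong [_] (ℕ.*-assoc a b c) ⟩
    [ a ℕ.* (b ℕ.* c) ]       ≡⟨ trans (cong ([ a ] *_) ([]-* b c)) ([]-* a (b ℕ.* c)) ⟨
    [ a ] * ([ b ] * [ c ]) ∎
    where open ≡-Reasoning

  *-distribʳ-+ : ∀ c a b → (a + b) * c ≡ a * c + b * c
  *-distribʳ-+ = via₁ λ c → via₁ λ a → via₁ λ b → begin
    ([ a ] + [ b ]) * [ c ]         ≡⟨ trans (cong (_* [ c ]) ([]-+ a b)) ([]-* (a ℕ.+ b) c) ⟩
    [ (a ℕ.+ b) ℕ.* c ]             ≡⟨ cong [_] (ℕ.*-distribʳ-+ c a b) ⟩
    [ a ℕ.* c ℕ.+ b ℕ.* c ]         ≡⟨ trans (cong₂ _+_ ([]-* a c) ([]-* b c)) ([]-+ (a ℕ.* c) (b ℕ.* c)) ⟨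
    [ a ] * [ c ] + [ b ] * [ c ] ∎
    where open ≡-Reasoning

  +-identityˡ : ∀ a → [ 0 ] + a ≡ a
  +-identityˡ = via₁ λ a → []-+ 0 a

  *-identityˡ : ∀ a → [ 1 ] * a ≡ a
  *-identityˡ = via₁ λ a → trans ([]-* 1 a) (cong [_] (ℕ.*-identityˡ a))

  propositionalRing : PropositionalRing F
  propositionalRing = record
    { _+_ = _+_ ; _*_ = _*_ ; -_ = neg ; 0# = Defs.0# ; 1# = Defs.1#
    ; isCommutativeRing = record
      { isRing = record
        { +-isAbelianGroup = record
          { isGroup = record
            { isMonoid = record
              { isSemigroup = record
                { isMagma = record { isEquivalence = isEquivalence ; ∙-cong = cong₂ _+_ }
                ; assoc = +-assoc }
              ; identity = +-identityˡ , λ a → trans (+-comm a _) (+-identityˡ a) }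
            ; inverse = (λ a → trans (+-comm (neg a) a) (neg-inverseʳ a)) , neg-inverseʳ
            ; ⁻¹-cong = cong neg }
          ; comm = +-comm }
        ; *-cong = cong₂ _*_
        ; *-assoc = *-assoc
        ; *-identity = *-identityˡ , λ a → trans (*-comm a _) (*-identityˡ a)
        ; distrib = (λ c a b → trans (*-comm c _)
            (trans (*-distribʳ-+ c a b) (cong₂ _+_ (*-comm a c) (*-comm b c)))) , *-distribʳ-+ }
      ; *-comm = *-comm } }

  1<p : 1 < p
  1<p = ℕ.nonTrivial⇒n>1 p {{prime⇒nonTrivial p-prime}}

  toℕ-0 : toℕ [ 0 ] ≡ 0
  toℕ-0 = toℕ-[] 0

  inverse : ∀ a → a ≢ [ 0 ] → ∃[ b ] a * b ≡ [ 1 ]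
  inverse a a≢0 with coprime-Bézout (prime⇒coprime p-prime
      {{ℕ.≢-nonZero (λ q → a≢0 (Fin.toℕ-injective (trans q (sym toℕ-0))))}} (Fin.toℕ<n a))
  ... | Bézout.-+ x y eq = [ y ] , (begin
    a * [ y ]                 ≡⟨ trans (cong (_* [ y ]) (sym ([toℕ] a))) ([]-* (toℕ a) y) ⟩
    [ toℕ a ℕ.* y ]           ≡⟨ cong [_] (trans (ℕ.*-comm (toℕ a) y) (sym eq)) ⟩
    [ 1 ℕ.+ x ℕ.* p ]         ≡⟨ []-+ 1 (x ℕ.* p) ⟨
    [ 1 ] + [ x ℕ.* p ]       ≡⟨ cong ([ 1 ] +_) ([p*]≡0 x) ⟩
    [ 1 ] + [ 0 ]             ≡⟨ []-+ 1 0 ⟩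
    [ 1 ] ∎)
    where open ≡-Reasoning
  -- In this case y * a ≡ -1, and the factor `p′` corrects the sign.
  ... | Bézout.+- x y eq = [ p′ ℕ.* y ] , (begin
    a * [ p′ ℕ.* y ]                          ≡⟨ trans (cong (_* [ p′ ℕ.* y ]) (sym ([toℕ] a)))
        ([]-* (toℕ a) (p′ ℕ.* y)) ⟩
    [ toℕ a ℕ.* (p′ ℕ.* y) ]                  ≡⟨ +-identityˡ [ toℕ a ℕ.* (p′ ℕ.* y) ] ⟨
    [ 0 ] + [ toℕ a ℕ.* (p′ ℕ.* y) ]          ≡⟨ cong (_+ [ toℕ a ℕ.* (p′ ℕ.* y) ]) ([p*]≡0 1) ⟨
    [ 1 ℕ.* p ] + [ toℕ a ℕ.* (p′ ℕ.* y) ]    ≡⟨ []-+ (1 ℕ.* p) (toℕ a ℕ.* (p′ ℕ.* y)) ⟩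
    [ 1 ℕ.* p ℕ.+ toℕ a ℕ.* (p′ ℕ.* y) ]      ≡⟨ cong [_] lem ⟩
    [ 1 ℕ.+ (p′ ℕ.* x) ℕ.* p ]                ≡⟨ []-+ 1 (p′ ℕ.* x ℕ.* p) ⟨
    [ 1 ] + [ (p′ ℕ.* x) ℕ.* p ]              ≡⟨ cong ([ 1 ] +_) ([p*]≡0 (p′ ℕ.* x)) ⟩
    [ 1 ] + [ 0 ]                             ≡⟨ []-+ 1 0 ⟩
    [ 1 ] ∎)
    where
    open ≡-Reasoning
    lem : 1 ℕ.* p ℕ.+ toℕ a ℕ.* (p′ ℕ.* y) ≡ 1 ℕ.+ (p′ ℕ.* x) ℕ.* p
    lem = trans (expand p′ (toℕ a) y) (cong suc (trans (cong (p′ ℕ.*_) eq) (sym (ℕ.*-assoc p′ x p))))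
      where
      expand : ∀ q a y → 1 ℕ.* suc q ℕ.+ a ℕ.* (q ℕ.* y) ≡ 1 ℕ.+ q ℕ.* (1 ℕ.+ y ℕ.* a)
      expand = solve-∀

  discreteField : DiscreteField F
  discreteField = record
    { propositionalRing = propositionalRing
    ; _≟_ = Fin._≟_
    ; 1≢0 = λ q → ℕ.1+n≢0 (trans (sym (trans (toℕ-[] 1) (m<n⇒m%n≡m 1<p))) (trans (cong toℕ q) toℕ-0))
    ; inverse = inverse }

  open DiscreteField discreteField using (ι; x*y≢0)

  ι≡[] : ∀ n → ι n ≡ [ n ]
  ι≡[] zero    = refl
  ι≡[] (suc n) = trans (cong ([ 1 ] +_) (ι≡[] n)) ([]-+ 1 n)

  𝔽ₚ : PrimeField p′
  𝔽ₚ = record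
    { discreteField = discreteField
    ; ι≡0⇒∣ = λ n q → m%n≡0⇒n∣m n p (trans (sym (toℕ-[] n)) (trans (cong toℕ (trans (sym (ι≡[] n)) q)) toℕ-0))
    ; ι-p≡0 = trans (ι≡[] p) ([]-cong p 0 (n%n≡0 p)) }

-- Cardinality and order of a multiplicative subgroup.

injective⇒≤∣∣ : ∀ {n M} (S : Subset n) (x : Fin M → Fin n) → (∀ {i j} → x i ≡ x j → i ≡ j) → (∀ i → x i ∈ S)
    → M ≤ ∣ S ∣
injective⇒≤∣∣ {M = zero}  S x inj x∈S = z≤n
injective⇒≤∣∣ {M = suc M} S x inj x∈S = ℕ.≤-<-trans
  (injective⇒≤∣∣ (S ⊝ x zero) (x ∘ suc) (Fin.suc-injective ∘ inj)
    (λ i → x∈p∧x≢y⇒x∈p-y (x∈S (suc i)) (λ q → Fin.0≢1+n (sym (inj q)))))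
  (x∈p⇒∣p-x∣<∣p∣ (x∈S zero))

module SubgroupOrder {n : ℕ} (𝔽 : DiscreteField (Fin n)) where

  open DiscreteField 𝔽
  open Degrees 𝔽 using (eval; X; eval-*; eval-X; eval-C) renaming (_^_ to _^ᴾ_)
  open CommutativeRing commutativeRing using (semiring; *-commutativeMonoid)
  open import Algebra.Properties.Semiring.Exp semiring using (_^_)
  open import Algebra.Properties.CommutativeMonoid.Sum *-commutativeMonoid using ()
    renaming (sum to ∏; sum-permute to ∏-permute; ∑-distrib-+ to ∏-distrib-*; sum-cong-≗ to ∏-cong)

  eval-X^ : ∀ t x → eval (X ^ᴾ t) x ≡ x ^ t
  eval-X^ zero    x = eval-C 1# x
  eval-X^ (suc t) x = trans (eval-* X (X ^ᴾ t) x) (cong₂ _*_ (eval-X x) (eval-X^ t x))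

  -- Products over `S` run over the whole index type with factors 1 outside `S`, so that
  -- multiplication by an element becomes a permutation of the indices.
  ∏-indicator : ∀ {k} (S : Subset k) x → ∏ (λ i → if lookup S i then x else 1#) ≡ x ^ ∣ S ∣
  ∏-indicator []            x = refl
  ∏-indicator (true ∷ S)    x = cong (x *_) (∏-indicator S x)
  ∏-indicator (false ∷ S)   x = trans (*-identityˡ _) (∏-indicator S x)

  -- Multiplication by x permutes S, so it leaves the product of the elements of S unchanged.
  subgroup-order : ∀ {S : Subset n} → 0# ∉ S → (∀ {x y} → x ∈ S → y ∈ S → x * y ∈ S) →
                   (∀ {x} → x ∈ S → ∃[ y ] (y ∈ S × x * y ≡ 1#)) → ∀ {x} → x ∈ S → x ^ ∣ S ∣ ≡ 1#
  subgroup-order {S} 0∉S *-closed ⁻¹-closed {x} x∈S with ⁻¹-closed x∈S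
  ... | x⁻¹ , x⁻¹∈S , x*x⁻¹≡1 = cancel (begin
    x ^ ∣ S ∣ * ∏ φ                                              ≡⟨ cong (_* ∏ φ) (∏-indicator S x) ⟨
    ∏ (λ y → if lookup S y then x else 1#) * ∏ φ              ≡⟨ ∏-distrib-*
        (λ y → if lookup S y then x else 1#) φ ⟨
    ∏ (λ y → (if lookup S y then x else 1#) * φ y)            ≡⟨ ∏-cong φ-* ⟨
    ∏ (λ y → φ (x * y))                                          ≡⟨ ∏-permute φ π ⟨
    ∏ φ ∎)
    where
    open ≡-Reasoning
    φ : Fin n → Fin n
    φ y = if lookup S y then y else 1#
    x*[x⁻¹*y] : ∀ y → x * (x⁻¹ * y) ≡ y
    x*[x⁻¹*y] y = trans (sym (*-assoc x x⁻¹ y)) (trans (cong (_* y) x*x⁻¹≡1) (*-identityˡ y))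
    x⁻¹*[x*y] : ∀ y → x⁻¹ * (x * y) ≡ y
    x⁻¹*[x*y] y = trans (sym (*-assoc x⁻¹ x y))
        (trans (cong (_* y) (trans (*-comm x⁻¹ x) x*x⁻¹≡1)) (*-identityˡ y))
    π : Permutation n n
    π = permutation (x *_) (x⁻¹ *_) x*[x⁻¹*y] x⁻¹*[x*y]
    φ-* : ∀ y → φ (x * y) ≡ (if lookup S y then x else 1#) * φ y
    φ-* y with lookup S y in y∈S? | lookup S (x * y) in xy∈S?
    ... | true  | true  = refl
    ... | false | false = sym (*-identityˡ 1#)
    ... | true  | false = contradiction (trans (sym xy∈S?) ([]=⇒lookup (*-closed x∈S (lookup⇒[]= y S y∈S?))))
        λ ()
    ... | false | true  = contradiction (trans (sym y∈S?) ([]=⇒lookup (subst (_∈ S) (x⁻¹*[x*y] y)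
                            (*-closed x⁻¹∈S (lookup⇒[]= (x * y) S xy∈S?))))) λ ()
    φ≢0 : ∀ y → φ y ≢ 0#
    φ≢0 y q with lookup S y in y∈S?
    ... | true  = 0∉S (subst (_∈ S) q (lookup⇒[]= y S y∈S?))
    ... | false = 1≢0 q
    ∏≢0 : ∀ {k} (f : Fin k → Fin n) → (∀ i → f i ≢ 0#) → ∏ f ≢ 0#
    ∏≢0 {zero}  f p = 1≢0
    ∏≢0 {suc k} f p = x*y≢0 (p zero) (∏≢0 (f ∘ suc) (p ∘ suc))
    cancel : ∀ {a} → a * ∏ φ ≡ ∏ φ → a ≡ 1#
    cancel {a} q with inverse (∏ φ) (∏≢0 φ φ≢0)
    ... | b , r = begin
      a               ≡⟨ trans (*-comm a 1#) (*-identityˡ a) ⟨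
      a * 1#       ≡⟨ cong (a *_) r ⟨
      a * (∏ φ * b)   ≡⟨ *-assoc a (∏ φ) b ⟨
      a * ∏ φ * b     ≡⟨ cong (_* b) q ⟩
      ∏ φ * b         ≡⟨ r ⟩
      1# ∎

-- Choice of the parameters and numerical estimates.

module NaturalNumberBounds where

  open import Data.Nat using (ℕ; zero; suc; z≤n; s≤s; z<s; s<s; _≤_; _<_; _+_; _*_; _^_; _≤?_; >-nonZero)
  open import Data.Nat.Properties
  open import Data.Nat.Tactic.RingSolver using (solve-∀)

  module Parameters {n₁ dd B t p′ : ℕ} (0<dd : 0 < dd) (2≤B : 2 ≤ B) where

    private
      n Dg L m K A : ℕ
      n = suc n₁
      Dg = n * dd
      L = B ^ n
      m = B ^ n₁
      K = 2 * Dg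
      A = Dg * L

      0<Dg : 0 < Dg
      0<Dg = *-mono-< {0} {n} {0} {dd} z<s 0<dd

      0<m : 0 < m
      0<m = m^n>0 B {{>-nonZero (<-trans z<s 2≤B)}} n₁

      m≤L : m ≤ L
      m≤L = m≤n*m m B {{>-nonZero (<-trans z<s 2≤B)}}

      0<K : 0 < K
      0<K = *-mono-< {0} {2} {0} {Dg} z<s 0<Dg

    module _ (L²<t : K * (L * L) < t) where

      -- For A = Dg * L the degree allowed in the separation of the products is exactly K * L ^ 2.
      coefficient-bound : L * (A + L * Dg) < t
      coefficient-bound = subst (_< t) (identity Dg L) L²<t
        where
        identity : ∀ D L → 2 * D * (L * L) ≡ L * (D * L + L * D)
        identity = solve-∀

      private
        L≤t : L ≤ t
        L≤t = ≤-trans (≤-trans (m≤m*n L L {{>-nonZero (<-≤-trans 0<m m≤L)}})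
            (m≤n*m (L * L) K {{>-nonZero 0<K}})) (<⇒≤ L²<t)
        L≤tB : L ≤ t * B
        L≤tB = ≤-trans L≤t (m≤m*n t B {{>-nonZero (<-trans z<s 2≤B)}})

      degree-bound : n * (t * B * dd) + A ≤ K * t * B
      degree-bound = begin
        n * (t * B * dd) + Dg * L       ≤⟨ +-monoʳ-≤ (n * (t * B * dd)) (*-monoʳ-≤ Dg L≤tB) ⟩
        n * (t * B * dd) + n * dd * (t * B) ≡⟨ identity n t B dd ⟩
        2 * (n * dd) * t * B            ∎
        where
        open ≤-Reasoning
        identity : ∀ n t B d → n * (t * B * d) + n * d * (t * B) ≡ 2 * (n * d) * t * B
        identity = solve-∀

      module _ (KtB<p : K * t * B < suc p′) where

        degree<p : n * (t * B * dd) + A ≤ p′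
        degree<p = ≤-trans degree-bound (≤-pred KtB<p)

        multiplicity≤p : m ≤ suc p′
        multiplicity≤p = begin
          m         ≤⟨ m≤L ⟩
          L         ≤⟨ L≤tB ⟩
          t * B     ≤⟨ m≤n*m (t * B) K {{>-nonZero 0<K}} ⟩
          K * (t * B) ≡⟨ *-assoc K t B ⟨
          K * t * B ≤⟨ <⇒≤ KtB<p ⟩
          suc p′    ∎
          where open ≤-Reasoning

    -- As m ≤ L, the derivatives at most double the degree `A`; the factor B ≥ 2 between `m` and `L`
    -- pays for this doubling.
    equations<unknowns : m * suc (A + m * Dg) < L * suc A
    equations<unknowns = begin-strict
      m * suc (A + m * Dg)   <⟨ *-monoʳ-< m {{>-nonZero 0<m}} (begin-strict
        suc (A + m * Dg)        ≤⟨ s≤s (+-monoʳ-≤ A (≤-trans (*-monoˡ-≤ Dg m≤L) (≤-reflexive (*-comm L Dg)))) ⟩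
        suc (A + A)             <⟨ n<1+n _ ⟩
        suc (suc (A + A))       ≡⟨ identity A ⟩
        2 * suc A               ≤⟨ *-monoˡ-≤ (suc A) 2≤B ⟩
        B * suc A ∎) ⟩
      m * (B * suc A)        ≡⟨ trans (sym (*-assoc m B (suc A))) (cong (_* suc A) (*-comm m B)) ⟩
      B * m * suc A ∎
      where
      open ≤-Reasoning
      identity : ∀ a → suc (suc (a + a)) ≡ 2 * suc a
      identity = solve-∀

  ^-distribʳ-* : ∀ k m n → (m * n) ^ k ≡ m ^ k * n ^ k
  ^-distribʳ-* zero    m n = refl
  ^-distribʳ-* (suc k) m n = trans (cong (m * n *_) (^-distribʳ-* k m n)) (identity m n (m ^ k) (n ^ k))
    where
    identity : ∀ a b c d → a * b * (c * d) ≡ a * c * (b * d)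
    identity = solve-∀

  private
    x≤x^suc : ∀ x k → x ≤ x ^ suc k
    x≤x^suc zero    k = z≤n
    x≤x^suc (suc x) k = m≤m*n (suc x) (suc x ^ k) {{>-nonZero (m^n>0 (suc x) k)}}

  -- The number of polynomials is n = 4k + 2, and the exponents below B are chosen
  -- with B ^ (2n) of the order of t.
  module Exponents (k D₀ : ℕ) (0<D₀ : 0 < D₀) where

    -- For t > T₀ the value B = 2 is admissible. In `c₁` the factor 3 passes from `N` to `h` and n +
    -- 1 from `h` to the number of points. The constant `c₂` absorbs (B + 1) ^ 2n ≤ 4 ^ n * B ^ 2n.
    -- The summands of `C` serve, in order, the case of large p, the generic case, few points, and
    -- small t.
    n₁ n K T₀ c₁ c₂ C : ℕ
    n₁ = suc (4 * k)
    n = suc n₁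
    K = 2 * D₀
    T₀ = K * (2 ^ n * 2 ^ n)
    c₁ = 3 * suc n * K
    c₂ = K * (2 ^ n * 2 ^ n)
    C = K + c₂ * (c₁ * c₁) + suc (n + n) * suc (n + n) + suc (T₀ + T₀) * suc (T₀ + T₀)

    0<K : 0 < K
    0<K = *-mono-< {0} {2} {0} {D₀} z<s 0<D₀

    0<2^n : 0 < 2 ^ n
    0<2^n = m^n>0 2 n

    0<c₂ : 0 < c₂
    0<c₂ = *-mono-< {0} {K} 0<K (*-mono-< 0<2^n 0<2^n)

    0<c₁ : 0 < c₁
    0<c₁ = *-mono-< {0} {3 * suc n} {0} {K} z<s 0<K

    K≤C : K ≤ C
    K≤C = ≤-trans (m≤m+n K _) (≤-trans (m≤m+n _ _) (m≤m+n _ _))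

    c₂c₁²≤C : c₂ * (c₁ * c₁) ≤ C
    c₂c₁²≤C = ≤-trans (m≤n+m _ K) (≤-trans (m≤m+n _ _) (m≤m+n _ _))

    n-part≤C : suc (n + n) * suc (n + n) ≤ C
    n-part≤C = ≤-trans (m≤n+m (suc (n + n) * suc (n + n)) (K + c₂ * (c₁ * c₁))) (m≤m+n _ _)

    T-part≤C : suc (T₀ + T₀) * suc (T₀ + T₀) ≤ C
    T-part≤C = m≤n+m _ _

    0<C : 0 < C
    0<C = ≤-trans 0<K K≤C

    -- For `N` below a constant: raising the exponent to 2k + 2 makes the square of the constant
    -- appear, which `C` dominates.
    bounded-N : ∀ c {t N} → 0 < t → suc c * suc c ≤ C → N ≤ suc c → N ^ suc (k + k) ≤ (C * t) ^ suc k
    bounded-N c {t} {N} 0<t c²≤C N≤c = begin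
      N ^ suc (k + k)                ≤⟨ ^-monoˡ-≤ (suc (k + k)) N≤c ⟩
      suc c ^ suc (k + k)            ≤⟨ ^-monoʳ-≤ (suc c) (s≤s (+-monoʳ-≤ k (n≤1+n k))) ⟩
      suc c ^ (suc k + suc k)        ≡⟨ ^-distribˡ-+-* (suc c) (suc k) (suc k) ⟩
      suc c ^ suc k * suc c ^ suc k  ≡⟨ ^-distribʳ-* (suc k) (suc c) (suc c) ⟨
      (suc c * suc c) ^ suc k        ≤⟨ ^-monoˡ-≤ (suc k) (≤-trans c²≤C (m≤m*n C t {{>-nonZero 0<t}})) ⟩
      (C * t) ^ suc k ∎
      where open ≤-Reasoning

    -- A descent from 2 + t, which is certainly too large, to the first admissible value. It cannot
    -- pass below 2 because t > T₀.
    choose-B : ∀ {t} → T₀ < t → ∃[ B ] (2 ≤ B × K * (B ^ n * B ^ n) < t × t ≤ K * (suc B ^ n * suc B ^ n))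
    choose-B {t} T₀<t = search t (begin
      t                                  ≤⟨ m≤n+m t 2 ⟩
      2 + t                              ≤⟨ x≤x^suc (2 + t) n₁ ⟩
      (2 + t) ^ n                        ≤⟨ m≤m*n ((2 + t) ^ n) ((2 + t) ^ n) {{>-nonZero (m^n>0 (2 + t) n)}} ⟩
      (2 + t) ^ n * (2 + t) ^ n          ≤⟨ m≤n*m _ K {{>-nonZero 0<K}} ⟩
      K * ((2 + t) ^ n * (2 + t) ^ n) ∎)
      where
      open ≤-Reasoning
      search : ∀ j → t ≤ K * ((2 + j) ^ n * (2 + j) ^ n) → ∃[ B ]
          (2 ≤ B × K * (B ^ n * B ^ n) < t × t ≤ K * (suc B ^ n * suc B ^ n))
      search zero    t≤ = contradiction T₀<t (≤⇒≯ t≤)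
      search (suc j) t≤ with t ≤? K * ((2 + j) ^ n * (2 + j) ^ n)
      ... | yes t≤′ = search j t≤′
      ... | no t≰   = 2 + j , s≤s (s≤s z≤n) , ≰⇒> t≰ , t≤

    -- With x = K t one has p ≤ x B and B ^ 2n ≤ x, hence p ^ 2n ≤ x ^ (2n + 1). Eighth powers
    -- reduce the claim to this, since 8k ≤ 2n and 2n + 1 ≤ 8(k + 1).
    large-p : ∀ {t p B} → 0 < t → 0 < p → K * (B ^ n * B ^ n) < t → p ≤ K * t * B → p ^ k ≤ (C * t) ^ suc k
    large-p {t} {p} {B} 0<t 0<p B<t p≤ = ≤-trans (≮⇒≥ absurd) (^-monoˡ-≤ (suc k) (*-monoˡ-≤ t K≤C))
      where
      open ≤-Reasoning
      x = K * t
      0<x : 0 < x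
      0<x = *-mono-< {0} {K} 0<K 0<t
      B^2n≤x : B ^ n * B ^ n ≤ x
      B^2n≤x = ≤-trans (m≤n*m _ K {{>-nonZero 0<K}}) (≤-trans (<⇒≤ B<t) (m≤n*m t K {{>-nonZero 0<K}}))
      exponents : suc (n + n) + 3 ≡ suc k * 8
      exponents = identity k
        where
        identity : ∀ k → suc (suc (suc (4 * k)) + suc (suc (4 * k))) + 3 ≡ suc k * 8
        identity = solve-∀
      k8≤n+n : k * 8 ≤ n + n
      k8≤n+n = subst (_≤ n + n) (identity k) (+-mono-≤ (≤-trans (n≤1+n _) (n≤1+n _))
          (≤-trans (n≤1+n _) (n≤1+n _)))
        where
        identity : ∀ k → 4 * k + 4 * k ≡ k * 8
        identity = solve-∀
      absurd : ¬ x ^ suc k < p ^ k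
      absurd lt = <-irrefl refl (begin-strict
        (x ^ suc k) ^ 8           <⟨ ^-monoˡ-< 8 lt ⟩
        (p ^ k) ^ 8               ≡⟨ ^-*-assoc p k 8 ⟩
        p ^ (k * 8)               ≤⟨ ^-monoʳ-≤ p {{>-nonZero 0<p}} k8≤n+n ⟩
        p ^ (n + n)               ≤⟨ ^-monoˡ-≤ (n + n) p≤ ⟩
        (x * B) ^ (n + n)         ≡⟨ ^-distribʳ-* (n + n) x B ⟩
        x ^ (n + n) * B ^ (n + n) ≡⟨ cong (x ^ (n + n) *_) (^-distribˡ-+-* B n n) ⟩
        x ^ (n + n) * (B ^ n * B ^ n) ≤⟨ *-monoʳ-≤ (x ^ (n + n)) B^2n≤x ⟩
        x ^ (n + n) * x           ≡⟨ *-comm _ x ⟩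
        x ^ suc (n + n)           ≤⟨ ^-monoʳ-≤ x {{>-nonZero 0<x}} (m≤m+n (suc (n + n)) 3) ⟩
        x ^ (suc (n + n) + 3)     ≡⟨ cong (x ^_) exponents ⟩
        x ^ (suc k * 8)           ≡⟨ ^-*-assoc x (suc k) 8 ⟨
        (x ^ suc k) ^ 8 ∎)

    -- Up to constants t ≤ B ^ 2n, and by 2nk = 4k(2k + 1) this bounds t ^ k by the (2k + 1)-th
    -- power of B ^ 4k. Multiplied by N ^ (2k + 1) and combined with the bound for N * B ^ 4k, it
    -- leaves a common factor t ^ k to cancel.
    large-N : ∀ {t B N} → 2 ≤ B → 0 < t → t ≤ K * (suc B ^ n * suc B ^ n) → N * B ^ (4 * k) ≤ c₁ * t →
              N ^ suc (k + k) ≤ (C * t) ^ suc k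
    large-N {t} {B} {N} 2≤B 0<t t≤ N≤ = *-cancelʳ-≤ _ _ (t ^ k) {{>-nonZero (m^n>0 t {{>-nonZero 0<t}} k)}}
        (begin
      N ^ e * t ^ k                              ≤⟨ *-monoʳ-≤ (N ^ e) t^k≤ ⟩
      N ^ e * (c₂ ^ k * (B ^ (4 * k)) ^ e)       ≡⟨ regroup₁ (N ^ e) (c₂ ^ k) ((B ^ (4 * k)) ^ e) ⟩
      c₂ ^ k * (N ^ e * (B ^ (4 * k)) ^ e)       ≡⟨ cong (c₂ ^ k *_) (^-distribʳ-* e N (B ^ (4 * k))) ⟨
      c₂ ^ k * (N * B ^ (4 * k)) ^ e             ≤⟨ *-monoʳ-≤ (c₂ ^ k) (^-monoˡ-≤ e N≤) ⟩
      c₂ ^ k * (c₁ * t) ^ e                      ≡⟨ cong (c₂ ^ k *_) (^-distribʳ-* e c₁ t) ⟩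
      c₂ ^ k * (c₁ ^ e * t ^ e)                  ≤⟨ *-mono-≤ (^-monoʳ-≤ c₂ {{>-nonZero 0<c₂}} (n≤1+n k))
          (*-monoˡ-≤ (t ^ e) c₁^e≤) ⟩
      c₂ ^ suc k * ((c₁ * c₁) ^ suc k * t ^ e)   ≡⟨ cong (λ a → c₂ ^ suc k * ((c₁ * c₁) ^ suc k * a))
          (^-distribˡ-+-* t (suc k) k) ⟩
      c₂ ^ suc k * ((c₁ * c₁) ^ suc k * (t ^ suc k * t ^ k)) ≡⟨ regroup₂ (c₂ ^ suc k) ((c₁ * c₁) ^ suc k)
          (t ^ suc k) (t ^ k) ⟩
      c₂ ^ suc k * (c₁ * c₁) ^ suc k * t ^ suc k * t ^ k
        ≡⟨ cong (_* t ^ k) (trans (cong (_* t ^ suc k) (sym (^-distribʳ-* (suc k) c₂ (c₁ * c₁))))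
            (sym (^-distribʳ-* (suc k) (c₂ * (c₁ * c₁)) t))) ⟩
      (c₂ * (c₁ * c₁) * t) ^ suc k * t ^ k       ≤⟨ *-monoˡ-≤ (t ^ k)
          (^-monoˡ-≤ (suc k) (*-monoˡ-≤ t c₂c₁²≤C)) ⟩
      (C * t) ^ suc k * t ^ k ∎)
      where
      open ≤-Reasoning
      e = suc (k + k)
      regroup₁ : ∀ a b c → a * (b * c) ≡ b * (a * c)
      regroup₁ = solve-∀
      regroup₂ : ∀ a b c d → a * (b * (c * d)) ≡ a * b * c * d
      regroup₂ = solve-∀
      c₁^e≤ : c₁ ^ e ≤ (c₁ * c₁) ^ suc k
      c₁^e≤ = begin
        c₁ ^ suc (k + k)          ≤⟨ ^-monoʳ-≤ c₁ {{>-nonZero 0<c₁}} (s≤s (+-monoʳ-≤ k (n≤1+n k))) ⟩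
        c₁ ^ (suc k + suc k)      ≡⟨ ^-distribˡ-+-* c₁ (suc k) (suc k) ⟩
        c₁ ^ suc k * c₁ ^ suc k   ≡⟨ ^-distribʳ-* (suc k) c₁ c₁ ⟨
        (c₁ * c₁) ^ suc k ∎
      t≤c₂B : t ≤ c₂ * B ^ (n + n)
      t≤c₂B = begin
        t                                  ≤⟨ t≤ ⟩
        K * (suc B ^ n * suc B ^ n)        ≤⟨ *-monoʳ-≤ K (*-mono-≤ 1+B≤ 1+B≤) ⟩
        K * (2 ^ n * B ^ n * (2 ^ n * B ^ n)) ≡⟨ regroup₃ K (2 ^ n) (B ^ n) ⟩
        c₂ * (B ^ n * B ^ n)               ≡⟨ cong (c₂ *_) (^-distribˡ-+-* B n n) ⟨
        c₂ * B ^ (n + n) ∎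
        where
        regroup₃ : ∀ a b c → a * (b * c * (b * c)) ≡ a * (b * b) * (c * c)
        regroup₃ = solve-∀
        1+B≤ : suc B ^ n ≤ 2 ^ n * B ^ n
        1+B≤ = ≤-trans (^-monoˡ-≤ n (≤-trans (+-monoˡ-≤ B (<⇒≤ 2≤B))
            (≤-reflexive (cong (B +_) (sym (+-identityʳ B)))))) (≤-reflexive (^-distribʳ-* n 2 B))
      t^k≤ : t ^ k ≤ c₂ ^ k * (B ^ (4 * k)) ^ e
      t^k≤ = begin
        t ^ k                          ≤⟨ ^-monoˡ-≤ k t≤c₂B ⟩
        (c₂ * B ^ (n + n)) ^ k         ≡⟨ ^-distribʳ-* k c₂ (B ^ (n + n)) ⟩
        c₂ ^ k * (B ^ (n + n)) ^ k     ≡⟨ cong (c₂ ^ k *_)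
            (trans (^-*-assoc B (n + n) k) (trans (cong (B ^_) (exponents k)) (sym (^-*-assoc B (4 * k) e)))) ⟩
        c₂ ^ k * (B ^ (4 * k)) ^ e ∎
        where
        exponents : ∀ k → (suc (suc (4 * k)) + suc (suc (4 * k))) * k ≡ 4 * k * suc (k + k)
        exponents = solve-∀

    -- Here `h` is the number of consecutive nonzero points. The cases are t too small to admit any
    -- B, K t B at least p, at most n points, and the generic one; the second alone leads to the
    -- bound for p.
    dichotomy : ∀ {t p N h} → 0 < t → 0 < p → N ≤ suc (h + h) → h ≤ t →
      (∀ {B M} → 2 ≤ B → K * (B ^ n * B ^ n) < t → K * t * B < p → n + suc M ≤ h → suc M * B ^ n₁ ≤ K * t * B) →
      N ^ suc (k + k) ≤ (C * t) ^ suc k ⊎ p ^ k ≤ (C * t) ^ suc k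
    dichotomy {t} {p} {N} {h} 0<t 0<p N≤ h≤t bound with t ≤? T₀
    ... | yes t≤T₀ = inj₁ (bounded-N (T₀ + T₀) 0<t T-part≤C
        (≤-trans N≤ (s≤s (+-mono-≤ (≤-trans h≤t t≤T₀) (≤-trans h≤t t≤T₀)))))
    ... | no t≰T₀ with choose-B (≰⇒> t≰T₀)
    ...   | B , 2≤B , B<t , t≤ with p ≤? K * t * B
    ...     | yes p≤ = inj₂ (large-p {B = B} 0<t 0<p B<t p≤)
    ...     | no p≰ with h ≤? n
    ...       | yes h≤n = inj₁ (bounded-N (n + n) 0<t n-part≤C (≤-trans N≤ (s≤s (+-mono-≤ h≤n h≤n))))
    ...       | no h≰n with m≤n⇒∃[o]m+o≡n (≰⇒> h≰n)
    ...         | M , q = inj₁ (large-N {N = N} 2≤B 0<t t≤ N-bound)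
      where
      open ≤-Reasoning
      h≡ : n + suc M ≡ h
      h≡ = trans (+-suc n M) q
      -- Since n - 1 = 4k + 1, one factor B of the multiplicity cancels the B in the degree.
      B^4k-bound : suc M * B ^ (4 * k) ≤ K * t
      B^4k-bound = *-cancelʳ-≤ _ _ B {{>-nonZero (<-trans z<s 2≤B)}} (begin
        suc M * B ^ (4 * k) * B     ≡⟨ trans (*-assoc (suc M) (B ^ (4 * k)) B)
            (cong (suc M *_) (*-comm (B ^ (4 * k)) B)) ⟩
        suc M * B ^ n₁              ≤⟨ bound 2≤B B<t (≰⇒> p≰) (≤-reflexive h≡) ⟩
        K * t * B ∎)
      h≤ : h ≤ suc n * suc M
      h≤ = begin
        h                           ≡⟨ trans (sym h≡) (+-comm n (suc M)) ⟩
        suc M + n                   ≤⟨ +-monoʳ-≤ (suc M) (m≤m*n n (suc M)) ⟩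
        suc n * suc M ∎
      1≤h : 1 ≤ h
      1≤h = ≤-trans (s≤s z≤n) (≰⇒> h≰n)
      N≤3h : N ≤ 3 * (suc n * suc M)
      N≤3h = begin
        N                           ≤⟨ N≤ ⟩
        1 + (h + h)                 ≤⟨ +-monoˡ-≤ (h + h) 1≤h ⟩
        h + (h + h)                 ≡⟨ cong (λ a → h + (h + a)) (+-identityʳ h) ⟨
        3 * h                       ≤⟨ *-monoʳ-≤ 3 h≤ ⟩
        3 * (suc n * suc M) ∎
      N-bound : N * B ^ (4 * k) ≤ c₁ * t
      N-bound = begin
        N * B ^ (4 * k)                          ≤⟨ *-monoˡ-≤ (B ^ (4 * k)) N≤3h ⟩
        3 * (suc n * suc M) * B ^ (4 * k)        ≡⟨ regroup₁ 3 (suc n) (suc M) (B ^ (4 * k)) ⟩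
        3 * suc n * (suc M * B ^ (4 * k))        ≤⟨ *-monoʳ-≤ (3 * suc n) B^4k-bound ⟩
        3 * suc n * (K * t)                      ≡⟨ *-assoc (3 * suc n) K t ⟨
        c₁ * t ∎
        where
        regroup₁ : ∀ a b c d → a * (b * c) * d ≡ a * b * (c * d)
        regroup₁ = solve-∀

open NaturalNumberBounds

-- The bound for orbits inside a subgroup modulo p.

module OrbitsModulo {p′ : ℕ} (p-prime : Prime (suc p′)) where

  open PrimeModulus p′ p-prime using (𝔽ₚ; discreteField)
  module It = Iterates 𝔽ₚ
  module Dg = Degrees discreteField

  orbit≡ : ∀ f u n → It.orbit f u n ≡ Defs.orbit f u n
  orbit≡ f u zero    = refl
  orbit≡ f u (suc n) = cong (Defs.eval f) (orbit≡ f u n)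

  coeff≡ : ∀ f i → Dg.coeff f i ≡ Defs.coeff f i
  coeff≡ []      i       = refl
  coeff≡ (a ∷ f) zero    = refl
  coeff≡ (a ∷ f) (suc i) = coeff≡ f i

  -- The order of `S` serves as t; membership in `S` makes the values nonzero and their t-th powers
  -- 1.
  subgroup-bound : ∀ {n₁ d B M h} f → Defs.DegreeAtMost d f → 0 < d →
    let n = suc n₁ ; K = 2 ℕ.* (n ℕ.* d ℕ.^ n) in
    (∀ r → 0 < r → r < n → Defs.orbit f Defs.0# r ≢ Defs.0#) →
    {S : Subset (suc p′)} → Defs.IsSubgroup S →
    2 ≤ B → K ℕ.* (B ℕ.^ n ℕ.* B ℕ.^ n) < ∣ S ∣ → K ℕ.* ∣ S ∣ ℕ.* B < suc p′ →
    ∀ u → (∀ {i j} → i < h → j < h → Defs.orbit f u i ≡ Defs.orbit f u j → i ≡ j) →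
    (∀ i → i < h → Defs.orbit f u i ∈ S) →
    n ℕ.+ suc M ≤ h → suc M ℕ.* B ℕ.^ n₁ ≤ K ℕ.* ∣ S ∣ ℕ.* B
  subgroup-bound {n₁} {d} {B} {M} {h} f deg-f 0<d aperiodic {S} S-subgroup 2≤B L²<t tB<p u inj u∈S M≤h =
      ℕ.≤-trans
    (It.orbit-bound {suc n₁} {d} {B} {∣ S ∣} {B ℕ.^ n₁} {M} {h} f
        (Dg.mkDeg≤ λ i d<i → trans (coeff≡ f i) (deg-f i d<i)) 0<d
      (λ r 0<r r<n q → aperiodic r 0<r r<n (trans (sym (orbit≡ f Defs.0# r)) q))
      (coefficient-bound L²<t) (degree<p L²<t tB<p) (multiplicity≤p L²<t tB<p) equations<unknowns u
      (λ {i} {j} i<h j<h q → inj i<h j<h (trans (sym (orbit≡ f u i)) (trans q (orbit≡ f u j))))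
      (λ i i<h q → 0∉S (subst (_∈ S) q (member i i<h)))
      (λ i i<h → trans (eval-X^ ∣ S ∣ (It.orbit f u i)) (subgroup-order 0∉S *-closed ⁻¹-closed (member i i<h)))
      M≤h)
    (degree-bound L²<t)
    where
    open Defs.IsSubgroup S-subgroup
    open SubgroupOrder discreteField
    open Parameters {n₁} {d ℕ.^ suc n₁} {B} {∣ S ∣} {p′} (ℕ.m^n>0 d {{ℕ.>-nonZero 0<d}} (suc n₁)) 2≤B
    member : ∀ i → i < h → It.orbit f u i ∈ S
    member i i<h = subst (_∈ S) (sym (orbit≡ f u i)) (u∈S i i<h)

-- Rational exponents and the cuts of real powers.

module RationalPowers where

  open import Data.Integer as ℤ using (+_; -[1+_])
  import Data.Integer.Properties as ℤ
  open import Data.Rational.Unnormalised using (mkℚᵘ)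
  import Data.Rational.Unnormalised as ℚᵘ
  import Data.Rational.Unnormalised.Properties as ℚᵘ
  open import Defs using (ℝ; fromℕ; _⊖_; _^ℝ_; _^ℤ_)
  open import Algebra.Properties.Semiring.Exp (CommutativeRing.semiring ℚ.+-*-commutativeRing) using
      (_^_; ^-assocʳ)

  toℚᵘ-fromℕ : ∀ n → toℚᵘ (fromℕ n) ℚᵘ.≃ mkℚᵘ (+ n) 0
  toℚᵘ-fromℕ n = ℚ.toℚᵘ-fromℚᵘ (mkℚᵘ (+ n) 0)

  fromℕ-mono-≤ : ∀ {m n} → m ℕ.≤ n → fromℕ m ℚ.≤ fromℕ n
  fromℕ-mono-≤ {m} {n} m≤n = ℚ.toℚᵘ-cancel-≤ (ℚᵘ.≤-respˡ-≃ (ℚᵘ.≃-sym (toℚᵘ-fromℕ m))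
    (ℚᵘ.≤-respʳ-≃ (ℚᵘ.≃-sym (toℚᵘ-fromℕ n)) (ℚᵘ.*≤* (ℤ.*-monoʳ-≤-nonNeg (+ 1) (ℤ.+≤+ m≤n)))))

  fromℕ-cancel-≤ : ∀ {m n} → fromℕ m ℚ.≤ fromℕ n → m ℕ.≤ n
  fromℕ-cancel-≤ {m} {n} p with ℚᵘ.≤-respˡ-≃ (toℚᵘ-fromℕ m) (ℚᵘ.≤-respʳ-≃ (toℚᵘ-fromℕ n) (ℚ.toℚᵘ-mono-≤ p))
  ... | ℚᵘ.*≤* q = ℤ.drop‿+≤+ (subst₂ ℤ._≤_ (ℤ.*-identityʳ (+ m)) (ℤ.*-identityʳ (+ n)) q)

  fromℕ-* : ∀ m n → fromℕ (m ℕ.* n) ≡ fromℕ m ℚ.* fromℕ n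
  fromℕ-* m n = ℚ.toℚᵘ-injective (ℚᵘ.≃-trans (toℚᵘ-fromℕ (m ℕ.* n))
      (ℚᵘ.≃-sym (ℚᵘ.≃-trans (ℚ.toℚᵘ-homo-* (fromℕ m) (fromℕ n))
    (ℚᵘ.≃-trans (ℚᵘ.*-cong (toℚᵘ-fromℕ m) (toℚᵘ-fromℕ n)) (ℚᵘ.*≡* (cong (ℤ._* + 1) (sym (ℤ.pos-* m n))))))))

  fromℕ-^ : ∀ m k → fromℕ (m ℕ.^ k) ≡ fromℕ m ^ k
  fromℕ-^ m zero    = refl
  fromℕ-^ m (suc k) = trans (fromℕ-* m (m ℕ.^ k)) (cong (fromℕ m ℚ.*_) (fromℕ-^ m k))

  0≤fromℕ : ∀ n → 0ℚ ℚ.≤ fromℕ n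
  0≤fromℕ n = fromℕ-mono-≤ {0} {n} ℕ.z≤n

  0<fromℕ : ∀ {n} → 0 ℕ.< n → 0ℚ ℚ.< fromℕ n
  0<fromℕ {n} 0<n = ℚ.≰⇒> λ p → ℕ.<⇒≱ 0<n (fromℕ-cancel-≤ {n} {0} p)

  ^-nonNeg : ∀ {x} k → 0ℚ ℚ.≤ x → 0ℚ ℚ.≤ x ^ k
  ^-nonNeg     zero    0≤x = fromℕ-mono-≤ {0} {1} ℕ.z≤n
  ^-nonNeg {x} (suc k) 0≤x = subst (ℚ._≤ x ℚ.* x ^ k) (ℚ.*-zeroʳ x)
    (ℚ.*-monoˡ-≤-nonNeg x {{ℚ.nonNegative 0≤x}} (^-nonNeg k 0≤x))

  ^-mono-≤ : ∀ {x y} k → 0ℚ ℚ.≤ x → x ℚ.≤ y → x ^ k ℚ.≤ y ^ k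
  ^-mono-≤         zero    0≤x x≤y = ℚ.≤-refl
  ^-mono-≤ {x} {y} (suc k) 0≤x x≤y = ℚ.≤-trans
    (ℚ.*-monoˡ-≤-nonNeg x {{ℚ.nonNegative 0≤x}} (^-mono-≤ k 0≤x x≤y))
    (ℚ.*-monoʳ-≤-nonNeg (y ^ k) {{ℚ.nonNegative (^-nonNeg k (ℚ.≤-trans 0≤x x≤y))}} x≤y)

  ^-pos : ∀ {x} k → 0ℚ ℚ.< x → 0ℚ ℚ.< x ^ k
  ^-pos     zero    0<x = 0<fromℕ {1} ℕ.z<s
  ^-pos {x} (suc k) 0<x = subst (ℚ._< x ℚ.* x ^ k) (ℚ.*-zeroʳ x)
    (ℚ.*-monoʳ-<-pos x {{ℚ.positive 0<x}} (^-pos k 0<x))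

  ^-mono-< : ∀ {x y} k → 0ℚ ℚ.≤ x → x ℚ.< y → x ^ suc k ℚ.< y ^ suc k
  ^-mono-< {x} {y} k 0≤x x<y = ℚ.≤-<-trans
    (ℚ.*-monoˡ-≤-nonNeg x {{ℚ.nonNegative 0≤x}} (^-mono-≤ k 0≤x (ℚ.<⇒≤ x<y)))
    (ℚ.*-monoˡ-<-pos (y ^ k) {{ℚ.positive (^-pos k (ℚ.≤-<-trans 0≤x x<y))}} x<y)

  1^ : ∀ k → 1ℚ ^ k ≡ 1ℚ
  1^ zero    = refl
  1^ (suc k) = trans (ℚ.*-identityˡ (1ℚ ^ k)) (1^ k)

  1/n≤1 : ∀ n .{{_ : NonZero n}} → (+ 1) ℚ./ n ℚ.≤ 1ℚ
  1/n≤1 (suc n) = ℚ.toℚᵘ-cancel-≤ (ℚᵘ.≤-respˡ-≃ (ℚᵘ.≃-sym (ℚ.toℚᵘ-fromℚᵘ (mkℚᵘ (+ 1) n)))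
    (ℚᵘ.*≤* (ℤ.+≤+ (ℕ.s≤s ℕ.z≤n))))

  0≤1/n : ∀ n .{{_ : NonZero n}} → 0ℚ ℚ.≤ (+ 1) ℚ./ n
  0≤1/n (suc n) = ℚ.toℚᵘ-cancel-≤ (ℚᵘ.≤-respʳ-≃ (ℚᵘ.≃-sym (ℚ.toℚᵘ-fromℚᵘ (mkℚᵘ (+ 1) n)))
    (ℚᵘ.*≤* (ℤ.+≤+ ℕ.z≤n)))

  ^ℤ-bound : ∀ n .{{_ : NonZero n}} a k e b → a ℤ.* + suc k ℤ.≤ + (e ℕ.* b) → (n ^ℤ a) ^ suc k ℚ.≤ fromℕ
      (n ℕ.^ e) ^ b
  ^ℤ-bound n a k e b a≤ = subst ((n ^ℤ a) ^ suc k ℚ.≤_)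
      (trans (cong fromℕ (sym (ℕ.^-*-assoc n e b))) (fromℕ-^ (n ℕ.^ e) b)) (bound a a≤)
    where
    bound : ∀ a → a ℤ.* + suc k ℤ.≤ + (e ℕ.* b) → (n ^ℤ a) ^ suc k ℚ.≤ fromℕ (n ℕ.^ (e ℕ.* b))
    bound (+ a) a≤ = subst (ℚ._≤ fromℕ (n ℕ.^ (e ℕ.* b)))
        (trans (cong fromℕ (sym (ℕ.^-*-assoc n a (suc k)))) (fromℕ-^ (n ℕ.^ a) (suc k)))
      (fromℕ-mono-≤ (ℕ.^-monoʳ-≤ n (ℤ.drop‿+≤+ (subst (ℤ._≤ + (e ℕ.* b)) (sym (ℤ.pos-* a (suc k))) a≤))))
    -- A negative exponent gives a value of at most 1, which every natural power of n ≥ 1 reaches.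
    bound -[1+ a ] _ = ℚ.≤-trans (^-mono-≤ (suc k) (0≤1/n (n ℕ.^ suc a) {{ℕ.m^n≢0 n (suc a)}})
        (1/n≤1 (n ℕ.^ suc a) {{ℕ.m^n≢0 n (suc a)}}))
      (subst (ℚ._≤ fromℕ (n ℕ.^ (e ℕ.* b))) (sym (1^ (suc k))) (fromℕ-mono-≤ {1} (ℕ.m^n>0 n (e ℕ.* b))))

  ^-comm : ∀ x i j → (x ^ i) ^ j ≡ (x ^ j) ^ i
  ^-comm x i j = trans (^-assocʳ x i j) (trans (cong (x ^_) (ℕ.*-comm i j)) (sym (^-assocʳ x j i)))

  -- The hypothesis on `a` says a / b ≤ e / (k + 1). Comparing b(k + 1)-th powers of `q` takes the
  -- place of extracting roots.
  root-bound : ∀ n .{{_ : NonZero n}} a k e b {q} → a ℤ.* + suc k ℤ.≤ + (e ℕ.* b) → 0ℚ ℚ.≤ q →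
               q ^ b ℚ.< n ^ℤ a → q ^ suc k ℚ.< fromℕ (n ℕ.^ e)
  root-bound n a k e b {q} a≤ 0≤q q^b< = ℚ.≰⇒> λ ≤q → ℚ.<-irrefl refl (begin-strict
    fromℕ (n ℕ.^ e) ^ b   ≤⟨ ^-mono-≤ b (0≤fromℕ (n ℕ.^ e)) ≤q ⟩
    (q ^ suc k) ^ b       ≡⟨ ^-comm q (suc k) b ⟩
    (q ^ b) ^ suc k       <⟨ ^-mono-< k (^-nonNeg b 0≤q) q^b< ⟩
    (n ^ℤ a) ^ suc k      ≤⟨ ^ℤ-bound n a k e b a≤ ⟩
    fromℕ (n ℕ.^ e) ^ b ∎)
    where open ℚ.≤-Reasoning

  -- A positive rational r is at least 1 / ↧ₙ r.
  exponent-bound : ∀ s r c e → 0ℚ ℚ.< r → suc e ≡ c ℕ.* ↧ₙ r → r ℚ.< fromℕ c ℚ.- s →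
                   ↥ s ℤ.* + ↧ₙ r ℤ.≤ + (e ℕ.* ↧ₙ s)
  exponent-bound s (mkℚ (+ zero)   k _) c e (ℚ.*<* (ℤ.+<+ ())) e≡ r<c-s
  exponent-bound s (mkℚ -[1+ _ ] k _) c e (ℚ.*<* ()) e≡ r<c-s
  exponent-bound s@(mkℚ a b-1 _) r@(mkℚ (+ suc x) k _) c e 0<r e≡ r<c-s with ℚᵘ.<-respʳ-≃ (toℚᵘ-fromℕ c)
      (ℚᵘ.<-respˡ-≃ (ℚ.toℚᵘ-homo-+ s r) (ℚ.toℚᵘ-mono-< s+r<c))
    where
    s+r<c : s ℚ.+ r ℚ.< fromℕ c
    s+r<c = subst (s ℚ.+ r ℚ.<_) (trans (ℚ.+-comm s (fromℕ c ℚ.- s)) (trans (ℚ.+-assoc (fromℕ c) (ℚ.- s) s)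
      (trans (cong (fromℕ c ℚ.+_) (ℚ.+-inverseˡ s)) (ℚ.+-identityʳ (fromℕ c))))) (ℚ.+-monoʳ-< s r<c-s)
  -- If `s` exceeded e / (k + 1), then adding `r`, at least 1 / (k + 1), would pass (e + 1) / (k +
  -- 1) = c.
  ... | ℚᵘ.*<* lt = ℤ.≮⇒≥ λ e*b< → ℤ.<-irrefl refl (begin-strict
      + (e ℕ.* b) ℤ.+ + b                        <⟨ ℤ.+-monoˡ-< (+ b) e*b< ⟩
      a ℤ.* + suc k ℤ.+ + b                      ≤⟨ ℤ.+-monoʳ-≤ (a ℤ.* + suc k)
          (ℤ.≤-trans (ℤ.+≤+ (ℕ.m≤n*m b (suc x))) (ℤ.≤-reflexive (ℤ.pos-* (suc x) b))) ⟩
      a ℤ.* + suc k ℤ.+ + suc x ℤ.* + b          ≡⟨ ℤ.*-identityʳ _ ⟨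
      (a ℤ.* + suc k ℤ.+ + suc x ℤ.* + b) ℤ.* + 1 <⟨ lt ⟩
      + c ℤ.* + (b ℕ.* suc k)                    ≡⟨ ℤ.pos-* c (b ℕ.* suc k) ⟨
      + (c ℕ.* (b ℕ.* suc k))                    ≡⟨ cong +_ nat ⟩
      + (e ℕ.* b ℕ.+ b)                          ≡⟨ ℤ.pos-+ (e ℕ.* b) b ⟩
      + (e ℕ.* b) ℤ.+ + b ∎)
    where
    open ℤ.≤-Reasoning
    b = suc b-1
    nat : c ℕ.* (b ℕ.* suc k) ≡ e ℕ.* b ℕ.+ b
    nat = trans (cong (c ℕ.*_) (ℕ.*-comm b (suc k))) (trans (sym (ℕ.*-assoc c (suc k) b))
      (trans (cong (ℕ._* b) (sym e≡)) (ℕ.+-comm b (e ℕ.* b))))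

  -- From s < c - ε and r < ε follows s < c - r, so the exponent `s` is at most e / `↧ₙ r`, where an
  -- inequality between natural numbers decides.
  cut-bound : ∀ (ε : ℝ) r → 0ℚ ℚ.< r → ℝ.lower ε r → ∀ n .{{_ : NonZero n}} c e → suc e ≡ c ℕ.* ↧ₙ r →
              ∀ {G} → n ℕ.^ e ℕ.≤ G ℕ.^ ↧ₙ r → ∀ {q} → (n ^ℝ (c ⊖ ε)) q → q ℚ.< fromℕ G
  cut-bound ε r 0<r r<ε n c e e≡ {G} n^e≤ (s , _ , inj₁ q<0) = ℚ.<-≤-trans q<0 (0≤fromℕ G)
  cut-bound ε r 0<r r<ε n c e e≡ {G} n^e≤ {q} (s , ε<c-s , inj₂ q^b<) = ℚ.≰⇒> λ G≤q → ℚ.<-irrefl refl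
      (begin-strict
    fromℕ (G ℕ.^ ↧ₙ r)   ≡⟨ fromℕ-^ G (↧ₙ r) ⟩
    fromℕ G ^ ↧ₙ r       ≤⟨ ^-mono-≤ (↧ₙ r) (0≤fromℕ G) G≤q ⟩
    q ^ ↧ₙ r             <⟨ root-bound n (↥ s) (ℚ.denominator-1 r) e (↧ₙ s)
        (exponent-bound s r c e 0<r e≡ r<c-s) (ℚ.≤-trans (0≤fromℕ G) G≤q) q^b< ⟩
    fromℕ (n ℕ.^ e)       ≤⟨ fromℕ-mono-≤ n^e≤ ⟩
    fromℕ (G ℕ.^ ↧ₙ r) ∎)
    where
    open ℚ.≤-Reasoning
    r<c-s : r ℚ.< fromℕ c ℚ.- s
    r<c-s with ℚ.<-cmp r (fromℕ c ℚ.- s)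
    ... | tri< lt _ _ = lt
    ... | tri≈ _ q _  = contradiction (subst (ℝ.upper ε) (sym q) ε<c-s) (ℝ.disjoint ε r<ε)
    ... | tri> _ _ gt = contradiction (ℝ.upper-closed ε gt ε<c-s) (ℝ.disjoint ε r<ε)

open import Defs
open import Relation.Nullary.Construct.Add.Supremum using (_⁺; [_]; ⊤⁺)
open RationalPowers

-- Periods, trajectory lengths and zeros in an orbit.

module _ {p : ℕ} .{{_ : NonZero p}} where

  orbit-+ : ∀ (f : Poly p) u s i → orbit f (orbit f u s) i ≡ orbit f u (i ℕ.+ s)
  orbit-+ f u s zero    = refl
  orbit-+ f u s (suc i) = cong (eval f) (orbit-+ f u s i)

  return⇒period : ∀ (f : Poly p) v r → 0 < r → orbit f v r ≡ v → IsPeriod f v r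
  return⇒period f v r 0<r q = 0<r , periodic
    where
    periodic : ∀ n → orbit f v n ≡ orbit f v (n ℕ.+ r)
    periodic zero    = sym q
    periodic (suc n) = cong (eval f) (periodic n)

  no-early-return : ∀ (f : Poly p) v 𝒫 → IsPeriodLength f v 𝒫 → ∀ {n} → fromℕ n ≤∞ 𝒫 →
                    ∀ r → 0 < r → r < n → orbit f v r ≢ v
  no-early-return f v [ m ] (_ , least) {n} n≤m r 0<r r<n q =
    ℕ.<⇒≱ r<n (ℕ.≤-trans (fromℕ-cancel-≤ {n} {m} n≤m) (least r (return⇒period f v r 0<r q)))
  no-early-return f v ⊤⁺ aperiodic _ r 0<r r<n q = aperiodic r (return⇒period f v r 0<r q)

  trajectory-injective : ∀ (f : Poly p) u {T} → IsTrajectoryLength f u T →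
                         ∀ {i j} → i < T → j < T → orbit f u i ≡ orbit f u j → i ≡ j
  trajectory-injective f u (_ , least) {i} {j} i<T j<T q with ℕ.<-cmp i j
  ... | tri< i<j _ _ = contradiction j<T (ℕ.≤⇒≯ (least j (i , i<j , q)))
  ... | tri≈ _ i≡j _ = i≡j
  ... | tri> _ _ j<i = contradiction i<T (ℕ.≤⇒≯ (least i (j , j<i , sym q)))

  -- As 0 occurs at most once, it is missing from the first or the second half of u₁, …, u_N.
  zero-free-half : ∀ (f : Poly p) u {N} h → h ℕ.+ h ≤ N →
    (∀ {i j} → i ≤ N → j ≤ N → orbit f u i ≡ orbit f u j → i ≡ j) →
    ∃[ s ] (1 ≤ s × h ℕ.+ s ≤ suc N × (∀ i → i < h → orbit f u (i ℕ.+ s) ≢ 0#))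
  zero-free-half f u {N} h 2h≤N inj with Fin.any? {h} (λ i → orbit f u (toℕ i ℕ.+ 1) Fin.≟ 0#)
  -- The segment starts at index 1, because the subgroup is only known to capture u₁, u₂, ....
  ... | no ¬q = 1 , s≤s z≤n , subst (_≤ suc N) (ℕ.+-comm 1 h) (s≤s (ℕ.≤-trans (ℕ.m≤m+n h h) 2h≤N)) ,
    λ i i<h q → ¬q (fromℕ< i<h , subst (λ j → orbit f u (j ℕ.+ 1) ≡ 0#) (sym (Fin.toℕ-fromℕ< i<h)) q)
  ... | yes (i₀ , q₀) = suc h , s≤s z≤n , subst (_≤ suc N) (sym (ℕ.+-suc h h)) (s≤s 2h≤N) , λ i i<h q →
    ℕ.<⇒≢ (i₀+1<i+1+h i) (inj (ℕ.≤-trans (ℕ.<⇒≤ (i₀+1<i+1+h i)) (i+1+h≤N i i<h)) (i+1+h≤N i i<h)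
        (trans q₀ (sym q)))
    where
    i₀+1<i+1+h : ∀ i → toℕ i₀ ℕ.+ 1 < i ℕ.+ suc h
    i₀+1<i+1+h i = ℕ.≤-trans (s≤s (ℕ.≤-trans (ℕ.≤-reflexive (ℕ.+-comm (toℕ i₀) 1)) (Fin.toℕ<n i₀)))
        (ℕ.m≤n+m (suc h) i)
    i+1+h≤N : ∀ i → i < h → i ℕ.+ suc h ≤ N
    i+1+h≤N i i<h = ℕ.≤-trans (ℕ.≤-reflexive (ℕ.+-suc i h)) (ℕ.≤-trans (ℕ.+-monoˡ-≤ h i<h) 2h≤N)

-- The integral form of the theorem and the passage to real exponents.

halve : ∀ N → ∃[ h ] (h ℕ.+ h ≤ N × N ≤ suc (h ℕ.+ h))
halve zero          = 0 , z≤n , z≤n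
halve (suc zero)    = 0 , z≤n , s≤s z≤n
halve (suc (suc N)) with halve N
... | h , 2h≤N , N≤ = suc h , subst (λ a → suc a ≤ suc (suc N)) (sym (ℕ.+-suc h h)) (s≤s (s≤s 2h≤N)) ,
  subst (λ a → suc (suc N) ≤ suc (suc a)) (sym (ℕ.+-suc h h)) (s≤s (s≤s N≤))

polynomials : ℕ → ℕ
polynomials k = suc (suc (4 ℕ.* k))

-- Bounds the degree of the product of the iterates, each of degree at most d ^ n.
degree : ℕ → ℕ → ℕ
degree k d = polynomials k ℕ.* d ℕ.^ polynomials k

0<degree : ∀ k d → 2 ≤ d → 0 < degree k d
0<degree k d 2≤d = ℕ.*-mono-< {0} {polynomials k} z<s
    (ℕ.m^n>0 d {{ℕ.>-nonZero (ℕ.<-trans z<s 2≤d)}} (polynomials k))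

-- The exponents 2 - 1 / (k + 1) and 1 - 1 / (k + 1), cleared of denominators by raising to the
-- power k + 1.
IntegralBound : (k d C : ℕ) → Set
IntegralBound k d C =
  ∀ {p′} → Prime (suc p′) → (f : Poly (suc p′)) → DegreeAtMost d f →
  (∀ r → 0 < r → r < polynomials k → orbit f 0# r ≢ 0#) → ∀ u T → IsTrajectoryLength f u T →
  ∀ N → N < T → ∀ g → IsG f u N g →
  N ℕ.^ suc (k ℕ.+ k) ≤ (C ℕ.* g) ℕ.^ suc k ⊎ suc p′ ℕ.^ k ≤ (C ℕ.* g) ℕ.^ suc k

module _ (k d : ℕ) (2≤d : 2 ≤ d) where

  open Exponents k (degree k d) (0<degree k d 2≤d) using (n; n₁; K; C; dichotomy)

  -- The estimate for subgroups needs a stretch of the orbit without 0. Halving `N` provides one of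
  -- length h with N ≤ 2h + 1, and its points are distinct members of `S`, whence h ≤ `∣ S ∣`.
  integral-bound : IntegralBound k d C
  integral-bound {p′} p-prime f deg-f aperiodic u T T-length N N<T g (S , (S-subgroup , u∈S , _) , ∣S∣≡g) =
    subst (λ g → N ℕ.^ suc (k ℕ.+ k) ≤ (C ℕ.* g) ℕ.^ suc k ⊎ suc p′ ℕ.^ k ≤ (C ℕ.* g) ℕ.^ suc k) ∣S∣≡g
      (split (halve N))
    where
    N-injective : ∀ {i j} → i ≤ N → j ≤ N → orbit f u i ≡ orbit f u j → i ≡ j
    N-injective i≤N j≤N = trajectory-injective f u T-length (ℕ.≤-<-trans i≤N N<T) (ℕ.≤-<-trans j≤N N<T)

    0<∣S∣ : 0 < ∣ S ∣
    0<∣S∣ = injective⇒≤∣∣ {M = 1} S (λ _ → 1#) (λ { {Fin.zero} {Fin.zero} _ → refl })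
        (λ _ → IsSubgroup.1∈S S-subgroup)

    module Segment {h s} (1≤s : 1 ≤ s) (h+s≤1+N : h ℕ.+ s ≤ suc N)
        (nonzero : ∀ i → i < h → orbit f u (i ℕ.+ s) ≢ 0#) where
      i+s≤N : ∀ {i} → i < h → i ℕ.+ s ≤ N
      i+s≤N i<h = ℕ.≤-pred (ℕ.≤-trans (ℕ.+-monoˡ-≤ s i<h) h+s≤1+N)
      inj : ∀ {i j} → i < h → j < h → orbit f u (i ℕ.+ s) ≡ orbit f u (j ℕ.+ s) → i ≡ j
      inj {i} {j} i<h j<h q = ℕ.+-cancelʳ-≡ s i j (N-injective (i+s≤N i<h) (i+s≤N j<h) q)
      member : ∀ i → i < h → orbit f u (i ℕ.+ s) ∈ S
      member i i<h = u∈S (i ℕ.+ s) (ℕ.≤-trans 1≤s (ℕ.m≤n+m s i)) (i+s≤N i<h) (nonzero i i<h)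
      h≤∣S∣ : h ≤ ∣ S ∣
      h≤∣S∣ = injective⇒≤∣∣ S (λ (i : Fin h) → orbit f u (toℕ i ℕ.+ s))
        (λ {i} {j} q → Fin.toℕ-injective (inj (Fin.toℕ<n i) (Fin.toℕ<n j) q))
            (λ i → member (toℕ i) (Fin.toℕ<n i))
      bound : ∀ {B M} → 2 ≤ B → K ℕ.* (B ℕ.^ n ℕ.* B ℕ.^ n) < ∣ S ∣ → K ℕ.* ∣ S ∣ ℕ.* B < suc p′ →
              n ℕ.+ suc M ≤ h → suc M ℕ.* B ℕ.^ n₁ ≤ K ℕ.* ∣ S ∣ ℕ.* B
      bound {B} {M} 2≤B L²<t tB<p M≤h = OrbitsModulo.subgroup-bound p-prime {n₁} {d} {B} {M} {h} f deg-f
        (ℕ.<-trans z<s 2≤d) aperiodic S-subgroup 2≤B L²<t tB<p (orbit f u s)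
        (λ {i} {j} i<h j<h q → inj i<h j<h (trans (sym (orbit-+ f u s i)) (trans q (orbit-+ f u s j))))
        (λ i i<h → subst (_∈ S) (sym (orbit-+ f u s i)) (member i i<h)) M≤h

    split : ∃[ h ] (h ℕ.+ h ≤ N × N ≤ suc (h ℕ.+ h)) →
            N ℕ.^ suc (k ℕ.+ k) ≤ (C ℕ.* ∣ S ∣) ℕ.^ suc k ⊎ suc p′ ℕ.^ k ≤ (C ℕ.* ∣ S ∣) ℕ.^ suc k
    split (h , 2h≤N , N≤) = finish (zero-free-half f u h 2h≤N N-injective)
      where
      finish : ∃[ s ] (1 ≤ s × h ℕ.+ s ≤ suc N × (∀ i → i < h → orbit f u (i ℕ.+ s) ≢ 0#)) →
               N ℕ.^ suc (k ℕ.+ k) ≤ (C ℕ.* ∣ S ∣) ℕ.^ suc k ⊎ suc p′ ℕ.^ k ≤ (C ℕ.* ∣ S ∣) ℕ.^ suc k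
      finish (s , 1≤s , h+s≤1+N , nonzero) = dichotomy 0<∣S∣ z<s N≤ h≤∣S∣ bound
        where open Segment {h} {s} 1≤s h+s≤1+N nonzero

module Conclusion (ε : ℝ) {r : ℚ} (0<r : 0ℚ <ℚ r) (r<ε : ℝ.lower ε r) {d C : ℕ} (0<C : 0 < C)
  (integral-bound : IntegralBound (ℚ.denominator-1 r) d C) where

  private
    k = ℚ.denominator-1 r
    instance
      C-pos : ℚ.Positive (fromℕ C)
      C-pos = ℚ.positive (0<fromℕ 0<C)
      C-nonZero : ℚ.NonZero (fromℕ C)
      C-nonZero = ℚ.pos⇒nonZero (fromℕ C)

  c₂ : ℚ
  c₂ = ℚ.1/ fromℕ C

  c₂-pos : ℚ.Positive c₂
  c₂-pos = ℚ.1/pos⇒pos (fromℕ C)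

  2[1+k] : suc (suc (k ℕ.+ k)) ≡ 2 ℕ.* suc k
  2[1+k] = identity k
    where
    identity : ∀ k → suc (suc (k ℕ.+ k)) ≡ 2 ℕ.* suc k
    identity = solve-∀

  conclusion : (p : ℕ) .{{_ : NonZero p}} → Prime p → (f : Poly p) → DegreeAtMost d f →
    (𝒫₀ : ℕ ⁺) → IsPeriodLength f 0# 𝒫₀ → fromℕ (polynomials k) ≤∞ 𝒫₀ →
    (u : 𝔽 p) (T : ℕ) → IsTrajectoryLength f u T → (N : ℕ) .{{_ : NonZero N}} → N < T →
    (g : ℕ) → IsG f u N g → c₂ · min (N ^ℝ (2 ⊖ ε)) (p ^ℝ (1 ⊖ ε)) ≤ᴸ g
  conclusion zero p-prime = contradiction p-prime ¬prime[0]
  conclusion p@(suc p′) p-prime f deg-f 𝒫₀ 𝒫₀-length n≤𝒫₀ u T T-length N N<T g g-size q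
      (x , (x∈N , x∈p) , q≤c₂x) = begin-strict
    q                                   ≤⟨ q≤c₂x ⟩
    c₂ ℚ.* x                            <⟨ ℚ.*-monoʳ-<-pos c₂ {{c₂-pos}} x<Cg ⟩
    c₂ ℚ.* fromℕ (C ℕ.* g)              ≡⟨ cong (c₂ ℚ.*_) (fromℕ-* C g) ⟩
    c₂ ℚ.* (fromℕ C ℚ.* fromℕ g)        ≡⟨ ℚ.*-assoc c₂ (fromℕ C) (fromℕ g) ⟨
    c₂ ℚ.* fromℕ C ℚ.* fromℕ g          ≡⟨ cong (ℚ._* fromℕ g) (ℚ.*-inverseˡ (fromℕ C)) ⟩
    1ℚ ℚ.* fromℕ g                      ≡⟨ ℚ.*-identityˡ (fromℕ g) ⟩
    fromℕ g                             ∎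
    where
    open ℚ.≤-Reasoning
    -- A rational below the minimum lies in both cuts, so either alternative suffices; 2k + 1 and k
    -- are c(k + 1) - 1 for c = 2 and c = 1.
    x<Cg : x ℚ.< fromℕ (C ℕ.* g)
    x<Cg = [ (λ N≤ → cut-bound ε r 0<r r<ε N 2 (suc (k ℕ.+ k)) 2[1+k] {C ℕ.* g} N≤ x∈N)
           , (λ p≤ → cut-bound ε r 0<r r<ε p 1 k (sym (ℕ.*-identityˡ (suc k))) {C ℕ.* g} p≤ x∈p) ]′
      (integral-bound p-prime f deg-f (no-early-return f 0# 𝒫₀ 𝒫₀-length n≤𝒫₀) u T T-length N N<T g g-size)

corollary1p2 : (ε : ℝ) → Positive ε → (d : ℕ) → 2 ≤ d →
    ∃[ c₁ ] ∃[ c₂ ] (0ℚ <ℚ c₁ × 0ℚ <ℚ c₂ ×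
    ((p : ℕ) .{{_ : NonZero p}} → Prime p →
    (f : Poly p) → DegreeAtMost d f →
    (𝒫₀ : ℕ ⁺) → IsPeriodLength f 0# 𝒫₀ → c₁ ≤∞ 𝒫₀ →
    (u : 𝔽 p) (T : ℕ) → IsTrajectoryLength f u T →
    (N : ℕ) .{{_ : NonZero N}} → N < T →
    (g : ℕ) → IsG f u N g →
    c₂ · min (N ^ℝ (2 ⊖ ε)) (p ^ℝ (1 ⊖ ε)) ≤ᴸ g))
corollary1p2 ε 0<ε d 2≤d =
  -- The period of 0 has to reach the number of iterates, which makes them pairwise coprime.
  fromℕ (polynomials k) , c₂ , 0<fromℕ {polynomials k} z<s , ℚ.positive⁻¹ c₂ {{c₂-pos}} , conclusion
  where
  -- Openness of the lower cut at 0 yields a rational 0 < r < ε; its denominator k + 1 satisfies 1 /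
  -- (k + 1) ≤ r and fixes the exponents.
  r = proj₁ (ℝ.lower-open ε 0<ε)
  k = ℚ.denominator-1 r
  open Conclusion ε (proj₁ (proj₂ (ℝ.lower-open ε 0<ε))) (proj₂ (proj₂ (ℝ.lower-open ε 0<ε)))
    (Exponents.0<C k (degree k d) (0<degree k d 2≤d)) (integral-bound k d 2≤d)
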